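{- Let $d,n$ be positive integers with $1\le d\le n$. Then the following hold: (1) For every strictly monotone Ferrers diagram $\mathcal{D}$ of order $n$ and every finite field $\mathbb{F}$, there exists a $[\mathcal{D},\nu_{\min}(\mathcal{D},d),d]_{\mathbb{F}}$ code. (2) For every initially convex Ferrers diagram $\mathcal{D}$ of order $n$ and every finite field $\mathbb{F}$, there exists a $[\mathcal{D},\nu_{\min}(\mathcal{D},d),d]_{\mathbb{F}}$ code.
   Context: Write $[n]=\{1,\ldots,n\}$. A (top-right justified) Ferrers diagram of order $n$ is a subset $\mathcal{D}\subseteq[n]^2$ such that: if $(i,j)\in\mathcal{D}$ and $j\le j'\le n$, then $(i,j')\in\mathcal{D}$; and if $(i,j)\in\mathcal{D}$ and $1\le i'\le i$, then $(i',j)\in\mathcal{D}$. It is identified with the vector $(c_1,\ldots,c_n)$, $c_j=|\{i\in[n]:(i,j)\in\mathcal{D}\}|$, so $0\le c_1\le\cdots\le c_n\le n$ and $\mathcal{D}=\{(i,j)\in[n]^2: i\le c_j\}$. For a field $\mathbb{F}$, $\mathbb{F}^{\mathcal{D}}$ is the space of matrices $(a_{i,j})\in\mathbb{F}^{n\times n}$ with $a_{i,j}=0$ for all $(i,j)\notin\mathcal{D}$. A $[\mathcal{D},k,d]_{\mathbb{F}}$ (Ferrers diagram rank-metric) code is a $k$-dimensional $\mathbb{F}$-subspace $\mathcal{C}\subseteq\mathbb{F}^{\mathcal{D}}$ whose minimum rank distance $\min\{\operatorname{rk}(A):A\in\mathcal{C},A\ne0\}$ equals $d$. (Convention: for $k=0$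 the zero subspace counts as a $[\mathcal{D},0,d]_{\mathbb{F}}$ code.) Define $$\nu_{\min}(\mathcal{D},d)=\min_{0\le j\le d-1}\ \sum_{i=1}^{n-j}\max\{0,c_i-d+1+j\}.$$ The diagram $\mathcal{D}=(c_1,\ldots,c_n)$ is strictly monotone if for every $i\in\{1,\ldots,n-1\}$ with $c_i>0$ one has $c_{i+1}>c_i$. It is initially convex if $c_1\le1$ and $c_{i+1}-c_i\le1$ for every $i\in\{1,\ldots,n-1\}$. -}

module Defs where

open import Algebra.Apartness.Bundles using (HeytingField; HeytingCommutativeRing)
open import Algebra.Bundles using (Ring; CommutativeRing)
open import Algebra.Module.Bundles using (LeftModule)
import Algebra.Construct.Pointwise as Pointwise
import Algebra.Definitions.RawMonoid as RawMonoidSum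
import Algebra.Module.Construct.TensorUnit as TensorUnit
open import Data.Fin.Base as Fin using (Fin; toℕ; inject≤)
open import Data.Fin.Subset using (Subset; ∣_∣; _∈_; _∉_)
open import Data.List.Base using (map; tabulate; upTo)
open import Data.List.Extrema.Nat using (min)
open import Data.Nat.Base using (ℕ; suc; _+_; _∸_; _≤_; _<_)
open import Data.Nat.ListAction using (sum)
open import Data.Nat.Properties using (m∸n≤m)
open import Data.Product.Base using (∃; _×_; _,_)
open import Data.Sum.Base using (_⊎_)
open import Data.Vec.Functional using (Vector; transpose)
open import Function.Bundles using (Bijection)
open import Level using (Level; _⊔_)
open import Relation.Binary.Bundles using (Setoid)
open import Relation.Binary.PropositionalEquality.Core using (_≡_)
import Relation.Binary.PropositionalEquality.Properties as ≡
open import Relation.Nullary.Negation.Core using (¬_)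
import Relation.Unary as U
open U using (Pred)

private
  variable
    a c ℓ ℓ₁ ℓ₂ m ℓm p r ℓr : Level

-- Rows and columns are numbered from 0, row 0 being the top row and column
-- n - 1 the rightmost one; `column j` is { i | (i , j) ∈ 𝒟 }.
record FerrersDiagram (n : ℕ) : Set where
  field
    column          : Fin n → Subset n
    right-justified : ∀ {i j j′} → i ∈ column j → j Fin.≤ j′ → i ∈ column j′
    top-justified   : ∀ {i i′ j} → i ∈ column j → i′ Fin.≤ i → i′ ∈ column j

  height : Fin n → ℕ
  height j = ∣ column j ∣

module _ {n : ℕ} (𝒟 : FerrersDiagram n) where
  open FerrersDiagram 𝒟

  -- In both conditions, i and i′ stand for consecutive columns.
  StrictlyMonotone : Set
  StrictlyMonotone = ∀ {i i′} → toℕ i′ ≡ suc (toℕ i) → 0 < height i → height i < height i′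

  InitiallyConvex : Set
  InitiallyConvex = (∀ {i} → toℕ i ≡ 0 → height i ≤ 1)
                  × (∀ {i i′} → toℕ i′ ≡ suc (toℕ i) → height i′ ≤ suc (height i))

  -- The truncated subtraction (cᵢ + (1 + j)) ∸ d is max {0 , cᵢ - d + 1 + j}.
  ν : (d j : ℕ) → ℕ
  ν d j = sum (tabulate {n = n ∸ j} λ i → (height (inject≤ i (m∸n≤m n j)) + suc j) ∸ d)

  -- The minimum over 0 ≤ j ≤ d - 1; it is meaningful for d ≥ 1, when the
  -- default value ν d 0 of `min` is already a member of the list.
  νmin : (d : ℕ) → ℕ
  νmin d = min (ν d 0) (map (ν d) (upTo d))

module _ {R : Ring r ℓr} (M : LeftModule R m ℓm) where
  open Ring R using (Carrier; _≈_; 0#)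
  open LeftModule M

  record IsSubspace (P : Pred Carrierᴹ p) : Set (r ⊔ m ⊔ ℓm ⊔ p) where
    field
      resp-≈ᴹ   : ∀ {x y} → x ≈ᴹ y → P x → P y
      0ᴹ-closed : P 0ᴹ
      +ᴹ-closed : ∀ {x y} → P x → P y → P (x +ᴹ y)
      *ₗ-closed : ∀ s {x} → P x → P (s *ₗ x)

  combination : ∀ {k} → Vector Carrier k → Vector Carrierᴹ k → Carrierᴹ
  combination s v = RawMonoidSum.sum +ᴹ-rawMonoid (λ i → s i *ₗ v i)

  Span : ∀ {k} → Vector Carrierᴹ k → Pred Carrierᴹ (r ⊔ ℓm)
  Span v x = ∃ λ s → combination s v ≈ᴹ x

  LinearlyIndependent : ∀ {k} → Vector Carrierᴹ k → Set (r ⊔ ℓr ⊔ ℓm)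
  LinearlyIndependent v = ∀ s → combination s v ≈ᴹ 0ᴹ → ∀ i → s i ≈ 0#

  record IsBasis (P : Pred Carrierᴹ p) {k : ℕ} (v : Vector Carrierᴹ k)
                 : Set (r ⊔ ℓr ⊔ m ⊔ ℓm ⊔ p) where
    field
      members     : ∀ i → P (v i)
      independent : LinearlyIndependent v
      spanning    : ∀ {x} → P x → Span v x

  HasDimension : Pred Carrierᴹ p → ℕ → Set (r ⊔ ℓr ⊔ m ⊔ ℓm ⊔ p)
  HasDimension P k = ∃ λ (v : Vector Carrierᴹ k) → IsBasis P v

  power : (I : Set a) → LeftModule R (a ⊔ m) (a ⊔ ℓm)
  power I = record
    { Carrierᴹ     = I → Carrierᴹ
    ; _≈ᴹ_         = λ f g → ∀ i → f i ≈ᴹ g i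
    ; _+ᴹ_         = λ f g i → f i +ᴹ g i
    ; _*ₗ_         = λ s f i → s *ₗ f i
    ; 0ᴹ           = λ _ → 0ᴹ
    ; -ᴹ_          = λ f i → -ᴹ f i
    ; isLeftModule = record
      { isLeftSemimodule = record
        { +ᴹ-isCommutativeMonoid = Pointwise.isCommutativeMonoid I +ᴹ-isCommutativeMonoid
        ; isPreleftSemimodule    = record
          { *ₗ-cong      = λ s≈t f≈g i → *ₗ-cong s≈t (f≈g i)
          ; *ₗ-zeroˡ     = λ f i → *ₗ-zeroˡ (f i)
          ; *ₗ-distribʳ  = λ f s t i → *ₗ-distribʳ (f i) s t
          ; *ₗ-identityˡ = λ f i → *ₗ-identityˡ (f i)
          ; *ₗ-assoc     = λ s t f i → *ₗ-assoc s t (f i)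
          ; *ₗ-zeroʳ     = λ s i → *ₗ-zeroʳ s
          ; *ₗ-distribˡ  = λ s f g i → *ₗ-distribˡ s (f i) (g i)
          }
        }
      ; -ᴹ‿cong    = λ f≈g i → -ᴹ‿cong (f≈g i)
      ; -ᴹ‿inverse = (λ f i → -ᴹ‿inverseˡ (f i)) , (λ f i → -ᴹ‿inverseʳ (f i))
      }
    }

IsFinite : Setoid c ℓ → Set (c ⊔ ℓ)
IsFinite S = ∃ λ q → Bijection S (≡.setoid (Fin q))

-- A field is a Heyting field: x # y says that x - y is invertible, and 0# is
-- not invertible because # is irreflexive.  When `setoid` is finite, _≈_ is
-- decidable and x # y is equivalent to ¬ (x ≈ y), so that finite Heyting
-- fields are exactly the finite fields.
module _ (𝔽 : HeytingField c ℓ₁ ℓ₂) where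
  open HeytingField 𝔽 using (Carrier; _≈_; 0#; heytingCommutativeRing)
  open CommutativeRing (HeytingCommutativeRing.commutativeRing heytingCommutativeRing)
    using (ring; setoid)

  IsFiniteField : Set (c ⊔ ℓ₁)
  IsFiniteField = IsFinite setoid

  vectors : ℕ → LeftModule ring c ℓ₁
  vectors n = power (TensorUnit.leftModule {R = ring}) (Fin n)

  matrices : ℕ → LeftModule ring c ℓ₁
  matrices n = power (vectors n) (Fin n)

  -- A i j is the entry in row i and column j.
  Matrix : ℕ → Set c
  Matrix n = Vector (Vector Carrier n) n

  ColumnSpace : ∀ {n} → Matrix n → Pred (Vector Carrier n) (c ⊔ ℓ₁)
  ColumnSpace {n} A = Span (vectors n) (transpose A)

  HasRank : ∀ {n} → Matrix n → ℕ → Set (c ⊔ ℓ₁)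
  HasRank {n} A = HasDimension (vectors n) (ColumnSpace A)

  -- Supported 𝒟 is the space 𝔽^𝒟.
  Supported : ∀ {n} → FerrersDiagram n → Pred (Matrix n) ℓ₁
  Supported 𝒟 A = ∀ {i j} → i ∉ FerrersDiagram.column 𝒟 j → A i j ≈ 0#

  NonzeroRank : ∀ {n} → Pred (Matrix n) p → Pred ℕ (c ⊔ ℓ₁ ⊔ p)
  NonzeroRank {n = n} C ρ = ∃ λ A → C A × ¬ (A ≈ᴹ 0ᴹ) × HasRank A ρ
    where open LeftModule (matrices n)

  HasMinimumRankDistance : ∀ {n} → Pred (Matrix n) p → ℕ → Set (c ⊔ ℓ₁ ⊔ p)
  HasMinimumRankDistance C d = NonzeroRank C d × (∀ {ρ} → NonzeroRank C ρ → d ≤ ρ)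

  -- The zero subspace has no nonzero element, hence no minimum rank distance;
  -- by convention it is a code for every d.
  record IsCode {n : ℕ} (𝒟 : FerrersDiagram n) (k d : ℕ) (C : Pred (Matrix n) p)
                : Set (c ⊔ ℓ₁ ⊔ p) where
    field
      isSubspace      : IsSubspace (matrices n) C
      supported       : C U.⊆ Supported 𝒟
      dimension       : HasDimension (matrices n) C k
      minimumDistance : k ≡ 0 ⊎ HasMinimumRankDistance C d

  ExistsCode : ∀ {n} → FerrersDiagram n → (k d : ℕ) → Set (Level.suc (c ⊔ ℓ₁))
  ExistsCode {n} 𝒟 k d = ∃ λ (C : Pred (Matrix n) (c ⊔ ℓ₁)) → IsCode 𝒟 k d C

{-# OPTIONS --safe #-}
module Submission where

-- Let q = |F| and let K be a finite extension of F containing a chain e₀ = 1, …, eₙ₋₁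
-- with Δ eⱼ₊₁ = eⱼ, where Δ x = x^q - x.  Since ker Δ = F, the first b elements of the
-- chain span ker Δ^b, and by the Leibniz rule the product of ker Δ^a and ker Δ^b lies in
-- ker Δ^(a + b - 1).  Hence x ↦ eₗ Δ^i x with l < cᵢ maps ker Δ^(j + 1) into ker Δ^cⱼ for
-- all j when c is strictly monotone: in the basis e its matrix is supported on the diagram.
-- A nonzero operator Σ αᵢ Δ^i with i ≤ n - d has a kernel of dimension at most n - d, so
-- the combinations of these matrices with i ≤ n - d have rank at least d, and Δ^(n - d)
-- has rank exactly d.  There are c₀ + … + c_{n-d} = ν(d - 1) ≥ νmin of them.
--
-- K is generated by a solution of Δ^(n-1) x = 1: composing companion matrices gives an
-- operator X on a finite F-space with Δ^(n-1) X = 1, and F[X] acts through a field on a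
-- vector whose annihilator is minimal.
--
-- Reflection in the antidiagonal turns initially convex diagrams into strictly monotone
-- ones and ν(0) into ν(d - 1).

open import Defs
open import Level using (Level; _⊔_)
open import Algebra.Apartness.Bundles using (HeytingField; HeytingCommutativeRing)
open import Algebra.Bundles using (CommutativeMonoid; CommutativeRing; Ring)
open import Algebra.Module.Bundles using (LeftModule)
import Algebra.Module.Construct.TensorUnit as TensorUnit
import Algebra.Properties.AbelianGroup as AbelianGroupProperties
import Algebra.Properties.CommutativeMonoid.Sum as CommutativeMonoidSum
import Algebra.Properties.CommutativeSemigroup as CommutativeSemigroupProperties
import Algebra.Properties.CommutativeSemiring.Binomial as Binomial
import Algebra.Properties.CommutativeSemiring.Exp as CommutativeSemiringExp
import Algebra.Properties.Group as GroupProperties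
import Algebra.Properties.Ring as RingProperties
import Algebra.Properties.Semiring.Mult as SemiringMult
import Algebra.Properties.Semiring.Sum as SemiringSum
import Algebra.Solver.Ring.NaturalCoefficients.Default as SemiringSolver
import Data.Bool.Base as Bool
open import Data.Empty using (⊥)
open import Data.Fin.Base as Fin using (Fin; zero; suc; toℕ; fromℕ; inject₁; punchIn; finToFun; funToFin)
import Data.Fin.Properties as Fin
open import Data.Fin.Permutation using (permutation)
open import Data.Fin.Subset using (Subset; ∣_∣; _∈_; _∉_)
open import Data.Fin.Subset.Properties using (∣p∣≤n; p⊆q⇒∣p∣≤∣q∣)
open import Data.List.Base as List using (List; []; _∷_)
open import Data.List.Extrema.Nat using (min≤xs)
open import Data.List.Membership.Propositional.Properties using (∈-map⁺; ∈-upTo⁺)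
open import Data.List.Relation.Unary.All using (lookup)
open import Data.Nat.Base as ℕ using (ℕ; zero; suc; _≤_)
open import Data.Nat.Combinatorics using (_C_; nCn≡1)
import Data.Nat.ListAction as ListAction
import Data.Nat.Properties as ℕ
open import Data.Product.Base using (∃; _×_; _,_; proj₁; proj₂)
open import Data.Sum.Base as Sum using (_⊎_; inj₁; inj₂)
import Data.Vec.Base as Vec
open import Data.Vec.Functional as Vector using (Vector; head; tail; init; last; toList; transpose)
open import Data.Vec.Functional.Properties using (insertAt-lookup; insertAt-punchIn)
open import Function.Base using (_∘_; id)
open import Function.Bundles using (Bijection; Inverse)
open import Function.Properties.Bijection using (Bijection⇒Inverse)
open import Relation.Binary.Bundles using (Setoid)
open import Relation.Binary.Definitions using (Decidable; _Respects_; tri<; tri≈; tri>)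
open import Relation.Binary.PropositionalEquality.Core as ≡ using (_≡_; _≢_)
import Relation.Binary.PropositionalEquality.Properties as ≡
open import Relation.Binary.Structures using (IsEquivalence)
import Relation.Binary.Reasoning.Setoid as SetoidReasoning
open import Relation.Nullary using (Dec; yes; no; ¬_; contradiction)
open import Relation.Nullary.Decidable using (map′; ¬?; _×-dec_; decidable-stable)
import Relation.Unary as U

-- The extension of F of degree n contains such a chain only when n is a power of the
-- characteristic. For this reason K may have any degree, and the matrices describe operators on the
-- n-dimensional F-subspace ker Δ^n of K. Multiplication by eₗ need not preserve this subspace; the
-- heights of the diagram single out products that stay inside it.
--
-- Every subfamily of the operators inherits the lower bound on the rank, so the dimension is
-- brought from ν(d - 1) down to νmin by dropping operators. The one that must be kept is Δ^(n - d),
-- which supplies a codeword of rank exactly d.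
--
-- No irreducible polynomial is exhibited for K. Finiteness does the work three times: by pigeonhole
-- some polynomial annihilates a nonzero vector, exhaustive search finds the least length at which
-- this happens, and a finite domain has inverses.

private
  variable
    a c p ℓ ℓ₁ ℓ₂ : Level
    A : Set a
    n : ℕ

-- Finite sets and fields

Enumeration : Setoid a ℓ → ℕ → Set (a ⊔ ℓ)
Enumeration S N = Inverse S (≡.setoid (Fin N))

module Enumerated {S : Setoid a ℓ} {N : ℕ} (enumeration : Enumeration S N) where
  open Setoid S
  open Inverse enumeration using (to; from; to-cong) renaming
    ( strictlyInverseˡ to to-from
    ; strictlyInverseʳ to from-to
    ) public

  to-injective : ∀ {x y} → to x ≡ to y → x ≈ y
  to-injective {x} {y} eq =
    trans (sym (from-to x)) (trans (reflexive (≡.cong from eq)) (from-to y))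

  from-injective : ∀ {i j} → from i ≈ from j → i ≡ j
  from-injective {i} {j} eq =
    ≡.trans (≡.sym (to-from i)) (≡.trans (to-cong eq) (to-from j))

  _≟_ : Decidable _≈_
  x ≟ y = map′ to-injective to-cong (to x Fin.≟ to y)

  any? : {P : U.Pred Carrier p} → P Respects _≈_ → U.Decidable P → Dec (∃ P)
  any? resp P? = map′ (λ (i , Pi) → from i , Pi)
                      (λ (x , Px) → to x , resp (sym (from-to x)) Px)
                      (Fin.any? (P? ∘ from))

-- A setoid carries the proof that its relation is an equivalence. Quantifying over that proof makes
-- the result fit the setoid of any module whose equality is pointwise.
enumerate-power : {S : Setoid a ℓ} {N : ℕ} (m : ℕ) → Enumeration S N →
                  {isEquivalence : IsEquivalence λ (f g : Vector (Setoid.Carrier S) m) → ∀ i → Setoid._≈_ S (f i) (g i)} →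
                  Enumeration (record { isEquivalence = isEquivalence }) (N ℕ.^ m)
enumerate-power {S = S} {N = N} m E = record
  { to        = λ f → funToFin (to ∘ f)
  ; from      = λ i → from ∘ finToFun i
  ; to-cong   = λ e → funToFin-cong _ _ (λ i → to-cong (e i))
  ; from-cong = λ { ≡.refl i → refl }
  ; inverse   =
      (λ {i} {f} e → ≡.trans (funToFin-cong _ _ λ j →
                        ≡.trans (to-cong (e j)) (to-from (finToFun i j)))
                      (Fin.funToFin-finToFin {m} i))
    , (λ { {f} ≡.refl i → trans (reflexive (≡.cong from (Fin.finToFun-funToFin (to ∘ f) i)))
                                (from-to (f i)) })
  }
  where
  open Setoid S
  open Enumerated E
  funToFin-cong : ∀ {k} (f g : Fin k → Fin N) → (∀ i → f i ≡ g i) → funToFin f ≡ funToFin g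
  funToFin-cong {zero}  f g e = ≡.refl
  funToFin-cong {suc k} f g e =
    ≡.cong₂ Fin.combine (e zero) (funToFin-cong (f ∘ suc) (g ∘ suc) (e ∘ suc))

module _ (M : CommutativeMonoid a ℓ) where
  open CommutativeMonoid M
  open CommutativeMonoidSum M

  sum-single : (t : Vector Carrier n) (i : Fin n) → (∀ j → j ≢ i → t j ≈ ε) → sum t ≈ t i
  sum-single {suc n} t i off = trans (sum-remove {i = i} t)
    (trans (∙-congˡ (trans (sum-cong-≋ λ j → off (punchIn i j) (Fin.punchInᵢ≢i i j))
                           (sum-replicate-zero n)))
           (identityʳ (t i)))

-- Nonzero means negated equality here, so that the given Heyting field and the quotients of
-- polynomials built below are both instances.
record DiscreteField c ℓ : Set (Level.suc (c ⊔ ℓ)) where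
  field
    commutativeRing : CommutativeRing c ℓ
  open CommutativeRing commutativeRing public hiding (zero)
  field
    _≟_     : Decidable _≈_
    1≉0     : ¬ 1# ≈ 0#
    inverse : ∀ x → ¬ x ≈ 0# → ∃ λ y → x * y ≈ 1#

  open SemiringSum semiring public
  open SemiringMult semiring public using ()
    renaming (_×_ to _⋆_; ×-congʳ to ⋆-congʳ; ×-assoc-* to ⋆-assoc-*)
  open CommutativeSemiringExp commutativeSemiring public
  open GroupProperties +-group public
    using () renaming (x∙y⁻¹≈ε⇒x≈y to x-y≈0⇒x≈y; x≈y⇒x∙y⁻¹≈ε to x≈y⇒x-y≈0)

  open SetoidReasoning setoid

  *-cancelˡ : ∀ x {y z} → ¬ x ≈ 0# → x * y ≈ x * z → y ≈ z
  *-cancelˡ x {y} {z} x≉0 eq with inverse x x≉0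
  ... | x⁻¹ , xx⁻¹≈1 = begin
    y              ≈⟨ unit y ⟨
    x⁻¹ * (x * y)  ≈⟨ *-congˡ eq ⟩
    x⁻¹ * (x * z)  ≈⟨ unit z ⟩
    z              ∎
    where
    unit : ∀ w → x⁻¹ * (x * w) ≈ w
    unit w = trans (sym (*-assoc x⁻¹ x w))
      (trans (*-congʳ (trans (*-comm x⁻¹ x) xx⁻¹≈1)) (*-identityˡ w))

  x*y≈0⇒y≈0 : ∀ x {y} → ¬ x ≈ 0# → x * y ≈ 0# → y ≈ 0#
  x*y≈0⇒y≈0 x x≉0 eq = *-cancelˡ x x≉0 (trans eq (sym (zeroʳ x)))

  1^n≈1 : ∀ n → 1# ^ n ≈ 1#
  1^n≈1 zero    = refl
  1^n≈1 (suc n) = trans (*-identityˡ _) (1^n≈1 n)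

  sum-zero : (t : Vector Carrier n) → (∀ i → t i ≈ 0#) → sum t ≈ 0#
  sum-zero {n} t t≈0 = trans (sum-cong-≋ t≈0) (sum-replicate-zero n)

  init-last≈0 : (r : Vector Carrier (suc n)) → (∀ i → init r i ≈ 0#) → last r ≈ 0# → ∀ i → r i ≈ 0#
  init-last≈0 {zero}  r init≈0 last≈0 zero    = last≈0
  init-last≈0 {suc n} r init≈0 last≈0 zero    = init≈0 zero
  init-last≈0 {suc n} r init≈0 last≈0 (suc i) = init-last≈0 (tail r) (init≈0 ∘ suc) last≈0 i

  evaluate : Vector Carrier n → Carrier → Carrier
  evaluate f x = sum λ i → f i * x ^ toℕ i

  evaluate-step : (f : Vector Carrier (suc n)) (x : Carrier) →
                  evaluate f x ≈ head f + x * evaluate (tail f) x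
  evaluate-step f x = +-cong (*-identityʳ (head f)) (trans
    (sum-cong-≋ λ i → solve 3 (λ u v w → u :* (v :* w) := v :* (u :* w)) refl (tail f i) x (x ^ toℕ i))
    (sym (*-distribˡ-sum x λ i → tail f i * x ^ toℕ i)))
    where open SemiringSolver commutativeSemiring

  -- Horner's scheme: coefficient i of (f(x) - f(r)) / (x - r) is the value at r of the (i + 1)-fold
  -- tail of f.
  quotient : ∀ {n} → Vector Carrier (suc n) → Carrier → Vector Carrier n
  quotient {suc n} f r zero    = evaluate (tail f) r
  quotient {suc n} f r (suc i) = quotient (tail f) r i

  -- f(x) - f(r) = (x - r) g(x), with both sides moved so that no subtraction occurs.
  evaluate-quotient : (f : Vector Carrier (suc n)) (r x : Carrier) →
    evaluate f x + r * evaluate (quotient f r) x ≈ evaluate f r + x * evaluate (quotient f r) x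
  evaluate-quotient {zero}  f r x = +-cong refl (trans (zeroʳ r) (sym (zeroʳ x)))
  evaluate-quotient {suc n} f r x = begin
    evaluate f x + r * evaluate (quotient f r) x
      ≈⟨ +-cong (evaluate-step f x) (*-congˡ (evaluate-step (quotient f r) x)) ⟩
    f₀ + x * X + r * (R + x * Q)
      ≈⟨ solve 6 (λ f x r X R Q → f :+ x :* X :+ r :* (R :+ x :* Q)
                                   := f :+ r :* R :+ x :* (X :+ r :* Q)) refl f₀ x r X R Q ⟩
    f₀ + r * R + x * (X + r * Q)
      ≈⟨ +-congˡ (*-congˡ (evaluate-quotient (tail f) r x)) ⟩
    f₀ + r * R + x * (R + x * Q)
      ≈⟨ +-cong (evaluate-step f r) (*-congˡ (evaluate-step (quotient f r) x)) ⟨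
    evaluate f r + x * evaluate (quotient f r) x ∎
    where
    open SemiringSolver commutativeSemiring
    f₀ = head f
    X = evaluate (tail f) x
    R = evaluate (tail f) r
    Q = evaluate (quotient (tail f) r) x

  head≈0 : (f : Vector Carrier (suc n)) (x : Carrier) →
           (∀ i → tail f i ≈ 0#) → evaluate f x ≈ 0# → head f ≈ 0#
  head≈0 f x tail≈0 f[x]≈0 = begin
    head f                           ≈⟨ +-identityʳ (head f) ⟨
    head f + 0#                      ≈⟨ +-congˡ (trans (*-congˡ (sum-zero _ λ i → trans (*-congʳ (tail≈0 i)) (zeroˡ _))) (zeroʳ x)) ⟨
    head f + x * evaluate (tail f) x ≈⟨ evaluate-step f x ⟨
    evaluate f x                     ≈⟨ f[x]≈0 ⟩
    0#                               ∎

  -- The quotient depends on the tail of f through a unitriangular system, which is solved from the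
  -- top degree down.
  quotient≈0⇒tail≈0 : (f : Vector Carrier (suc n)) (r : Carrier) →
                      (∀ i → quotient f r i ≈ 0#) → ∀ i → tail f i ≈ 0#
  quotient≈0⇒tail≈0 {suc n} f r q≈0 zero    =
    head≈0 (tail f) r (quotient≈0⇒tail≈0 (tail f) r (q≈0 ∘ suc)) (q≈0 zero)
  quotient≈0⇒tail≈0 {suc n} f r q≈0 (suc i) = quotient≈0⇒tail≈0 (tail f) r (q≈0 ∘ suc) i

  -- Dividing by x - r₀ removes one coefficient and one root; the quotient still vanishes at the
  -- other roots because they differ from r₀.
  root-bound : (f r : Vector Carrier n) → (∀ i j → r i ≈ r j → i ≡ j) →
               (∀ i → evaluate f (r i) ≈ 0#) → ∀ i → f i ≈ 0#
  root-bound {suc n} f r distinct root = λ { zero → head≈0 f r₀ tail≈0 (root zero) ; (suc i) → tail≈0 i }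
    where
    r₀ = head r
    quotient-root : ∀ i → evaluate (quotient f r₀) (r (suc i)) ≈ 0#
    quotient-root i = x*y≈0⇒y≈0 (r₀ - rᵢ) r₀-rᵢ≉0 (begin
      (r₀ - rᵢ) * Q          ≈⟨ distribʳ Q r₀ (- rᵢ) ⟩
      r₀ * Q + - rᵢ * Q      ≈⟨ +-congʳ r₀Q≈rᵢQ ⟩
      rᵢ * Q + - rᵢ * Q      ≈⟨ distribʳ Q rᵢ (- rᵢ) ⟨
      (rᵢ - rᵢ) * Q          ≈⟨ *-congʳ (-‿inverseʳ rᵢ) ⟩
      0# * Q                 ≈⟨ zeroˡ Q ⟩
      0#                     ∎)
      where
      rᵢ = r (suc i)
      Q = evaluate (quotient f r₀) rᵢ
      r₀Q≈rᵢQ : r₀ * Q ≈ rᵢ * Q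
      r₀Q≈rᵢQ = begin
        r₀ * Q                     ≈⟨ +-identityˡ _ ⟨
        0# + r₀ * Q                ≈⟨ +-congʳ (root (suc i)) ⟨
        evaluate f rᵢ + r₀ * Q     ≈⟨ evaluate-quotient f r₀ rᵢ ⟩
        evaluate f r₀ + rᵢ * Q     ≈⟨ +-congʳ (root zero) ⟩
        0# + rᵢ * Q                ≈⟨ +-identityˡ _ ⟩
        rᵢ * Q                     ∎
      r₀-rᵢ≉0 : ¬ r₀ - rᵢ ≈ 0#
      r₀-rᵢ≉0 eq with distinct zero (suc i) (x-y≈0⇒x≈y r₀ rᵢ eq)
      ... | ()
    tail≈0 : ∀ i → tail f i ≈ 0#
    tail≈0 = quotient≈0⇒tail≈0 f r₀ (root-bound (quotient f r₀) (tail r)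
      (λ i j eq → Fin.suc-injective (distinct (suc i) (suc j) eq)) quotient-root)

-- The size is stored as 2 + `predpred` because the companion matrix and the polynomial x^q - x
-- address the degrees 0 and 1 explicitly.
record FiniteField c ℓ : Set (Level.suc (c ⊔ ℓ)) where
  field
    discreteField : DiscreteField c ℓ
  open DiscreteField discreteField public
  field
    predpred    : ℕ
    enumeration : Enumeration setoid (2 ℕ.+ predpred)
  open Enumerated enumeration public using (to; from; to-from; from-to; to-cong; from-injective)

  q : ℕ
  q = 2 ℕ.+ predpred

  open CommutativeMonoidSum *-commutativeMonoid using ()
    renaming (sum to product; sum-cong-≋ to product-cong; sum-permute to product-permute;
              sum-replicate to product-replicate; ∑-distrib-+ to product-distrib-*)
  open SetoidReasoning setoid

  product≉0 : (t : Vector Carrier n) → (∀ i → ¬ t i ≈ 0#) → ¬ product t ≈ 0#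
  product≉0 {ℕ.zero} t t≉0 eq = 1≉0 eq
  product≉0 {suc n} t t≉0 eq = product≉0 (tail t) (t≉0 ∘ suc) (x*y≈0⇒y≈0 (head t) (t≉0 zero) eq)

  -- With 0 replaced by 1, the product over all of `Fin q` is the product of the nonzero elements,
  -- and permutations of `Fin q` can act on it.
  unit-part : Fin q → Carrier
  unit-part i with from i ≟ 0#
  ... | yes _ = 1#
  ... | no  _ = from i

  unit-part≉0 : ∀ i → ¬ unit-part i ≈ 0#
  unit-part≉0 i with from i ≟ 0#
  ... | yes _   = 1≉0
  ... | no  i≉0 = i≉0

  -- Multiplication by b permutes the nonzero elements, so their product is
  -- unchanged when each of them is multiplied by b.
  fermat : ∀ b → b ^ q ≈ b
  fermat b with b ≟ 0#
  ... | yes b≈0 = trans (trans (*-congʳ b≈0) (zeroˡ _)) (sym b≈0)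
  ... | no  b≉0 with inverse b b≉0
  ... | b⁻¹ , bb⁻¹≈1 = begin
    b ^ q                                       ≈⟨ product-replicate q ⟨
    product (λ (_ : Fin q) → b)                 ≈⟨ product-cong factor*cofactor ⟨
    product (λ i → factor i * cofactor i)       ≈⟨ product-distrib-* factor cofactor ⟩
    product factor * product cofactor           ≈⟨ *-cong product-factor (trans (sum-single *-commutativeMonoid cofactor i₀ cofactor-off) cofactor-on) ⟩
    1# * b                                      ≈⟨ *-identityˡ b ⟩
    b                                           ∎
    where
    i₀ = to 0#
    -- The q factors of `b ^ q` are split: those at nonzero elements multiply to 1, and the one at
    -- the index of 0 is the `b` that remains.
    factor cofactor : Fin q → Carrier
    factor i with from i ≟ 0#
    ... | yes _ = 1#
    ... | no  _ = b
    cofactor i with from i ≟ 0#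
    ... | yes _ = b
    ... | no  _ = 1#
    factor*cofactor : ∀ i → factor i * cofactor i ≈ b
    factor*cofactor i with from i ≟ 0#
    ... | yes _ = *-identityˡ b
    ... | no  _ = *-identityʳ b
    cofactor-on : cofactor i₀ ≈ b
    cofactor-on with from i₀ ≟ 0#
    ... | yes _  = refl
    ... | no  ≉0 = contradiction (from-to 0#) ≉0
    cofactor-off : ∀ i → i ≢ i₀ → cofactor i ≈ 1#
    cofactor-off i i≢i₀ with from i ≟ 0#
    ... | yes ≈0 = contradiction (≡.trans (≡.sym (to-from i)) (to-cong ≈0)) i≢i₀
    ... | no  _  = refl
    b⁻¹b≈1 : b⁻¹ * b ≈ 1#
    b⁻¹b≈1 = trans (*-comm b⁻¹ b) bb⁻¹≈1
    multiply : Carrier → Fin q → Fin q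
    multiply x i = to (x * from i)
    multiply-inverse : ∀ x y → x * y ≈ 1# → ∀ i → multiply x (multiply y i) ≡ i
    multiply-inverse x y xy≈1 i = ≡.trans (to-cong (begin
      x * from (to (y * from i))  ≈⟨ *-congˡ (from-to _) ⟩
      x * (y * from i)            ≈⟨ *-assoc x y (from i) ⟨
      x * y * from i              ≈⟨ *-congʳ xy≈1 ⟩
      1# * from i                 ≈⟨ *-identityˡ (from i) ⟩
      from i                      ∎)) (to-from i)
    π = permutation (multiply b) (multiply b⁻¹)
          (multiply-inverse b b⁻¹ bb⁻¹≈1) (multiply-inverse b⁻¹ b b⁻¹b≈1)
    unit-part-multiply : ∀ i → factor i * unit-part i ≈ unit-part (multiply b i)
    unit-part-multiply i with from i ≟ 0# | from (multiply b i) ≟ 0#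
    ... | yes _  | yes _   = *-identityˡ 1#
    ... | yes ≈0 | no  ≉0  = contradiction (trans (from-to _) (trans (*-congˡ ≈0) (zeroʳ b))) ≉0
    ... | no  ≉0 | yes ≈0  = contradiction (x*y≈0⇒y≈0 b b≉0 (trans (sym (from-to _)) ≈0)) ≉0
    ... | no  _  | no  _   = sym (from-to _)
    product-factor : product factor ≈ 1#
    product-factor = *-cancelˡ (product unit-part) (product≉0 unit-part unit-part≉0) (begin
      product unit-part * product factor       ≈⟨ *-comm _ _ ⟩
      product factor * product unit-part       ≈⟨ product-distrib-* factor unit-part ⟨
      product (λ i → factor i * unit-part i)   ≈⟨ product-cong unit-part-multiply ⟩
      product (unit-part ∘ multiply b)         ≈⟨ product-permute unit-part π ⟨
      product unit-part                        ≈⟨ *-identityʳ _ ⟨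
      product unit-part * 1#                   ∎)

  -- (x + 1) ^ q - x ^ q - 1 has degree less than q and q roots.
  binomial-vanishes : ∀ i → 0 ℕ.< toℕ {q} i → (q C toℕ i) ⋆ 1# ≈ 0#
  binomial-vanishes (suc i) _ = root-bound coefficients from (λ _ _ → from-injective) root (suc i)
    where
    open Binomial commutativeSemiring using (binomialTerm; theorem)
    coefficients : Vector Carrier q
    coefficients zero    = 0#
    coefficients (suc i) = (q C suc (toℕ i)) ⋆ 1#
    term : ∀ x (i : Fin (suc q)) → binomialTerm x 1# q i ≈ (q C toℕ i) ⋆ 1# * x ^ toℕ i
    term x i = trans (⋆-congʳ (q C toℕ i) (trans (*-congˡ (1^n≈1 (q ℕ.∸ toℕ i))) (*-comm _ 1#)))
                     (sym (⋆-assoc-* (q C toℕ i) 1# _))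
    root : ∀ i → evaluate coefficients (from i) ≈ 0#
    root i = x+y≈y⇒x≈0 (begin
      evaluate coefficients x + (x + 1#)
        ≈⟨ solve 3 (λ e x o → e :+ (x :+ o) := (o :+ e) :+ x) refl (evaluate coefficients x) x 1# ⟩
      (1# + evaluate coefficients x) + x
        ≈⟨ +-congʳ (+-congˡ (trans (+-congʳ (zeroˡ _)) (+-identityˡ _))) ⟩
      (1# + sum {suc predpred} (λ i → (q C suc (toℕ i)) ⋆ 1# * x ^ suc (toℕ i))) + x
        ≈⟨ +-cong (+-cong bottom middle) top ⟨
      sum (init (binomialTerm x 1# q)) + last (binomialTerm x 1# q)
        ≈⟨ sum-init-last (binomialTerm x 1# q) ⟨
      sum (binomialTerm x 1# q)
        ≈⟨ theorem q x 1# ⟨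
      (x + 1#) ^ q
        ≈⟨ fermat (x + 1#) ⟩
      x + 1# ∎)
      where
      open SemiringSolver commutativeSemiring
      x = from i
      x+y≈y⇒x≈0 : ∀ {x y} → x + y ≈ y → x ≈ 0#
      x+y≈y⇒x≈0 {x} {y} eq = trans (trans (sym (+-identityʳ x)) (trans (+-congˡ (sym (-‿inverseʳ y)))
        (trans (sym (+-assoc x y (- y))) (+-congʳ eq)))) (-‿inverseʳ y)
      bottom : binomialTerm x 1# q zero ≈ 1#
      bottom = trans (term x zero) (trans (*-identityʳ _) (+-identityʳ 1#))
      middle : sum {suc predpred} (λ i → binomialTerm x 1# q (inject₁ (suc i))) ≈
               sum {suc predpred} (λ i → (q C suc (toℕ i)) ⋆ 1# * x ^ suc (toℕ i))
      middle = sum-cong-≋ {suc predpred} λ i → trans (term x (inject₁ (suc i)))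
        (reflexive (≡.cong (λ k → (q C k) ⋆ 1# * x ^ k) (Fin.toℕ-inject₁ (suc i))))
      top : last (binomialTerm x 1# q) ≈ x
      top = begin
        last (binomialTerm x 1# q)  ≈⟨ term x (fromℕ q) ⟩
        (q C toℕ (fromℕ q)) ⋆ 1# * x ^ toℕ (fromℕ q)
          ≡⟨ ≡.cong (λ k → (q C k) ⋆ 1# * x ^ k) (Fin.toℕ-fromℕ q) ⟩
        (q C q) ⋆ 1# * x ^ q        ≡⟨ ≡.cong (λ k → k ⋆ 1# * x ^ q) (nCn≡1 q) ⟩
        (1# + 0#) * x ^ q           ≈⟨ *-cong (+-identityʳ 1#) (fermat x) ⟩
        1# * x                      ≈⟨ *-identityˡ x ⟩
        x                           ∎

snoc : Vector A n → A → Vector A (suc n)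
snoc {n = zero}  v x _       = x
snoc {n = suc n} v x zero    = head v
snoc {n = suc n} v x (suc i) = snoc (tail v) x i

snoc-inject₁ : (v : Vector A n) (x : A) → ∀ i → snoc v x (inject₁ i) ≡ v i
snoc-inject₁ {n = suc n} v x zero    = ≡.refl
snoc-inject₁ {n = suc n} v x (suc i) = snoc-inject₁ (tail v) x i

snoc-fromℕ : (v : Vector A n) (x : A) → snoc v x (fromℕ n) ≡ x
snoc-fromℕ {n = zero}  v x = ≡.refl
snoc-fromℕ {n = suc n} v x = snoc-fromℕ (tail v) x

-- Construction of the extension

module LinearOperators (F : FiniteField c ℓ) where
  open FiniteField F using (ring; Carrier; q; predpred) renaming (1# to one)

  Space : Set _
  Space = LeftModule ring c ℓ

  module OperatorPowers (V : Space) where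
    open LeftModule V

    iterate : (Carrierᴹ → Carrierᴹ) → ℕ → Carrierᴹ → Carrierᴹ
    iterate T zero    v = v
    iterate T (suc k) v = T (iterate T k v)

    iterate-comm : (T : Carrierᴹ → Carrierᴹ) → ∀ k v → iterate T k (T v) ≡ T (iterate T k v)
    iterate-comm T zero    v = ≡.refl
    iterate-comm T (suc k) v = ≡.cong T (iterate-comm T k v)

    difference : (Carrierᴹ → Carrierᴹ) → Carrierᴹ → Carrierᴹ
    difference T v = iterate T q v +ᴹ -ᴹ T v

    -- The innermost difference is peeled off first, since passing from T to `difference T` is what
    -- going down one storey of the tower does.
    differences : ℕ → (Carrierᴹ → Carrierᴹ) → Carrierᴹ → Carrierᴹ
    differences zero    T = T
    differences (suc h) T = differences h (difference T)

    Congruent : (Carrierᴹ → Carrierᴹ) → Set _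
    Congruent T = ∀ {v w} → v ≈ᴹ w → T v ≈ᴹ T w

    iterate-cong : ∀ {T} → Congruent T → ∀ k → Congruent (iterate T k)
    iterate-cong T-cong zero    v≈w = v≈w
    iterate-cong T-cong (suc k) v≈w = T-cong (iterate-cong T-cong k v≈w)

    difference-cong : ∀ {T} → Congruent T → Congruent (difference T)
    difference-cong T-cong v≈w = +ᴹ-cong (iterate-cong T-cong q v≈w) (-ᴹ‿cong (T-cong v≈w))

    differences-ext : ∀ h {T U} → Congruent U → (∀ v → T v ≈ᴹ U v) →
                      ∀ v → differences h T v ≈ᴹ differences h U v
    differences-ext zero    U-cong T≈U = T≈U
    differences-ext (suc h) {T} {U} U-cong T≈U =
      differences-ext h (difference-cong U-cong) λ v → +ᴹ-cong (iterates q v) (-ᴹ‿cong (T≈U v))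
      where
      iterates : ∀ k v → iterate T k v ≈ᴹ iterate U k v
      iterates zero    v = ≈ᴹ-refl
      iterates (suc k) v = ≈ᴹ-trans (T≈U _) (U-cong (iterates k v))

  record Operator (V : Space) : Set (c ⊔ ℓ) where
    open LeftModule V
    field
      apply       : Carrierᴹ → Carrierᴹ
      apply-cong  : ∀ {v w} → v ≈ᴹ w → apply v ≈ᴹ apply w
      apply-+ᴹ    : ∀ v w → apply (v +ᴹ w) ≈ᴹ apply v +ᴹ apply w
      apply-*ₗ    : ∀ s v → apply (s *ₗ v) ≈ᴹ s *ₗ apply v

    apply-0ᴹ : apply 0ᴹ ≈ᴹ 0ᴹ
    apply-0ᴹ = ≈ᴹ-trans (apply-cong (≈ᴹ-sym (*ₗ-zeroʳ one)))
      (≈ᴹ-trans (apply-cong (≈ᴹ-trans (*ₗ-zeroʳ one) (≈ᴹ-sym (*ₗ-zeroˡ 0ᴹ))))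
        (≈ᴹ-trans (apply-*ₗ _ 0ᴹ) (*ₗ-zeroˡ _)))

    apply--ᴹ : ∀ v → apply (-ᴹ v) ≈ᴹ -ᴹ apply v
    apply--ᴹ v = inverseˡ-unique (apply (-ᴹ v)) (apply v)
      (≈ᴹ-trans (≈ᴹ-sym (apply-+ᴹ (-ᴹ v) v)) (≈ᴹ-trans (apply-cong (-ᴹ‿inverseˡ v)) apply-0ᴹ))
      where open GroupProperties +ᴹ-group using (inverseˡ-unique)

  record FiniteSpace : Set (Level.suc (c ⊔ ℓ)) where
    field
      space       : Space
      operator    : Operator space
      size        : ℕ
      enumeration : Enumeration (LeftModule.≈ᴹ-setoid space) size
    open LeftModule space public
    open Operator operator public
    open OperatorPowers space public
    field
      nonzero     : ∃ λ v → ¬ v ≈ᴹ 0ᴹ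

  -- Adjoins a root X of X ^ q - X = T to the algebra generated by an operator T:
  -- on V ⊕ V X ⊕ … ⊕ V X ^ (q - 1), X acts by a companion matrix.
  module Companion (𝒱 : FiniteSpace) where
    open FiniteSpace 𝒱
    private
      W = power space (Fin q)
      module W = LeftModule W
      module Powers = OperatorPowers W

    -- A vector is read as the first q terms of a sequence with v(k + q) = v(k + 1) + T v(k), where
    -- T is `apply`. This is the shift of such sequences, and the recurrence says that its q-th
    -- power minus itself is T.
    companion : W.Carrierᴹ → W.Carrierᴹ
    companion v i = snoc v (v (suc zero) +ᴹ apply (v zero)) (suc i)

    companion-inject₁ : ∀ v i → companion v (inject₁ i) ≡ v (suc i)
    companion-inject₁ v i = snoc-inject₁ (tail v) _ i

    companion-fromℕ : ∀ v → companion v (fromℕ _) ≡ v (suc zero) +ᴹ apply (v zero)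
    companion-fromℕ v = snoc-fromℕ (tail v) _

    snoc-relate : ∀ {n} (R : Carrierᴹ → Carrierᴹ → Carrierᴹ → Set ℓ) {u v w : Vector Carrierᴹ n} {x y z} →
                  (∀ i → R (u i) (v i) (w i)) → R x y z → ∀ i → R (snoc u x i) (snoc v y i) (snoc w z i)
    snoc-relate {zero}  R uvw xyz i       = xyz
    snoc-relate {suc n} R uvw xyz zero    = uvw zero
    snoc-relate {suc n} R uvw xyz (suc i) = snoc-relate R (uvw ∘ suc) xyz i

    companion-operator : Operator W
    companion-operator = record
      { apply      = companion
      ; apply-cong = λ {v} {w} v≈w i → snoc-relate (λ x y _ → x ≈ᴹ y) {u = v} {v = w} {w = w} {z = 0ᴹ} v≈w
          (+ᴹ-cong (v≈w (suc zero)) (apply-cong (v≈w zero))) (suc i)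
      ; apply-+ᴹ   = λ v w i → snoc-relate (λ x y z → x ≈ᴹ y +ᴹ z) {v = v} {w = w} (λ i → ≈ᴹ-refl)
          (≈ᴹ-trans (+ᴹ-congˡ (apply-+ᴹ (v zero) (w zero))) (interchange _ _ _ _)) (suc i)
      ; apply-*ₗ   = λ s v i → snoc-relate (λ x y _ → x ≈ᴹ s *ₗ y) {v = v} {w = v} {z = 0ᴹ} (λ i → ≈ᴹ-refl)
          (≈ᴹ-trans (+ᴹ-congˡ (apply-*ₗ s (v zero))) (≈ᴹ-sym (*ₗ-distribˡ s _ _))) (suc i)
      }
      where open CommutativeSemigroupProperties
              (CommutativeMonoid.commutativeSemigroup +ᴹ-commutativeMonoid) using (interchange)

    open Operator companion-operator using () renaming
      (apply-cong to companion-cong; apply-+ᴹ to companion-+ᴹ; apply--ᴹ to companion--ᴹ)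

    iterate-companion : ∀ k v i → toℕ i ≡ k → Powers.iterate companion k v zero ≈ᴹ v i
    iterate-companion zero    v zero    _  = ≈ᴹ-refl
    iterate-companion (suc k) v (suc i) eq = ≈ᴹ-trans
      (≈ᴹ-reflexive (≡.cong (λ w → w zero) (≡.sym (Powers.iterate-comm companion k v))))
      (≈ᴹ-trans (iterate-companion k (companion v) (inject₁ i)
                  (≡.trans (Fin.toℕ-inject₁ i) (ℕ.suc-injective eq)))
                (≈ᴹ-reflexive (companion-inject₁ v i)))

    difference-companion-zero : ∀ v → Powers.difference companion v zero ≈ᴹ apply (v zero)
    difference-companion-zero v = ≈ᴹ-trans
      (+ᴹ-congʳ (≈ᴹ-trans
        (≈ᴹ-reflexive (≡.cong (λ w → w zero) (≡.sym (Powers.iterate-comm companion (suc predpred) v))))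
        (≈ᴹ-trans (iterate-companion (suc predpred) (companion v) (fromℕ _) (Fin.toℕ-fromℕ _))
                  (≈ᴹ-reflexive (companion-fromℕ v)))))
      (xyx⁻¹≈y (v (suc zero)) (apply (v zero)))
      where open AbelianGroupProperties +ᴹ-abelianGroup using (xyx⁻¹≈y)

    iterate-difference : ∀ k v → Powers.iterate companion k (Powers.difference companion v) W.≈ᴹ
                                 Powers.difference companion (Powers.iterate companion k v)
    iterate-difference zero    v = W.≈ᴹ-refl
    iterate-difference (suc k) v = W.≈ᴹ-trans (companion-cong (iterate-difference k v))
      (W.≈ᴹ-trans (companion-+ᴹ (Powers.iterate companion q w) (W.-ᴹ companion w))
        (W.+ᴹ-cong {u = companion (W.-ᴹ companion w)}
                   (W.≈ᴹ-reflexive (≡.sym (Powers.iterate-comm companion q w)))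
                   (companion--ᴹ (companion w))))
      where w = Powers.iterate companion k v

    -- At entry 0 this is the recurrence itself. Entry i is entry 0 after i shifts, and shifts
    -- commute with `difference companion`.
    difference-companion : ∀ v i → Powers.difference companion v i ≈ᴹ apply (v i)
    difference-companion v i =
      ≈ᴹ-trans (≈ᴹ-sym (iterate-companion (toℕ i) (Powers.difference companion v) i ≡.refl))
      (≈ᴹ-trans (iterate-difference (toℕ i) v zero)
      (≈ᴹ-trans (difference-companion-zero (Powers.iterate companion (toℕ i) v))
                (apply-cong (iterate-companion (toℕ i) v i ≡.refl))))

    differences-intertwine : ∀ h {T U} → Congruent U → (∀ v i → T v i ≈ᴹ U (v i)) →
                             ∀ v i → Powers.differences h T v i ≈ᴹ differences h U (v i)
    differences-intertwine zero    U-cong T∼U = T∼U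
    differences-intertwine (suc h) {T} {U} U-cong T∼U =
      differences-intertwine h (difference-cong U-cong) λ v i →
        +ᴹ-cong (iterates q v i) (-ᴹ‿cong (T∼U v i))
      where
      iterates : ∀ k v i → Powers.iterate T k v i ≈ᴹ iterate U k (v i)
      iterates zero    v i = ≈ᴹ-refl
      iterates (suc k) v i = ≈ᴹ-trans (T∼U _ i) (U-cong (iterates k v i))

    extended : FiniteSpace
    extended = record
      { space       = W
      ; operator    = companion-operator
      ; size        = size ℕ.^ q
      ; enumeration = enumerate-power q enumeration
      ; nonzero     = (λ _ → proj₁ nonzero) , λ eq → proj₂ nonzero (eq zero)
      }

n<q^n : ∀ p n → n ℕ.< (2 ℕ.+ p) ℕ.^ n
n<q^n p zero    = ℕ.s≤s ℕ.z≤n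
n<q^n p (suc n) = ℕ.≤-trans (ℕ.+-mono-≤ (ℕ.m^n>0 (2 ℕ.+ p) n) (n<q^n p n))
  (ℕ.+-monoʳ-≤ ((2 ℕ.+ p) ℕ.^ n) (ℕ.m≤m+n _ (p ℕ.* (2 ℕ.+ p) ℕ.^ n)))

module Tower (F : FiniteField c ℓ) where
  open FiniteField F using (ring; 1#; 1≉0; q; enumeration)
  open LinearOperators F

  tower : ∀ h → ∃ λ (𝒱 : FiniteSpace) → let open FiniteSpace 𝒱 in
                ∀ v → differences h apply v ≈ᴹ v
  tower zero = record
    { space       = TensorUnit.leftModule {R = ring}
    ; operator    = record { apply      = id
                           ; apply-cong = id
                           ; apply-+ᴹ   = λ _ _ → FiniteField.refl F
                           ; apply-*ₗ   = λ _ _ → FiniteField.refl F }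
    ; size        = q
    ; enumeration = enumeration
    ; nonzero     = 1# , 1≉0
    } , λ _ → FiniteField.refl F
  tower (suc h) with tower h
  ... | 𝒱 , differences≈id = extended , λ v i →
    ≈ᴹ-trans (differences-intertwine h apply-cong difference-companion v i) (differences≈id (v i))
    where
    open Companion 𝒱
    open FiniteSpace 𝒱

-- The field of polynomials acting on a vector with minimal annihilator

module PolynomialAction (F : FiniteField c ℓ) (𝒱 : LinearOperators.FiniteSpace F) where
  open FiniteField F
    using (Carrier; _≈_; _+_; _*_; -_; _-_; 0#; 1#; _≟_; q; predpred; *-comm; 1≉0)
  private module F = FiniteField F
  open LinearOperators.FiniteSpace 𝒱
  open SetoidReasoning ≈ᴹ-setoid
  open CommutativeSemigroupProperties
    (CommutativeMonoid.commutativeSemigroup +ᴹ-commutativeMonoid) using (interchange)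

  -- Coefficients by increasing degree, trailing zeros allowed: lists are compared only through
  -- their action on a vector.
  Polynomial : Set c
  Polynomial = List Carrier

  act : Polynomial → Carrierᴹ → Carrierᴹ
  act []      v = 0ᴹ
  act (s ∷ f) v = s *ₗ v +ᴹ apply (act f v)

  act-cong : ∀ f {v w} → v ≈ᴹ w → act f v ≈ᴹ act f w
  act-cong []      v≈w = ≈ᴹ-refl
  act-cong (s ∷ f) v≈w = +ᴹ-cong (*ₗ-congˡ v≈w) (apply-cong (act-cong f v≈w))

  act-+ᴹ : ∀ f v w → act f (v +ᴹ w) ≈ᴹ act f v +ᴹ act f w
  act-+ᴹ []      v w = ≈ᴹ-sym (+ᴹ-identityˡ 0ᴹ)
  act-+ᴹ (s ∷ f) v w = ≈ᴹ-trans
    (+ᴹ-cong (*ₗ-distribˡ s v w) (≈ᴹ-trans (apply-cong (act-+ᴹ f v w)) (apply-+ᴹ _ _)))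
    (interchange _ _ _ _)

  *ₗ-swap : ∀ s t v → s *ₗ (t *ₗ v) ≈ᴹ t *ₗ (s *ₗ v)
  *ₗ-swap s t v = ≈ᴹ-trans (≈ᴹ-sym (*ₗ-assoc s t v)) (≈ᴹ-trans (*ₗ-congʳ (*-comm s t)) (*ₗ-assoc t s v))

  act-*ₗ : ∀ f t v → act f (t *ₗ v) ≈ᴹ t *ₗ act f v
  act-*ₗ []      t v = ≈ᴹ-sym (*ₗ-zeroʳ t)
  act-*ₗ (s ∷ f) t v = ≈ᴹ-trans
    (+ᴹ-cong (*ₗ-swap s t v) (≈ᴹ-trans (apply-cong (act-*ₗ f t v)) (apply-*ₗ t _)))
    (≈ᴹ-sym (*ₗ-distribˡ t _ _))

  act-operator : Polynomial → LinearOperators.Operator F space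
  act-operator f = record
    { apply = act f ; apply-cong = act-cong f ; apply-+ᴹ = act-+ᴹ f ; apply-*ₗ = act-*ₗ f }

  act-0ᴹ : ∀ f → act f 0ᴹ ≈ᴹ 0ᴹ
  act-0ᴹ f = LinearOperators.Operator.apply-0ᴹ (act-operator f)

  act-apply : ∀ f v → act f (apply v) ≈ᴹ apply (act f v)
  act-apply []      v = ≈ᴹ-sym apply-0ᴹ
  act-apply (s ∷ f) v = ≈ᴹ-trans
    (+ᴹ-cong (≈ᴹ-sym (apply-*ₗ s v)) (apply-cong (act-apply f v))) (≈ᴹ-sym (apply-+ᴹ _ _))

  act-comm : ∀ f g v → act f (act g v) ≈ᴹ act g (act f v)
  act-comm []      g v = ≈ᴹ-sym (act-0ᴹ g)
  act-comm (s ∷ f) g v = ≈ᴹ-trans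
    (+ᴹ-cong (≈ᴹ-sym (act-*ₗ g s v)) (≈ᴹ-trans (apply-cong (act-comm f g v)) (≈ᴹ-sym (act-apply g _))))
    (≈ᴹ-sym (act-+ᴹ g _ _))

  constant : Carrier → Polynomial
  constant s = s ∷ []

  infixl 6 _⊕_
  infixl 7 _⊗_

  _⊕_ _⊗_ : Polynomial → Polynomial → Polynomial
  []      ⊕ g       = g
  (s ∷ f) ⊕ []      = s ∷ f
  (s ∷ f) ⊕ (t ∷ g) = s + t ∷ f ⊕ g
  []      ⊗ g = []
  (s ∷ f) ⊗ g = List.map (s *_) g ⊕ (0# ∷ f ⊗ g)

  ⊝_ : Polynomial → Polynomial
  ⊝ f = List.map (-_) f

  act-constant : ∀ s v → act (constant s) v ≈ᴹ s *ₗ v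
  act-constant s v = ≈ᴹ-trans (+ᴹ-congˡ apply-0ᴹ) (+ᴹ-identityʳ _)

  act-⊕ : ∀ f g v → act (f ⊕ g) v ≈ᴹ act f v +ᴹ act g v
  act-⊕ []      g       v = ≈ᴹ-sym (+ᴹ-identityˡ _)
  act-⊕ (s ∷ f) []      v = ≈ᴹ-sym (+ᴹ-identityʳ _)
  act-⊕ (s ∷ f) (t ∷ g) v = ≈ᴹ-trans
    (+ᴹ-cong (*ₗ-distribʳ v s t) (≈ᴹ-trans (apply-cong (act-⊕ f g v)) (apply-+ᴹ _ _)))
    (interchange _ _ _ _)

  act-scale : ∀ s f v → act (List.map (s *_) f) v ≈ᴹ s *ₗ act f v
  act-scale s []      v = ≈ᴹ-sym (*ₗ-zeroʳ s)
  act-scale s (t ∷ f) v = ≈ᴹ-trans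
    (+ᴹ-cong (*ₗ-assoc s t v) (≈ᴹ-trans (apply-cong (act-scale s f v)) (apply-*ₗ s _)))
    (≈ᴹ-sym (*ₗ-distribˡ s _ _))

  act-⊝ : ∀ f v → act (⊝ f) v ≈ᴹ -ᴹ act f v
  act-⊝ []      v = ≈ᴹ-sym ε⁻¹≈ε
    where open GroupProperties +ᴹ-group using (ε⁻¹≈ε)
  act-⊝ (t ∷ f) v = ≈ᴹ-trans
    (+ᴹ-cong (inverseˡ-unique _ _ (≈ᴹ-trans (≈ᴹ-sym (*ₗ-distribʳ v (- t) t))
                (≈ᴹ-trans (*ₗ-congʳ (F.-‿inverseˡ t)) (*ₗ-zeroˡ v))))
             (≈ᴹ-trans (apply-cong (act-⊝ f v)) (apply--ᴹ _)))
    (⁻¹-∙-comm _ _)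
    where
    open GroupProperties +ᴹ-group using (inverseˡ-unique)
    open AbelianGroupProperties +ᴹ-abelianGroup using (⁻¹-∙-comm)

  act-⊗ : ∀ f g v → act (f ⊗ g) v ≈ᴹ act f (act g v)
  act-⊗ []      g v = ≈ᴹ-refl
  act-⊗ (s ∷ f) g v = ≈ᴹ-trans (act-⊕ (List.map (s *_) g) (0# ∷ f ⊗ g) v)
    (+ᴹ-cong (act-scale s g v)
      (≈ᴹ-trans (+ᴹ-congʳ (*ₗ-zeroˡ v)) (≈ᴹ-trans (+ᴹ-identityˡ _) (apply-cong (act-⊗ f g v)))))

  -- Polynomials modulo the annihilator of v.
  quotientRing : Carrierᴹ → CommutativeRing c ℓ
  quotientRing v = record
    { Carrier = Polynomial
    ; _≈_     = λ f g → act f v ≈ᴹ act g v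
    ; _+_     = _⊕_
    ; _*_     = _⊗_
    ; -_      = ⊝_
    ; 0#      = []
    ; 1#      = constant 1#
    ; isCommutativeRing = record
      { isRing = record
        { +-isAbelianGroup = record
          { isGroup = record
            { isMonoid = record
              { isSemigroup = record
                { isMagma = record
                  { isEquivalence = record
                    { refl = ≈ᴹ-refl ; sym = ≈ᴹ-sym ; trans = ≈ᴹ-trans }
                  ; ∙-cong = λ {f} {f′} {g} {g′} f≈f′ g≈g′ →
                      ≈ᴹ-trans (act-⊕ f g v) (≈ᴹ-trans (+ᴹ-cong f≈f′ g≈g′) (≈ᴹ-sym (act-⊕ f′ g′ v))) }
                ; assoc = λ f g h → begin
                    act (f ⊕ g ⊕ h) v                 ≈⟨ act-⊕ (f ⊕ g) h v ⟩
                    act (f ⊕ g) v +ᴹ act h v          ≈⟨ +ᴹ-congʳ (act-⊕ f g v) ⟩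
                    act f v +ᴹ act g v +ᴹ act h v     ≈⟨ +ᴹ-assoc _ _ _ ⟩
                    act f v +ᴹ (act g v +ᴹ act h v)   ≈⟨ +ᴹ-congˡ (act-⊕ g h v) ⟨
                    act f v +ᴹ act (g ⊕ h) v          ≈⟨ act-⊕ f (g ⊕ h) v ⟨
                    act (f ⊕ (g ⊕ h)) v               ∎ }
              ; identity = (λ f → ≈ᴹ-refl)
                         , (λ f → ≈ᴹ-trans (act-⊕ f [] v) (+ᴹ-identityʳ _)) }
            ; inverse = (λ f → ≈ᴹ-trans (act-⊕ (⊝ f) f v) (≈ᴹ-trans (+ᴹ-congʳ (act-⊝ f v)) (-ᴹ‿inverseˡ _)))
                      , (λ f → ≈ᴹ-trans (act-⊕ f (⊝ f) v) (≈ᴹ-trans (+ᴹ-congˡ (act-⊝ f v)) (-ᴹ‿inverseʳ _)))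
            ; ⁻¹-cong = λ {f} {g} f≈g → ≈ᴹ-trans (act-⊝ f v) (≈ᴹ-trans (-ᴹ‿cong f≈g) (≈ᴹ-sym (act-⊝ g v))) }
          ; comm = λ f g → ≈ᴹ-trans (act-⊕ f g v) (≈ᴹ-trans (+ᴹ-comm _ _) (≈ᴹ-sym (act-⊕ g f v))) }
        -- The relation compares actions on v only, so `f` has to be moved past `g′` until it acts
        -- on v directly.
        ; *-cong = λ {f} {f′} {g} {g′} f≈f′ g≈g′ → begin
            act (f ⊗ g) v       ≈⟨ act-⊗ f g v ⟩
            act f (act g v)     ≈⟨ act-cong f g≈g′ ⟩
            act f (act g′ v)    ≈⟨ act-comm f g′ v ⟩
            act g′ (act f v)    ≈⟨ act-cong g′ f≈f′ ⟩
            act g′ (act f′ v)   ≈⟨ act-comm g′ f′ v ⟩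
            act f′ (act g′ v)   ≈⟨ act-⊗ f′ g′ v ⟨
            act (f′ ⊗ g′) v     ∎
        ; *-assoc = λ f g h → begin
            act (f ⊗ g ⊗ h) v         ≈⟨ act-⊗ (f ⊗ g) h v ⟩
            act (f ⊗ g) (act h v)     ≈⟨ act-⊗ f g (act h v) ⟩
            act f (act g (act h v))   ≈⟨ act-cong f (act-⊗ g h v) ⟨
            act f (act (g ⊗ h) v)     ≈⟨ act-⊗ f (g ⊗ h) v ⟨
            act (f ⊗ (g ⊗ h)) v       ∎
        ; *-identity = (λ f → ≈ᴹ-trans (act-⊗ (constant 1#) f v) (≈ᴹ-trans (act-constant 1# _) (*ₗ-identityˡ _)))
                     , (λ f → ≈ᴹ-trans (act-⊗ f (constant 1#) v) (act-cong f act-1))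
        ; distrib = (λ f g h → begin
            act (f ⊗ (g ⊕ h)) v                     ≈⟨ act-⊗ f (g ⊕ h) v ⟩
            act f (act (g ⊕ h) v)                   ≈⟨ act-cong f (act-⊕ g h v) ⟩
            act f (act g v +ᴹ act h v)              ≈⟨ act-+ᴹ f _ _ ⟩
            act f (act g v) +ᴹ act f (act h v)      ≈⟨ +ᴹ-cong (act-⊗ f g v) (act-⊗ f h v) ⟨
            act (f ⊗ g) v +ᴹ act (f ⊗ h) v          ≈⟨ act-⊕ (f ⊗ g) (f ⊗ h) v ⟨
            act (f ⊗ g ⊕ f ⊗ h) v                   ∎)
          , (λ f g h → begin
            act ((g ⊕ h) ⊗ f) v                     ≈⟨ act-⊗ (g ⊕ h) f v ⟩
            act (g ⊕ h) (act f v)                   ≈⟨ act-⊕ g h _ ⟩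
            act g (act f v) +ᴹ act h (act f v)      ≈⟨ +ᴹ-cong (act-⊗ g f v) (act-⊗ h f v) ⟨
            act (g ⊗ f) v +ᴹ act (h ⊗ f) v          ≈⟨ act-⊕ (g ⊗ f) (h ⊗ f) v ⟨
            act (g ⊗ f ⊕ h ⊗ f) v                   ∎) }
      ; *-comm = λ f g → ≈ᴹ-trans (act-⊗ f g v) (≈ᴹ-trans (act-comm f g v) (≈ᴹ-sym (act-⊗ g f v))) }
    }
    where
    act-1 : act (constant 1#) v ≈ᴹ v
    act-1 = ≈ᴹ-trans (act-constant 1# v) (*ₗ-identityˡ v)

  actᵛ : Vector Carrier n → Carrierᴹ → Carrierᴹ
  actᵛ r = act (toList r)

  actᵛ-cong : (r s : Vector Carrier n) → (∀ i → r i ≈ s i) → ∀ v → actᵛ r v ≈ᴹ actᵛ s v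
  actᵛ-cong {zero}  r s r≈s v = ≈ᴹ-refl
  actᵛ-cong {suc n} r s r≈s v =
    +ᴹ-cong (*ₗ-congʳ (r≈s zero)) (apply-cong (actᵛ-cong (tail r) (tail s) (r≈s ∘ suc) v))

  actᵛ-zero : (r : Vector Carrier n) → (∀ i → r i ≈ 0#) → ∀ v → actᵛ r v ≈ᴹ 0ᴹ
  actᵛ-zero {zero}  r r≈0 v = ≈ᴹ-refl
  actᵛ-zero {suc n} r r≈0 v = ≈ᴹ-trans
    (+ᴹ-cong (≈ᴹ-trans (*ₗ-congʳ (r≈0 zero)) (*ₗ-zeroˡ v))
             (≈ᴹ-trans (apply-cong (actᵛ-zero (tail r) (r≈0 ∘ suc) v)) apply-0ᴹ))
    (+ᴹ-identityˡ 0ᴹ)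

  actᵛ-+-* : ∀ (r s : Vector Carrier n) t v →
             actᵛ (λ i → r i + t * s i) v ≈ᴹ actᵛ r v +ᴹ t *ₗ actᵛ s v
  actᵛ-+-* {zero}  r s t v = ≈ᴹ-sym (≈ᴹ-trans (+ᴹ-identityˡ _) (*ₗ-zeroʳ t))
  actᵛ-+-* {suc n} r s t v = begin
    (r₀ + t * s₀) *ₗ v +ᴹ apply (actᵛ (λ i → tail r i + t * tail s i) v)
      ≈⟨ +ᴹ-cong (*ₗ-distribʳ v r₀ (t * s₀)) (apply-cong (actᵛ-+-* (tail r) (tail s) t v)) ⟩
    r₀ *ₗ v +ᴹ (t * s₀) *ₗ v +ᴹ apply (R +ᴹ t *ₗ S)
      ≈⟨ +ᴹ-cong (+ᴹ-congˡ (*ₗ-assoc t s₀ v)) (≈ᴹ-trans (apply-+ᴹ R (t *ₗ S)) (+ᴹ-congˡ (apply-*ₗ t S))) ⟩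
    r₀ *ₗ v +ᴹ t *ₗ (s₀ *ₗ v) +ᴹ (apply R +ᴹ t *ₗ apply S)
      ≈⟨ interchange _ _ _ _ ⟩
    r₀ *ₗ v +ᴹ apply R +ᴹ (t *ₗ (s₀ *ₗ v) +ᴹ t *ₗ apply S)
      ≈⟨ +ᴹ-congˡ (*ₗ-distribˡ t _ _) ⟨
    r₀ *ₗ v +ᴹ apply R +ᴹ t *ₗ (s₀ *ₗ v +ᴹ apply S) ∎
    where
    r₀ = head r
    s₀ = head s
    R = actᵛ (tail r) v
    S = actᵛ (tail s) v

  actᵛ-init : ∀ (r : Vector Carrier (suc n)) → last r ≈ 0# → ∀ v → actᵛ r v ≈ᴹ actᵛ (init r) v
  actᵛ-init {zero}  r last≈0 v = actᵛ-zero r (λ { zero → last≈0 }) v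
  actᵛ-init {suc n} r last≈0 v = +ᴹ-congˡ (apply-cong (actᵛ-init (tail r) last≈0 v))

  Nonzero : Vector Carrier n → Set ℓ
  Nonzero r = ¬ (∀ i → r i ≈ 0#)

  -- The vector is quantified together with the polynomial. Minimality of the length then also
  -- applies to `act f generator`, which is what makes the quotient a domain.
  Annihilates : ℕ → Set (c ⊔ ℓ)
  Annihilates l = ∃ λ v → ¬ v ≈ᴹ 0ᴹ × ∃ λ (r : Vector Carrier l) → Nonzero r × actᵛ r v ≈ᴹ 0ᴹ

  open Enumerated enumeration using () renaming (_≟_ to _≟ᴹ_; any? to anyᴹ?)

  private
    module Vectors (l : ℕ) = Enumerated
      (enumerate-power l F.enumeration
        {LeftModule.≈ᴹ-isEquivalence (power (TensorUnit.leftModule {R = F.ring}) (Fin l))})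

  annihilates? : ∀ l → Dec (Annihilates l)
  annihilates? l = anyᴹ?
    (λ { v≈w (v≉0 , r , r≉0 , rv≈0) →
         (λ w≈0 → v≉0 (≈ᴹ-trans v≈w w≈0)) , r , r≉0 , ≈ᴹ-trans (act-cong (toList r) (≈ᴹ-sym v≈w)) rv≈0 })
    λ v → ¬? (v ≟ᴹ 0ᴹ) ×-dec Vectors.any? l
      (λ { {r} {s} r≈s (r≉0 , rv≈0) → (λ s≈0 → r≉0 λ i → F.trans (r≈s i) (s≈0 i))
                                    , ≈ᴹ-trans (actᵛ-cong s r (λ i → F.sym (r≈s i)) v) rv≈0 })
      λ r → ¬? (Fin.all? λ i → r i ≟ 0#) ×-dec (actᵛ r v ≟ᴹ 0ᴹ)

  -- There are more coefficient vectors of this length than elements of the space.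
  annihilates-size : Annihilates size
  annihilates-size with Fin.pigeonhole (n<q^n predpred size)
                          (λ j → Inverse.to enumeration (actᵛ (Vectors.from size j) (proj₁ nonzero)))
  ... | i , j , i<j , eq = v , proj₂ nonzero , (λ k → r k + - 1# * s k) , r-s≉0 , r-s-annihilates
    where
    open Vectors size using (from; from-injective)
    v = proj₁ nonzero
    r = from i
    s = from j
    r-s≉0 : Nonzero λ k → r k + - 1# * s k
    r-s≉0 r-s≈0 = Fin.<⇒≢ i<j (from-injective λ k →
      F.x-y≈0⇒x≈y (r k) (s k) (F.trans (F.+-congˡ (F.sym (-1*x≈-x (s k)))) (r-s≈0 k)))
      where open RingProperties F.ring using (-1*x≈-x)
    r-s-annihilates : actᵛ (λ k → r k + - 1# * s k) v ≈ᴹ 0ᴹ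
    r-s-annihilates = begin
      actᵛ (λ k → r k + - 1# * s k) v   ≈⟨ actᵛ-+-* r s (- 1#) v ⟩
      actᵛ r v +ᴹ - 1# *ₗ actᵛ s v      ≈⟨ +ᴹ-congʳ (Enumerated.to-injective enumeration eq) ⟩
      actᵛ s v +ᴹ - 1# *ₗ actᵛ s v      ≈⟨ +ᴹ-congʳ (*ₗ-identityˡ _) ⟨
      1# *ₗ actᵛ s v +ᴹ - 1# *ₗ actᵛ s v ≈⟨ *ₗ-distribʳ _ 1# (- 1#) ⟨
      (1# - 1#) *ₗ actᵛ s v             ≈⟨ *ₗ-congʳ (F.-‿inverseʳ 1#) ⟩
      0# *ₗ actᵛ s v                    ≈⟨ *ₗ-zeroˡ _ ⟩
      0ᴹ                                ∎

  minimal-annihilator : ∀ N → Annihilates N → ∃ λ l → Annihilates (suc l) × ¬ Annihilates l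
  minimal-annihilator zero    (v , v≉0 , r , r≉0 , rv≈0) = contradiction (λ ()) r≉0
  minimal-annihilator (suc N) ann with annihilates? N
  ... | yes ann′ = minimal-annihilator N ann′
  ... | no ¬ann  = N , ann , ¬ann

  module Minimal {l} (ann : Annihilates (suc l)) (¬ann : ¬ Annihilates l) where
    generator : Carrierᴹ
    generator = proj₁ ann

    generator≉0 : ¬ generator ≈ᴹ 0ᴹ
    generator≉0 = proj₁ (proj₂ ann)

    private
      g : Vector Carrier (suc l)
      g = proj₁ (proj₂ (proj₂ ann))

      g-nonzero : Nonzero g
      g-nonzero = proj₁ (proj₂ (proj₂ (proj₂ ann)))

      g-annihilates : actᵛ g generator ≈ᴹ 0ᴹ
      g-annihilates = proj₂ (proj₂ (proj₂ (proj₂ ann)))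

      lead≉0 : ¬ last g ≈ 0#
      lead≉0 lead≈0 = ¬ann (generator , generator≉0 , init g
        , (λ init≈0 → g-nonzero (F.init-last≈0 g init≈0 lead≈0))
        , ≈ᴹ-trans (≈ᴹ-sym (actᵛ-init g lead≈0 generator)) g-annihilates)

    -- One step of division by g, whose leading coefficient is invertible. The equality is asserted
    -- for every vector annihilated by g, because `domain` uses it at `act f generator` as well as
    -- at `generator`.
    remainder : (r : Vector Carrier (suc l)) → ∃ λ (s : Vector Carrier l) →
                ∀ v → actᵛ g v ≈ᴹ 0ᴹ → actᵛ r v ≈ᴹ actᵛ s v
    remainder r with F.inverse (last g) lead≉0
    ... | x , gx≈1 = init s , λ v gv≈0 → ≈ᴹ-sym (begin
      actᵛ (init s) v             ≈⟨ actᵛ-init s last-s≈0 v ⟨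
      actᵛ s v                    ≈⟨ actᵛ-+-* r g t v ⟩
      actᵛ r v +ᴹ t *ₗ actᵛ g v   ≈⟨ +ᴹ-congˡ (≈ᴹ-trans (*ₗ-congˡ gv≈0) (*ₗ-zeroʳ t)) ⟩
      actᵛ r v +ᴹ 0ᴹ              ≈⟨ +ᴹ-identityʳ _ ⟩
      actᵛ r v                    ∎)
      where
      t = - last r * x
      s : Vector Carrier (suc l)
      s i = r i + t * g i
      last-s≈0 : last s ≈ 0#
      last-s≈0 = F.trans (F.+-congˡ (F.trans (F.*-assoc (- last r) x (last g))
        (F.trans (F.*-congˡ (F.trans (*-comm x (last g)) gx≈1)) (F.*-identityʳ _)))) (F.-‿inverseʳ (last r))

    reduce : ∀ f → ∃ λ (r : Vector Carrier l) → ∀ v → actᵛ g v ≈ᴹ 0ᴹ → act f v ≈ᴹ actᵛ r v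
    reduce []      = (λ _ → 0#) , λ v _ → ≈ᴹ-sym (actᵛ-zero {l} (λ _ → 0#) (λ _ → F.refl) v)
    reduce (s ∷ f) with reduce f
    ... | r , f≈r with remainder (s Vector.∷ r)
    ... | r′ , sr≈r′ = r′ , λ v gv≈0 →
      ≈ᴹ-trans (+ᴹ-congˡ (apply-cong (f≈r v gv≈0))) (sr≈r′ v gv≈0)

    -- By minimality of l, no nonzero remainder annihilates act f generator.
    domain : ∀ f h → ¬ act f generator ≈ᴹ 0ᴹ → act (f ⊗ h) generator ≈ᴹ 0ᴹ → act h generator ≈ᴹ 0ᴹ
    domain f h f≉0 fh≈0 with reduce h
    ... | r , h≈r with Fin.all? (λ i → r i ≟ 0#)
    ... | yes r≈0 = ≈ᴹ-trans (h≈r generator g-annihilates) (actᵛ-zero r r≈0 generator)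
    ... | no  r≉0 = contradiction (act f generator , f≉0 , r , r≉0 , (begin
      actᵛ r (act f generator)   ≈⟨ h≈r _ gf≈0 ⟨
      act h (act f generator)    ≈⟨ act-comm h f generator ⟩
      act f (act h generator)    ≈⟨ act-⊗ f h generator ⟨
      act (f ⊗ h) generator      ≈⟨ fh≈0 ⟩
      0ᴹ                         ∎)) ¬ann
      where
      gf≈0 : actᵛ g (act f generator) ≈ᴹ 0ᴹ
      gf≈0 = ≈ᴹ-trans (act-comm (toList g) f generator) (≈ᴹ-trans (act-cong f g-annihilates) (act-0ᴹ f))

module _ (R : CommutativeRing c ℓ) where
  open CommutativeRing R hiding (zero)
  open CommutativeSemiringExp commutativeSemiring using (_^_; ^-homo-*)
  open RingProperties ring using (x[y-z]≈xy-xz)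
  open GroupProperties +-group using (x∙y⁻¹≈ε⇒x≈y; x≈y⇒x∙y⁻¹≈ε)
  open SetoidReasoning setoid

  -- Some power of x ≉ 0 repeats, and cancellation makes x a root of unity.
  finite-domain⇒field : {N : ℕ} (code : Carrier → Fin N) → (∀ {x y} → x ≈ y → code x ≡ code y) →
    (∀ {x y} → code x ≡ code y → x ≈ y) → ¬ 1# ≈ 0# →
    (∀ x y → ¬ x ≈ 0# → x * y ≈ 0# → y ≈ 0#) → DiscreteField c ℓ
  finite-domain⇒field {N} code code-cong code-injective 1≉0 domain = record
    { commutativeRing = R
    ; _≟_             = λ x y → map′ code-injective code-cong (code x Fin.≟ code y)
    ; 1≉0             = 1≉0
    ; inverse         = inv
    }
    where
    power≉0 : ∀ x → ¬ x ≈ 0# → ∀ k → ¬ x ^ k ≈ 0#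
    power≉0 x x≉0 zero    eq = 1≉0 eq
    power≉0 x x≉0 (suc k) eq = power≉0 x x≉0 k (domain x _ x≉0 eq)

    inv : ∀ x → ¬ x ≈ 0# → ∃ λ y → x * y ≈ 1#
    inv x x≉0 with Fin.pigeonhole (ℕ.n<1+n N) (λ i → code (x ^ toℕ i))
    ... | i , j , i<j , eq with ℕ.m≤n⇒∃[o]m+o≡n i<j
    ... | k , 1+i+k≡j = x ^ k , x∙y⁻¹≈ε⇒x≈y (x ^ suc k) 1#
      (domain (x ^ toℕ i) (x ^ suc k - 1#) (power≉0 x x≉0 (toℕ i)) (begin
        x ^ toℕ i * (x ^ suc k - 1#)              ≈⟨ x[y-z]≈xy-xz _ _ _ ⟩
        x ^ toℕ i * x ^ suc k - x ^ toℕ i * 1#    ≈⟨ x≈y⇒x∙y⁻¹≈ε (begin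
          x ^ toℕ i * x ^ suc k  ≈⟨ ^-homo-* x (toℕ i) (suc k) ⟨
          x ^ (toℕ i ℕ.+ suc k)  ≡⟨ ≡.cong (x ^_) (≡.trans (ℕ.+-suc (toℕ i) k) 1+i+k≡j) ⟩
          x ^ toℕ j              ≈⟨ code-injective eq ⟨
          x ^ toℕ i              ≈⟨ *-identityʳ _ ⟨
          x ^ toℕ i * 1#         ∎) ⟩
        0#                                        ∎))

module FrobeniusDifference (K : DiscreteField c ℓ) (q : ℕ) where
  open DiscreteField K

  Δ : Carrier → Carrier
  Δ x = x ^ q - x

  Δ^ : ℕ → Carrier → Carrier
  Δ^ zero    x = x
  Δ^ (suc k) x = Δ (Δ^ k x)

  Δ^-Δ : ∀ k x → Δ^ k (Δ x) ≡ Δ (Δ^ k x)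
  Δ^-Δ zero    x = ≡.refl
  Δ^-Δ (suc k) x = ≡.cong Δ (Δ^-Δ k x)

-- The chain will consist of images of `top` under powers of Δ; the degree of the extension is left
-- open.
record Extension (F : FiniteField c ℓ) (h : ℕ) : Set (Level.suc (c ⊔ ℓ)) where
  private module F = FiniteField F
  field
    discreteField : DiscreteField c ℓ
  open DiscreteField discreteField public
  field
    ι      : F.Carrier → Carrier
    ι-cong : ∀ {s t} → s F.≈ t → ι s ≈ ι t
    ι-+    : ∀ s t → ι (s F.+ t) ≈ ι s + ι t
    ι-*    : ∀ s t → ι (s F.* t) ≈ ι s * ι t
    ι-0    : ι F.0# ≈ 0#
    ι-1    : ι F.1# ≈ 1#

  open FrobeniusDifference discreteField F.q public
  field
    top   : Carrier
    Δ^top : Δ^ h top ≈ 1#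

extension : (F : FiniteField c ℓ) (h : ℕ) → Extension F h
extension {c} {ℓ} F h with Tower.tower F h
... | 𝒱 , differences≈id with PolynomialAction.minimal-annihilator F 𝒱 _ (PolynomialAction.annihilates-size F 𝒱)
... | l , ann , ¬ann = record
  { discreteField = field′
  ; ι             = constant
  ; ι-cong        = λ s≈t → +ᴹ-congʳ (*ₗ-congʳ s≈t)
  ; ι-+           = λ s t → ≈ᴹ-refl
  ; ι-*           = λ s t → ≈ᴹ-trans (act-constant (s * t) v)
      (≈ᴹ-trans (*ₗ-assoc s t v) (≈ᴹ-sym (≈ᴹ-trans (act-⊗ (constant s) (constant t) v)
        (≈ᴹ-trans (act-constant s _) (*ₗ-congˡ (act-constant t v))))))
  ; ι-0           = ≈ᴹ-trans (act-constant 0# v) (*ₗ-zeroˡ v)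
  ; ι-1           = ≈ᴹ-refl
  ; top           = X
  ; Δ^top         = begin
      act (Δ^ h X) v             ≈⟨ act-Δ^ h X v ⟩
      differences h (act X) v    ≈⟨ differences-ext h apply-cong act-X v ⟩
      differences h apply v      ≈⟨ differences≈id v ⟩
      v                          ≈⟨ ≈ᴹ-trans (act-constant 1# v) (*ₗ-identityˡ v) ⟨
      act (constant 1#) v        ∎
  }
  where
  open PolynomialAction F 𝒱
  open Minimal ann ¬ann renaming (generator to v)
  open LinearOperators.FiniteSpace 𝒱
  open FiniteField F using (_*_; 0#; 1#; q)
  open SetoidReasoning ≈ᴹ-setoid
  field′ : DiscreteField c ℓ
  field′ = finite-domain⇒field (quotientRing v) (λ f → Inverse.to enumeration (act f v))
    (Inverse.to-cong enumeration) (Enumerated.to-injective enumeration)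
    (λ 1≈0 → generator≉0 (≈ᴹ-trans (≈ᴹ-sym (≈ᴹ-trans (act-constant 1# v) (*ₗ-identityˡ v))) 1≈0))
    domain
  open DiscreteField field′ using (_^_)
  open FrobeniusDifference field′ q
  X : Polynomial
  X = 0# ∷ 1# ∷ []
  act-X : ∀ w → act X w ≈ᴹ apply w
  act-X w = ≈ᴹ-trans (+ᴹ-cong (*ₗ-zeroˡ w) (apply-cong (≈ᴹ-trans (act-constant 1# w) (*ₗ-identityˡ w))))
                     (+ᴹ-identityˡ _)
  act-^ : ∀ f k w → act (f ^ k) w ≈ᴹ iterate (act f) k w
  act-^ f zero    w = ≈ᴹ-trans (act-constant 1# w) (*ₗ-identityˡ w)
  act-^ f (suc k) w = ≈ᴹ-trans (act-⊗ f (f ^ k) w) (act-cong f (act-^ f k w))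
  act-Δ : ∀ f w → act (Δ f) w ≈ᴹ difference (act f) w
  act-Δ f w = ≈ᴹ-trans (act-⊕ (f ^ q) (⊝ f) w) (+ᴹ-cong (act-^ f q w) (act-⊝ f w))
  act-Δ^ : ∀ k f w → act (Δ^ k f) w ≈ᴹ differences k (act f) w
  act-Δ^ zero    f w = ≈ᴹ-refl
  act-Δ^ (suc k) f w = ≈ᴹ-trans (≈ᴹ-reflexive (≡.cong (λ g → act g w) (≡.sym (Δ^-Δ k f))))
    (≈ᴹ-trans (act-Δ^ k (Δ f) w) (differences-ext k (difference-cong (act-cong f)) (act-Δ f) w))

-- Differential operators and their rank

module ExtensionProperties {F : FiniteField c ℓ} {h : ℕ} (E : Extension F h) where
  open Extension E
  private module F = FiniteField F
  open F using (q; predpred)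
  open SetoidReasoning setoid
  open RingProperties ring using (-‿distribʳ-*; [y-z]x≈yx-zx; x[y-z]≈xy-xz)
  open AbelianGroupProperties +-abelianGroup using (⁻¹-∙-comm; inverseʳ-unique)
  open CommutativeSemigroupProperties
    (CommutativeMonoid.commutativeSemigroup +-commutativeMonoid) using (interchange)

  ι-⋆ : ∀ m → ι (m F.⋆ F.1#) ≈ m ⋆ 1#
  ι-⋆ zero    = ι-0
  ι-⋆ (suc m) = trans (ι-+ _ _) (+-cong ι-1 (ι-⋆ m))

  ι-neg : ∀ s → ι (F.- s) ≈ - ι s
  ι-neg s = inverseʳ-unique (ι s) (ι (F.- s))
    (trans (sym (ι-+ s (F.- s))) (trans (ι-cong (F.-‿inverseʳ s)) ι-0))

  ι-^ : ∀ s k → ι (s F.^ k) ≈ ι s ^ k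
  ι-^ s zero    = ι-1
  ι-^ s (suc k) = trans (ι-* _ _) (*-congˡ (ι-^ s k))

  ι≈0⇒≈0 : ∀ {s} → ι s ≈ 0# → s F.≈ F.0#
  ι≈0⇒≈0 {s} ιs≈0 with s F.≟ F.0#
  ... | yes s≈0 = s≈0
  ... | no  s≉0 with F.inverse s s≉0
  ... | t , st≈1 = contradiction
    (trans (trans (sym ι-1) (trans (ι-cong (F.sym st≈1)) (ι-* s t))) (trans (*-congʳ ιs≈0) (zeroˡ _))) 1≉0

  ι-injective : ∀ {s t} → ι s ≈ ι t → s F.≈ t
  ι-injective {s} {t} eq = F.x-y≈0⇒x≈y s t
    (ι≈0⇒≈0 (trans (ι-+ s (F.- t)) (trans (+-congˡ (ι-neg t)) (x≈y⇒x-y≈0 eq))))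

  -- The inner binomial coefficients vanish in F, hence through `ι` in K, and the binomial theorem
  -- keeps only its two outer terms.
  frobenius-+ : ∀ x y → (x + y) ^ q ≈ x ^ q + y ^ q
  frobenius-+ x y = begin
    (x + y) ^ q
      ≈⟨ theorem q x y ⟩
    binomialTerm x y q zero + sum (tail (binomialTerm x y q))
      ≈⟨ +-congˡ (sum-init-last (tail (binomialTerm x y q))) ⟩
    binomialTerm x y q zero + (sum {suc predpred} (λ i → binomialTerm x y q (suc (inject₁ i))) + binomialTerm x y q (fromℕ q))
      ≈⟨ +-cong (trans (+-identityʳ _) (*-identityˡ _))
                (+-cong (sum-zero {suc predpred} _ middle) (term-top (toℕ (fromℕ q)) (Fin.toℕ-fromℕ q))) ⟩
    y ^ q + (0# + x ^ q)
      ≈⟨ trans (+-congˡ (+-identityˡ _)) (+-comm _ _) ⟩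
    x ^ q + y ^ q ∎
    where
    open Binomial commutativeSemiring using (binomialTerm; theorem)
    term-top : ∀ k → k ≡ q → (q C k) ⋆ (x ^ k * y ^ (q ℕ.∸ k)) ≈ x ^ q
    term-top k ≡.refl = begin
      (q C q) ⋆ (x ^ q * y ^ (q ℕ.∸ q))  ≡⟨ ≡.cong₂ (λ m j → m ⋆ (x ^ q * y ^ j)) (nCn≡1 q) (ℕ.n∸n≡0 q) ⟩
      x ^ q * 1# + 0#                    ≈⟨ trans (+-identityʳ _) (*-identityʳ _) ⟩
      x ^ q                              ∎
    vanish : ∀ k z → (q C k) F.⋆ F.1# F.≈ F.0# → (q C k) ⋆ z ≈ 0#
    vanish k z eq = begin
      (q C k) ⋆ z               ≈⟨ ⋆-congʳ (q C k) (*-identityˡ z) ⟨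
      (q C k) ⋆ (1# * z)        ≈⟨ ⋆-assoc-* (q C k) 1# z ⟨
      (q C k) ⋆ 1# * z          ≈⟨ *-congʳ (ι-⋆ (q C k)) ⟨
      ι ((q C k) F.⋆ F.1#) * z  ≈⟨ *-congʳ (trans (ι-cong eq) ι-0) ⟩
      0# * z                    ≈⟨ zeroˡ z ⟩
      0#                        ∎
    middle : ∀ i → binomialTerm x y q (suc (inject₁ i)) ≈ 0#
    middle i = vanish (suc (toℕ (inject₁ i))) _
      (≡.subst (λ k → (q C suc k) F.⋆ F.1# F.≈ F.0#) (≡.sym (Fin.toℕ-inject₁ i))
        (F.binomial-vanishes (suc i) ℕ.z<s))

  Δ-cong : ∀ {x y} → x ≈ y → Δ x ≈ Δ y
  Δ-cong x≈y = +-cong (^-congˡ q x≈y) (-‿cong x≈y)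

  Δ-+ : ∀ x y → Δ (x + y) ≈ Δ x + Δ y
  Δ-+ x y = trans (+-cong (frobenius-+ x y) (sym (⁻¹-∙-comm x y))) (interchange _ _ _ _)

  frobenius-Δ : ∀ x → x ^ q ≈ Δ x + x
  frobenius-Δ x = sym (trans (+-assoc _ _ _) (trans (+-congˡ (-‿inverseˡ x)) (+-identityʳ _)))

  Δ-ι* : ∀ s x → Δ (ι s * x) ≈ ι s * Δ x
  Δ-ι* s x = trans (+-congʳ (trans (^-distrib-* (ι s) x q)
      (*-congʳ (trans (sym (ι-^ s q)) (ι-cong (F.fermat s))))))
    (sym (x[y-z]≈xy-xz (ι s) (x ^ q) x))

  Δ-1 : Δ 1# ≈ 0#
  Δ-1 = x≈y⇒x-y≈0 (1^n≈1 q)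

  leibniz : ∀ x y → Δ (x * y) ≈ x ^ q * Δ y + Δ x * y
  leibniz x y = sym (begin
    x ^ q * Δ y + Δ x * y
      ≈⟨ +-cong (x[y-z]≈xy-xz _ _ _) ([y-z]x≈yx-zx _ _ _) ⟩
    (x ^ q * y ^ q - x ^ q * y) + (x ^ q * y - x * y)
      ≈⟨ trans (+-assoc _ _ _) (+-congˡ (trans (sym (+-assoc _ _ _)) (trans (+-congʳ (-‿inverseˡ _)) (+-identityˡ _)))) ⟩
    x ^ q * y ^ q - x * y
      ≈⟨ +-congʳ (^-distrib-* x y q) ⟨
    Δ (x * y) ∎)

  Δ^-cong : ∀ k {x y} → x ≈ y → Δ^ k x ≈ Δ^ k y
  Δ^-cong zero    x≈y = x≈y
  Δ^-cong (suc k) x≈y = Δ-cong (Δ^-cong k x≈y)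

  Δ^-+ : ∀ k x y → Δ^ k (x + y) ≈ Δ^ k x + Δ^ k y
  Δ^-+ zero    x y = refl
  Δ^-+ (suc k) x y = trans (Δ-cong (Δ^-+ k x y)) (Δ-+ _ _)

  Δ^-ι* : ∀ k s x → Δ^ k (ι s * x) ≈ ι s * Δ^ k x
  Δ^-ι* zero    s x = refl
  Δ^-ι* (suc k) s x = trans (Δ-cong (Δ^-ι* k s x)) (Δ-ι* s _)

  Δ^-0 : ∀ k → Δ^ k 0# ≈ 0#
  Δ^-0 k = begin
    Δ^ k 0#              ≈⟨ Δ^-cong k (trans (*-congʳ ι-0) (zeroˡ 0#)) ⟨
    Δ^ k (ι F.0# * 0#)   ≈⟨ Δ^-ι* k F.0# 0# ⟩
    ι F.0# * Δ^ k 0#     ≈⟨ trans (*-congʳ ι-0) (zeroˡ _) ⟩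
    0#                   ∎

  Δ^-Δ^ : ∀ j k x → Δ^ (j ℕ.+ k) x ≡ Δ^ j (Δ^ k x)
  Δ^-Δ^ zero    k x = ≡.refl
  Δ^-Δ^ (suc j) k x = ≡.cong Δ (Δ^-Δ^ j k x)

  ι-sum : (s : Vector F.Carrier n) → ι (F.sum s) ≈ sum (ι ∘ s)
  ι-sum {zero}  s = ι-0
  ι-sum {suc n} s = trans (ι-+ _ _) (+-congˡ (ι-sum (tail s)))

  combination-of : Vector F.Carrier n → Vector Carrier n → Carrier
  combination-of s v = sum λ i → ι (s i) * v i

  Δ^-combination : ∀ k (s : Vector F.Carrier n) v →
                   Δ^ k (combination-of s v) ≈ combination-of s (Δ^ k ∘ v)
  Δ^-combination {zero}  k s v = Δ^-0 k
  Δ^-combination {suc n} k s v = trans (Δ^-+ k _ _)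
    (+-cong (Δ^-ι* k _ _) (Δ^-combination k (tail s) (tail v)))

  -- X ^ q - X has at most q roots, and the elements of F are q of them.
  Δ≈0⇒constant : ∀ x → Δ x ≈ 0# → ∃ λ s → x ≈ ι s
  Δ≈0⇒constant x Δx≈0
    with Enumerated.any? F.enumeration (λ s≈t x≈ιs → trans x≈ιs (ι-cong s≈t)) (λ s → x ≟ ι s)
  ... | yes constant = constant
  ... | no ¬constant = contradiction
    (root-bound f (x Vector.∷ (ι ∘ F.from)) distinct root (suc (suc (fromℕ predpred)))) lead≉0
    where
    monomial : Vector Carrier (suc predpred)
    monomial i with i Fin.≟ fromℕ predpred
    ... | yes _ = 1#
    ... | no  _ = 0#
    f : Vector Carrier (suc q)
    f = 0# Vector.∷ (- 1# Vector.∷ monomial)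
    lead≈1 : monomial (fromℕ predpred) ≈ 1#
    lead≈1 with fromℕ predpred Fin.≟ fromℕ predpred
    ... | yes _   = refl
    ... | no  neq = contradiction ≡.refl neq
    lead≉0 : ¬ monomial (fromℕ predpred) ≈ 0#
    lead≉0 eq = 1≉0 (trans (sym lead≈1) eq)
    off-lead : ∀ z i → i ≢ fromℕ predpred → monomial i * z ≈ 0#
    off-lead z i neq with i Fin.≟ fromℕ predpred
    ... | yes eq = contradiction eq neq
    ... | no  _  = zeroˡ z
    evaluate-monomial : ∀ z → evaluate monomial z ≈ z ^ predpred
    evaluate-monomial z = trans
      (sum-single +-commutativeMonoid (λ i → monomial i * z ^ toℕ i) (fromℕ predpred) λ i → off-lead _ i)
      (trans (*-cong lead≈1 (reflexive (≡.cong (z ^_) (Fin.toℕ-fromℕ predpred)))) (*-identityˡ _))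
    evaluate-f : ∀ z → evaluate f z ≈ Δ z
    evaluate-f z = begin
      evaluate f z                                      ≈⟨ evaluate-step f z ⟩
      0# + z * evaluate (tail f) z                      ≈⟨ trans (+-identityˡ _) (*-congˡ (evaluate-step (tail f) z)) ⟩
      z * (- 1# + z * evaluate monomial z)              ≈⟨ *-congˡ (+-congˡ (*-congˡ (evaluate-monomial z))) ⟩
      z * (- 1# + z * z ^ predpred)                     ≈⟨ distribˡ z _ _ ⟩
      z * - 1# + z ^ q                                  ≈⟨ +-congʳ (trans (sym (-‿distribʳ-* z 1#)) (-‿cong (*-identityʳ z))) ⟩
      - z + z ^ q                                       ≈⟨ +-comm _ _ ⟩
      Δ z                                               ∎
    root : ∀ i → evaluate f ((x Vector.∷ (ι ∘ F.from)) i) ≈ 0#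
    root zero    = trans (evaluate-f x) Δx≈0
    root (suc i) = trans (evaluate-f (ι (F.from i)))
      (x≈y⇒x-y≈0 (trans (sym (ι-^ _ q)) (ι-cong (F.fermat _))))
    distinct : ∀ i j → (x Vector.∷ (ι ∘ F.from)) i ≈ (x Vector.∷ (ι ∘ F.from)) j → i ≡ j
    distinct zero    zero    _  = ≡.refl
    distinct zero    (suc j) eq = contradiction (F.from j , eq) ¬constant
    distinct (suc i) zero    eq = contradiction (F.from i , sym eq) ¬constant
    distinct (suc i) (suc j) eq = ≡.cong suc (F.from-injective (ι-injective eq))

  -- One use of `leibniz` turns the product into `x ^ q * Δ y`, where the right factor has lower
  -- order, and `Δ x * y`, where the left one has. The factor `x ^ q` has no larger order than x, as
  -- it equals Δ x + x. Writing the orders as successors keeps a + b - 1 free of subtraction.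
  product-kernel : ∀ a b x y → Δ^ (suc a) x ≈ 0# → Δ^ (suc b) y ≈ 0# → Δ^ (suc (a ℕ.+ b)) (x * y) ≈ 0#
  product-kernel a b x y x∈ y∈ = begin
    Δ^ (suc (a ℕ.+ b)) (x * y)                            ≡⟨ Δ^-Δ (a ℕ.+ b) (x * y) ⟨
    Δ^ (a ℕ.+ b) (Δ (x * y))                              ≈⟨ Δ^-cong (a ℕ.+ b) (leibniz x y) ⟩
    Δ^ (a ℕ.+ b) (x ^ q * Δ y + Δ x * y)                  ≈⟨ Δ^-+ (a ℕ.+ b) _ _ ⟩
    Δ^ (a ℕ.+ b) (x ^ q * Δ y) + Δ^ (a ℕ.+ b) (Δ x * y)   ≈⟨ +-cong (left b y∈) (right a x∈) ⟩
    0# + 0#                                               ≈⟨ +-identityˡ 0# ⟩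
    0#                                                    ∎
    where
    σx∈ : Δ^ (suc a) (x ^ q) ≈ 0#
    σx∈ = begin
      Δ^ (suc a) (x ^ q)                  ≈⟨ Δ^-cong (suc a) (frobenius-Δ x) ⟩
      Δ^ (suc a) (Δ x + x)                ≈⟨ Δ^-+ (suc a) (Δ x) x ⟩
      Δ^ (suc a) (Δ x) + Δ^ (suc a) x     ≈⟨ +-cong (trans (reflexive (Δ^-Δ (suc a) x)) (trans (Δ-cong x∈) (Δ^-0 1))) x∈ ⟩
      0# + 0#                             ≈⟨ +-identityˡ 0# ⟩
      0#                                  ∎
    left : ∀ b → Δ^ (suc b) y ≈ 0# → Δ^ (a ℕ.+ b) (x ^ q * Δ y) ≈ 0#
    left zero    y∈ = trans (Δ^-cong (a ℕ.+ 0) (trans (*-congˡ y∈) (zeroʳ _))) (Δ^-0 (a ℕ.+ 0))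
    left (suc b) y∈ = trans (reflexive (≡.cong (λ k → Δ^ k (x ^ q * Δ y)) (ℕ.+-suc a b)))
      (product-kernel a b (x ^ q) (Δ y) σx∈ (trans (reflexive (Δ^-Δ (suc b) y)) y∈))
    right : ∀ a → Δ^ (suc a) x ≈ 0# → Δ^ (a ℕ.+ b) (Δ x * y) ≈ 0#
    right zero    x∈ = trans (Δ^-cong b (trans (*-congʳ x∈) (zeroˡ _))) (Δ^-0 b)
    right (suc a) x∈ = product-kernel a b (Δ x) y (trans (reflexive (Δ^-Δ (suc a) x)) x∈) y∈

-- The chain as a basis of the kernels of powers of Δ

module Chain {F : FiniteField c ℓ} {h : ℕ} (E : Extension F h) where
  open Extension E
  open ExtensionProperties E
  private module F = FiniteField F
  open SetoidReasoning setoid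

  -- Numbered from the far end: for j ≤ h, h - j applications of Δ to `top` leave an element with
  -- Δ^j (e j) = 1, so `e 0` is 1 and `e h` is `top`.
  e : ℕ → Carrier
  e j = Δ^ (h ℕ.∸ j) top

  Δ^e : ∀ j k → j ℕ.+ k ℕ.≤ h → Δ^ k (e (j ℕ.+ k)) ≈ e j
  Δ^e j k j+k≤h = reflexive (≡.trans (≡.sym (Δ^-Δ^ k (h ℕ.∸ (j ℕ.+ k)) top)) (≡.cong (λ m → Δ^ m top) eq))
    where
    eq : k ℕ.+ (h ℕ.∸ (j ℕ.+ k)) ≡ h ℕ.∸ j
    eq = ≡.trans (≡.cong (k ℕ.+_) (≡.sym (ℕ.∸-+-assoc h j k)))
           (ℕ.m+[n∸m]≡n (ℕ.m+n≤o⇒m≤o∸n k (≡.subst (ℕ._≤ h) (ℕ.+-comm j k) j+k≤h)))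

  Δ^e≈1 : ∀ j → j ℕ.≤ h → Δ^ j (e j) ≈ 1#
  Δ^e≈1 j j≤h = trans (Δ^e 0 j j≤h) Δ^top

  Δ^e≈0 : ∀ j k → j ℕ.≤ h → j ℕ.< k → Δ^ k (e j) ≈ 0#
  Δ^e≈0 j (suc k) j≤h (ℕ.s≤s j≤k) with ℕ.m≤n⇒∃[o]m+o≡n j≤k
  ... | o , ≡.refl = begin
    Δ^ (suc (j ℕ.+ o)) (e j)      ≡⟨ ≡.cong (λ m → Δ^ m (e j)) (≡.trans (≡.cong suc (ℕ.+-comm j o)) (≡.sym (ℕ.+-suc o j))) ⟩
    Δ^ (o ℕ.+ suc j) (e j)        ≡⟨ Δ^-Δ^ o (suc j) (e j) ⟩
    Δ^ o (Δ (Δ^ j (e j)))         ≈⟨ Δ^-cong o (trans (Δ-cong (Δ^e≈1 j j≤h)) Δ-1) ⟩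
    Δ^ o 0#                       ≈⟨ Δ^-0 o ⟩
    0#                            ∎

  basis : Vector Carrier (suc h)
  basis i = e (toℕ i)

  toℕ≤h : (i : Fin (suc h)) → toℕ i ℕ.≤ h
  toℕ≤h i = ℕ.s≤s⁻¹ (Fin.toℕ<n i)

  Independent : Vector Carrier n → Set _
  Independent v = ∀ s → combination-of s v ≈ 0# → ∀ i → s i F.≈ F.0#

  -- Coefficients vanish from the top down: once those above b are 0, applying Δ^b isolates the
  -- b-th, because it annihilates the earlier chain elements and sends `e b` to 1.
  basis-independent : Independent basis
  basis-independent s s≈0 i = below (suc h) ℕ.≤-refl
    (λ i h<i → contradiction (Fin.toℕ<n i) (ℕ.≤⇒≯ h<i)) i
    where
    below : ∀ b → b ℕ.≤ suc h → (∀ i → b ℕ.≤ toℕ i → s i F.≈ F.0#) → ∀ i → s i F.≈ F.0#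
    below zero    b≤n above i = above i ℕ.z≤n
    below (suc b) b<n above = below b (ℕ.<⇒≤ b<n) above′
      where
      i₀ : Fin (suc h)
      i₀ = Fin.fromℕ< b<n
      toℕ-i₀ : toℕ i₀ ≡ b
      toℕ-i₀ = Fin.toℕ-fromℕ< b<n
      off : ∀ i → i ≢ i₀ → ι (s i) * Δ^ b (basis i) ≈ 0#
      off i i≢i₀ with ℕ.<-cmp (toℕ i) b
      ... | tri< i<b _ _ = trans (*-congˡ (Δ^e≈0 (toℕ i) b (toℕ≤h i) i<b)) (zeroʳ _)
      ... | tri≈ _ i≡b _ = contradiction (Fin.toℕ-injective (≡.trans i≡b (≡.sym toℕ-i₀))) i≢i₀
      ... | tri> _ _ b<i = trans (*-congʳ (trans (ι-cong (above i b<i)) ι-0)) (zeroˡ _)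
      s₀≈0 : s i₀ F.≈ F.0#
      s₀≈0 = ι≈0⇒≈0 (begin
        ι (s i₀)                              ≈⟨ *-identityʳ _ ⟨
        ι (s i₀) * 1#                         ≈⟨ *-congˡ (≡.subst (λ b → Δ^ b (basis i₀) ≈ 1#) toℕ-i₀ (Δ^e≈1 (toℕ i₀) (toℕ≤h i₀))) ⟨
        ι (s i₀) * Δ^ b (basis i₀)            ≈⟨ sum-single +-commutativeMonoid _ i₀ off ⟨
        combination-of s (Δ^ b ∘ basis)       ≈⟨ Δ^-combination b s basis ⟨
        Δ^ b (combination-of s basis)         ≈⟨ Δ^-cong b s≈0 ⟩
        Δ^ b 0#                               ≈⟨ Δ^-0 b ⟩
        0#                                    ∎)
      above′ : ∀ i → b ℕ.≤ toℕ i → s i F.≈ F.0#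
      above′ i b≤i with ℕ.m≤n⇒m<n∨m≡n b≤i
      ... | inj₁ b<i = above i b<i
      ... | inj₂ b≡i = ≡.subst (λ i → s i F.≈ F.0#) (Fin.toℕ-injective (≡.trans toℕ-i₀ b≡i)) s₀≈0

  -- If Δ^(b + 1) x = 0, then Δ^b x is a constant t of F, and x - t e_b already lies in ker Δ^b.
  kernel-coordinates : ∀ b → b ℕ.≤ suc h → ∀ x → Δ^ b x ≈ 0# →
    ∃ λ (s : Vector F.Carrier (suc h)) → (∀ i → b ℕ.≤ toℕ i → s i F.≈ F.0#) × combination-of s basis ≈ x
  kernel-coordinates zero    _   x x≈0 = (λ _ → F.0#) , (λ _ _ → F.refl)
    , trans (sum-zero {suc h} _ λ i → trans (*-congʳ ι-0) (zeroˡ (basis i))) (sym x≈0)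
  kernel-coordinates (suc b) b<n x x∈ with Δ≈0⇒constant (Δ^ b x) x∈
  ... | t , Δ^bx≈t = extend (kernel-coordinates b (ℕ.<⇒≤ b<n) x′ x′∈)
    where
    x′ = x + ι (F.- t) * e b
    x′∈ : Δ^ b x′ ≈ 0#
    x′∈ = begin
      Δ^ b x′                             ≈⟨ Δ^-+ b _ _ ⟩
      Δ^ b x + Δ^ b (ι (F.- t) * e b)     ≈⟨ +-cong Δ^bx≈t (trans (Δ^-ι* b _ _) (trans (*-congˡ (Δ^e≈1 b (ℕ.s≤s⁻¹ b<n))) (*-identityʳ _))) ⟩
      ι t + ι (F.- t)                     ≈⟨ ι-+ t (F.- t) ⟨
      ι (t F.+ F.- t)                     ≈⟨ trans (ι-cong (F.-‿inverseʳ t)) ι-0 ⟩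
      0#                                  ∎
    i₀ : Fin (suc h)
    i₀ = Fin.fromℕ< b<n
    toℕ-i₀ : toℕ i₀ ≡ b
    toℕ-i₀ = Fin.toℕ-fromℕ< b<n
    δ : Vector F.Carrier (suc h)
    δ i with i Fin.≟ i₀
    ... | yes _ = t
    ... | no  _ = F.0#
    δ-on : δ i₀ ≡ t
    δ-on with i₀ Fin.≟ i₀
    ... | yes _   = ≡.refl
    ... | no  neq = contradiction ≡.refl neq
    δ-off : ∀ i → i ≢ i₀ → δ i ≡ F.0#
    δ-off i neq with i Fin.≟ i₀
    ... | yes eq = contradiction eq neq
    ... | no  _  = ≡.refl
    extend : (∃ λ s → (∀ i → b ℕ.≤ toℕ i → s i F.≈ F.0#) × combination-of s basis ≈ x′) →
             ∃ λ s → (∀ i → suc b ℕ.≤ toℕ i → s i F.≈ F.0#) × combination-of s basis ≈ x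
    extend (s , above , s≈x′) = (λ i → s i F.+ δ i)
      , (λ i b<i → F.trans (F.+-cong (above i (ℕ.<⇒≤ b<i))
            (F.reflexive (δ-off i λ { ≡.refl → ℕ.<-irrefl (≡.sym toℕ-i₀) b<i }))) (F.+-identityˡ _))
      , (begin
        combination-of (λ i → s i F.+ δ i) basis
          ≈⟨ sum-cong-≋ (λ i → trans (*-congʳ (ι-+ (s i) (δ i))) (distribʳ (basis i) _ _)) ⟩
        sum (λ i → ι (s i) * basis i + ι (δ i) * basis i)
          ≈⟨ ∑-distrib-+ (λ i → ι (s i) * basis i) (λ i → ι (δ i) * basis i) ⟩
        combination-of s basis + combination-of δ basis
          ≈⟨ +-cong s≈x′ (sum-single +-commutativeMonoid _ i₀ λ i neq →
               trans (*-congʳ (trans (reflexive (≡.cong ι (δ-off i neq))) ι-0)) (zeroˡ (basis i))) ⟩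
        x + ι (F.- t) * e b + ι (δ i₀) * e (toℕ i₀)
          ≡⟨ ≡.cong₂ (λ t′ j → x + ι (F.- t) * e b + ι t′ * e j) δ-on toℕ-i₀ ⟩
        x + ι (F.- t) * e b + ι t * e b
          ≈⟨ trans (+-assoc _ _ _) (+-congˡ (sym (distribʳ _ _ _))) ⟩
        x + (ι (F.- t) + ι t) * e b
          ≈⟨ +-congˡ (trans (*-congʳ (trans (sym (ι-+ _ _)) (trans (ι-cong (F.-‿inverseˡ t)) ι-0))) (zeroˡ _)) ⟩
        x + 0#
          ≈⟨ +-identityʳ x ⟩
        x ∎)

-- Kernel and rank of an operator of bounded order

module RankBound {F : FiniteField c ℓ} {h : ℕ} (E : Extension F h) where
  open Extension E
  open ExtensionProperties E
  open Chain E using (Independent)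
  private module F = FiniteField F
  open SetoidReasoning setoid
  private module M = CommutativeSemigroupProperties
            (CommutativeMonoid.commutativeSemigroup *-commutativeMonoid)

  differential : Vector Carrier n → Carrier → Carrier
  differential α x = sum λ i → α i * Δ^ (toℕ i) x

  differential-step : (α : Vector Carrier (suc n)) (x : Carrier) →
                      differential α x ≈ head α * x + differential (tail α) (Δ x)
  differential-step α x = +-congˡ (sum-cong-≋ λ i → *-congˡ {tail α i} (reflexive (≡.sym (Δ^-Δ (toℕ i) x))))

  differential-cong : (α : Vector Carrier n) → ∀ {x y} → x ≈ y → differential α x ≈ differential α y
  differential-cong α x≈y = sum-cong-≋ λ i → *-congˡ {α i} (Δ^-cong (toℕ i) x≈y)

  differential-+ : (α : Vector Carrier n) → ∀ x y → differential α (x + y) ≈ differential α x + differential α y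
  differential-+ α x y = trans
    (sum-cong-≋ λ i → trans (*-congˡ (Δ^-+ (toℕ i) x y)) (distribˡ (α i) _ _))
    (∑-distrib-+ (λ i → α i * Δ^ (toℕ i) x) (λ i → α i * Δ^ (toℕ i) y))

  differential-ι* : (α : Vector Carrier n) → ∀ s x → differential α (ι s * x) ≈ ι s * differential α x
  differential-ι* α s x = trans
    (sum-cong-≋ λ i → trans (*-congˡ (Δ^-ι* (toℕ i) s x)) (M.x∙yz≈y∙xz (α i) (ι s) _))
    (sym (*-distribˡ-sum (ι s) λ i → α i * Δ^ (toℕ i) x))

  differential-0 : (α : Vector Carrier n) → differential α 0# ≈ 0#
  differential-0 α = sum-zero _ λ i → trans (*-congˡ (Δ^-0 (toℕ i))) (zeroʳ (α i))

  differential-coefficients-+ : (α β : Vector Carrier n) → ∀ x →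
    differential (λ i → α i + β i) x ≈ differential α x + differential β x
  differential-coefficients-+ α β x = trans
    (sum-cong-≋ λ i → distribʳ (Δ^ (toℕ i) x) (α i) (β i))
    (∑-distrib-+ (λ i → α i * Δ^ (toℕ i) x) (λ i → β i * Δ^ (toℕ i) x))

  differential-init : (α : Vector Carrier (suc n)) → last α ≈ 0# → ∀ x →
                      differential α x ≈ differential (init α) x
  differential-init {n} α last≈0 x = trans (sum-init-last λ i → α i * Δ^ (toℕ i) x) (trans
    (+-cong (sum-cong-≋ {n} λ i → *-congˡ {init α i} (reflexive (≡.cong (λ k → Δ^ k x) (Fin.toℕ-inject₁ i))))
            (trans (*-congʳ last≈0) (zeroˡ _)))
    (+-identityʳ _))

  -- The coefficients of y ↦ L (u y), where L has coefficients α.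
  twist : Vector Carrier n → Carrier → Vector Carrier n
  twist {zero}  α u = α
  twist {suc n} α u i =
    (head α * u Vector.∷ twist (tail α) (u ^ F.q)) i + snoc (twist (tail α) (Δ u)) 0# i

  last-snoc : ∀ {n} (α : Vector Carrier n) → last (snoc α 0#) ≡ 0#
  last-snoc {n} α = snoc-fromℕ α 0#

  -- The leading coefficient is that of α multiplied by u^(q^n); the padded summand contributes 0
  -- there.
  twist-last : ∀ (α : Vector Carrier (suc n)) u → ¬ u ≈ 0# → ¬ last α ≈ 0# → ¬ last (twist α u) ≈ 0#
  twist-last {zero}  α u u≉0 last≉0 eq = u≉0 (x*y≈0⇒y≈0 (head α) last≉0 (trans (sym (+-identityʳ _)) eq))
  twist-last {suc n} α u u≉0 last≉0 eq = twist-last (tail α) (u ^ F.q) (power≉0 F.q) last≉0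
    (trans (sym (+-identityʳ _)) (trans (+-congˡ (sym (reflexive (last-snoc (twist (tail α) (Δ u)))))) eq))
    where
    power≉0 : ∀ k → ¬ u ^ k ≈ 0#
    power≉0 zero    eq = 1≉0 eq
    power≉0 (suc k) eq = power≉0 k (x*y≈0⇒y≈0 u u≉0 eq)

  differential-snoc : (α : Vector Carrier n) → ∀ x → differential (snoc α 0#) x ≈ differential α x
  differential-snoc {n} α x = trans (differential-init (snoc α 0#) (reflexive (last-snoc α)) x)
    (sum-cong-≋ λ i → *-congʳ {Δ^ (toℕ i) x} (reflexive (snoc-inject₁ α 0# i)))

  -- By `leibniz`, Δ (u y) has a part u^q Δ y, which gains one Δ and accounts for the shift by one
  -- place in `twist`, and a part Δ u y, which does not and accounts for the padding at the top.
  differential-twist : (α : Vector Carrier n) → ∀ u y → differential α (u * y) ≈ differential (twist α u) y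
  differential-twist {zero}  α u y = refl
  differential-twist {suc n} α u y = begin
    differential α (u * y)
      ≈⟨ differential-step α (u * y) ⟩
    head α * (u * y) + differential (tail α) (Δ (u * y))
      ≈⟨ +-cong (sym (*-assoc _ _ _)) (trans (differential-cong (tail α) (leibniz u y)) (differential-+ (tail α) _ _)) ⟩
    head α * u * y + (differential (tail α) (u ^ F.q * Δ y) + differential (tail α) (Δ u * y))
      ≈⟨ +-congˡ (+-cong (differential-twist (tail α) (u ^ F.q) (Δ y)) (differential-twist (tail α) (Δ u) y)) ⟩
    head α * u * y + (differential (twist (tail α) (u ^ F.q)) (Δ y) + differential (twist (tail α) (Δ u)) y)
      ≈⟨ +-assoc _ _ _ ⟨
    head α * u * y + differential (twist (tail α) (u ^ F.q)) (Δ y) + differential (twist (tail α) (Δ u)) y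
      ≈⟨ +-cong (differential-step (head α * u Vector.∷ twist (tail α) (u ^ F.q)) y)
                (differential-snoc (twist (tail α) (Δ u)) y) ⟨
    differential (head α * u Vector.∷ twist (tail α) (u ^ F.q)) y + differential (snoc (twist (tail α) (Δ u)) 0#) y
      ≈⟨ differential-coefficients-+ (head α * u Vector.∷ twist (tail α) (u ^ F.q)) (snoc (twist (tail α) (Δ u)) 0#) y ⟨
    differential (twist α u) y ∎

  combination-of-* : ∀ x (s : Vector F.Carrier n) v → combination-of s (λ i → x * v i) ≈ x * combination-of s v
  combination-of-* x s v = trans (sum-cong-≋ λ i → M.x∙yz≈y∙xz (ι (s i)) x (v i))
    (sym (*-distribˡ-sum x λ i → ι (s i) * v i))

  head≉0 : (v : Vector Carrier (suc n)) → Independent v → ¬ head v ≈ 0#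
  head≉0 v ind v₀≈0 = 1≉0 (trans (sym ι-1) (trans (ι-cong (ind (F.1# Vector.∷ λ _ → F.0#) (begin
    ι F.1# * head v + sum (λ i → ι F.0# * tail v i)
      ≈⟨ +-cong (trans (*-congˡ v₀≈0) (zeroʳ _)) (sum-zero _ λ i → trans (*-congʳ ι-0) (zeroˡ (tail v i))) ⟩
    0# + 0#
      ≈⟨ +-identityˡ 0# ⟩
    0# ∎) zero)) ι-0))

  -- Dividing by an element u of the kernel of L gives L (u y) = L′ (Δ y), where
  -- L′ has smaller order, and Δ is injective modulo F.
  kernel-bound-lead : ∀ k (α : Vector Carrier (suc k)) → ¬ last α ≈ 0# →
                      ∀ m (v : Vector Carrier m) → Independent v →
                      (∀ j → differential α (v j) ≈ 0#) → m ℕ.≤ k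
  kernel-bound-lead k       α last≉0 zero    v ind v∈ = ℕ.z≤n
  kernel-bound-lead zero    α last≉0 (suc m) v ind v∈ = contradiction
    (x*y≈0⇒y≈0 (head α) last≉0 (trans (sym (+-identityʳ _)) (v∈ zero))) (head≉0 v ind)
  kernel-bound-lead (suc k) α last≉0 (suc m) v ind v∈ with inverse (head v) (head≉0 v ind)
  ... | u⁻¹ , uu⁻¹≈1 = ℕ.s≤s (kernel-bound-lead k (tail β) (twist-last α u (head≉0 v ind) last≉0) m w w-ind w∈)
    where
    u = head v
    β = twist α u
    w : Vector Carrier m
    w j = Δ (u⁻¹ * tail v j)
    u[u⁻¹x]≈x : ∀ x → u * (u⁻¹ * x) ≈ x
    u[u⁻¹x]≈x x = trans (sym (*-assoc u u⁻¹ x)) (trans (*-congʳ uu⁻¹≈1) (*-identityˡ x))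
    β₀≈0 : head β ≈ 0#
    β₀≈0 = begin
      head β                                            ≈⟨ trans (+-cong (*-identityʳ _) (trans (differential-cong (tail β) Δ-1) (differential-0 (tail β)))) (+-identityʳ _) ⟨
      head β * 1# + differential (tail β) (Δ 1#)        ≈⟨ differential-step β 1# ⟨
      differential β 1#                                 ≈⟨ differential-twist α u 1# ⟨
      differential α (u * 1#)                           ≈⟨ differential-cong α (*-identityʳ u) ⟩
      differential α u                                  ≈⟨ v∈ zero ⟩
      0#                                                ∎
    w∈ : ∀ j → differential (tail β) (w j) ≈ 0#
    w∈ j = begin
      differential (tail β) (Δ y)                       ≈⟨ trans (+-congʳ (trans (*-congʳ β₀≈0) (zeroˡ y))) (+-identityˡ _) ⟨
      head β * y + differential (tail β) (Δ y)          ≈⟨ differential-step β y ⟨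
      differential β y                                  ≈⟨ differential-twist α u y ⟨
      differential α (u * y)                            ≈⟨ differential-cong α (u[u⁻¹x]≈x _) ⟩
      differential α (tail v j)                         ≈⟨ v∈ (suc j) ⟩
      0#                                                ∎
      where y = u⁻¹ * tail v j
    w-ind : Independent w
    w-ind s sw≈0 with Δ≈0⇒constant (u⁻¹ * combination-of s (tail v)) (begin
      Δ (u⁻¹ * combination-of s (tail v))               ≈⟨ Δ-cong (combination-of-* u⁻¹ s (tail v)) ⟨
      Δ (combination-of s (λ j → u⁻¹ * tail v j))       ≈⟨ Δ^-combination 1 s _ ⟩
      combination-of s w                                ≈⟨ sw≈0 ⟩
      0#                                                ∎)
    ... | t , u⁻¹sv≈t = λ j → ind (F.- t Vector.∷ s) (begin
      ι (F.- t) * u + combination-of s (tail v)         ≈⟨ +-congˡ (u[u⁻¹x]≈x _) ⟨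
      ι (F.- t) * u + u * (u⁻¹ * combination-of s (tail v))   ≈⟨ +-cong (*-comm _ u) (*-congˡ u⁻¹sv≈t) ⟩
      u * ι (F.- t) + u * ι t                           ≈⟨ distribˡ u _ _ ⟨
      u * (ι (F.- t) + ι t)                             ≈⟨ *-congˡ (trans (sym (ι-+ _ _)) (trans (ι-cong (F.-‿inverseˡ t)) ι-0)) ⟩
      u * 0#                                            ≈⟨ zeroʳ u ⟩
      0#                                                ∎) (suc j)

  kernel-bound : ∀ k (α : Vector Carrier (suc k)) → ¬ (∀ i → α i ≈ 0#) →
                 ∀ m (v : Vector Carrier m) → Independent v →
                 (∀ j → differential α (v j) ≈ 0#) → m ℕ.≤ k
  kernel-bound k α α≉0 m v ind v∈ with last α ≟ 0#
  ... | no last≉0 = kernel-bound-lead k α last≉0 m v ind v∈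
  kernel-bound zero    α α≉0 m v ind v∈ | yes last≈0 = contradiction (λ { zero → last≈0 }) α≉0
  kernel-bound (suc k) α α≉0 m v ind v∈ | yes last≈0 = ℕ.m≤n⇒m≤1+n
    (kernel-bound k (init α) (λ init≈0 → α≉0 (init-last≈0 α init≈0 last≈0)) m v ind
      λ j → trans (sym (differential-init α last≈0 (v j))) (v∈ j))

  -- Elimination on the rows of M: a nonzero entry of the first row clears the rest of that row at
  -- the cost of one vector, and a zero row costs none. After ρ rows the remaining vectors lie in
  -- the kernel, where `kernel-bound` applies.
  rank-bound : ∀ {k} (α : Vector Carrier (suc k)) → ¬ (∀ i → α i ≈ 0#) →
               ∀ ρ m (v : Vector Carrier m) → Independent v →
               (W : Vector Carrier ρ) (M : Fin ρ → Fin m → F.Carrier) →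
               (∀ j → differential α (v j) ≈ sum (λ t → ι (M t j) * W t)) → m ℕ.≤ k ℕ.+ ρ
  rank-bound {k} α α≉0 zero m v ind W M v∈ =
    ≡.subst (m ℕ.≤_) (≡.sym (ℕ.+-identityʳ k)) (kernel-bound k α α≉0 m v ind v∈)
  rank-bound {k} α α≉0 (suc ρ) m v ind W M v∈ with Fin.any? (λ j → ¬? (M zero j F.≟ F.0#))
  ... | no ¬pivot = ℕ.≤-trans
    (rank-bound α α≉0 ρ m v ind (tail W) (M ∘ suc) λ j → trans (v∈ j)
      (trans (+-congʳ (trans (*-congʳ (trans (ι-cong (M₀≈0 j)) ι-0)) (zeroˡ _))) (+-identityˡ _)))
    (ℕ.+-monoʳ-≤ k (ℕ.n≤1+n ρ))
    where
    M₀≈0 : ∀ j → M zero j F.≈ F.0#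
    M₀≈0 j = decidable-stable (M zero j F.≟ F.0#) λ M≉0 → ¬pivot (j , M≉0)
  rank-bound {k} α α≉0 (suc ρ) (suc m) v ind W M v∈ | yes (j₀ , pivot≉0) with F.inverse (M zero j₀) pivot≉0
  ... | x , pivot*x≈1 = ≡.subst (suc m ℕ.≤_) (≡.sym (ℕ.+-suc k ρ))
    (ℕ.s≤s (rank-bound α α≉0 ρ m v′ v′-ind (tail W) M′ v′∈))
    where
    factor : Vector F.Carrier m
    factor j = F.- (M zero (punchIn j₀ j) F.* x)
    v′ : Vector Carrier m
    v′ j = v (punchIn j₀ j) + ι (factor j) * v j₀
    M′ : Fin ρ → Fin m → F.Carrier
    M′ t j = M (suc t) (punchIn j₀ j) F.+ factor j F.* M (suc t) j₀
    pivoted : ∀ j → M zero (punchIn j₀ j) F.+ factor j F.* M zero j₀ F.≈ F.0#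
    pivoted j = F.trans (F.+-congˡ (F.trans (F.sym (-‿distribˡ-* _ _)) (F.-‿cong
      (F.trans (F.*-assoc _ x _) (F.trans (F.*-congˡ (F.trans (F.*-comm x _) pivot*x≈1)) (F.*-identityʳ _))))))
      (F.-‿inverseʳ _)
      where open RingProperties F.ring using (-‿distribˡ-*)
    eliminate : ∀ t j → ι (M t (punchIn j₀ j)) * W t + ι (factor j) * (ι (M t j₀) * W t) ≈
                        ι (M t (punchIn j₀ j) F.+ factor j F.* M t j₀) * W t
    eliminate t j = trans (+-congˡ (trans (sym (*-assoc _ _ _)) (*-congʳ (sym (ι-* _ _)))))
      (trans (sym (distribʳ (W t) _ _)) (*-congʳ (sym (ι-+ _ _))))
    v′∈ : ∀ j → differential α (v′ j) ≈ sum (λ t → ι (M′ t j) * tail W t)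
    v′∈ j = begin
      differential α (v′ j)
        ≈⟨ trans (differential-+ α _ _) (+-congˡ (differential-ι* α _ _)) ⟩
      differential α (v (punchIn j₀ j)) + ι (factor j) * differential α (v j₀)
        ≈⟨ +-cong (v∈ _) (trans (*-congˡ (v∈ j₀)) (*-distribˡ-sum (ι (factor j)) λ t → ι (M t j₀) * W t)) ⟩
      sum (λ t → ι (M t (punchIn j₀ j)) * W t) + sum (λ t → ι (factor j) * (ι (M t j₀) * W t))
        ≈⟨ ∑-distrib-+ (λ t → ι (M t (punchIn j₀ j)) * W t) (λ t → ι (factor j) * (ι (M t j₀) * W t)) ⟨
      sum (λ t → ι (M t (punchIn j₀ j)) * W t + ι (factor j) * (ι (M t j₀) * W t))
        ≈⟨ sum-cong-≋ (λ t → eliminate t j) ⟩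
      ι (M zero (punchIn j₀ j) F.+ factor j F.* M zero j₀) * head W + sum (λ t → ι (M′ t j) * tail W t)
        ≈⟨ trans (+-congʳ (trans (*-congʳ (trans (ι-cong (pivoted j)) ι-0)) (zeroˡ _))) (+-identityˡ _) ⟩
      sum (λ t → ι (M′ t j) * tail W t) ∎
    v′-ind : Independent v′
    v′-ind s sv′≈0 j = F.trans (F.reflexive (≡.sym (insertAt-punchIn s j₀ t j))) (ind s′ (begin
      combination-of s′ v
        ≈⟨ sum-remove {i = j₀} (λ i → ι (s′ i) * v i) ⟩
      ι (s′ j₀) * v j₀ + sum (λ j → ι (s′ (punchIn j₀ j)) * v (punchIn j₀ j))
        ≈⟨ +-cong (*-congʳ (trans (reflexive (≡.cong ι (insertAt-lookup s j₀ t))) (ι-sum (λ j → s j F.* factor j))))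
                  (sum-cong-≋ λ j → *-congʳ {v (punchIn j₀ j)} (reflexive (≡.cong ι (insertAt-punchIn s j₀ t j)))) ⟩
      sum (λ j → ι (s j F.* factor j)) * v j₀ + sum (λ j → ι (s j) * v (punchIn j₀ j))
        ≈⟨ +-congʳ (*-distribʳ-sum (v j₀) λ j → ι (s j F.* factor j)) ⟩
      sum (λ j → ι (s j F.* factor j) * v j₀) + sum (λ j → ι (s j) * v (punchIn j₀ j))
        ≈⟨ +-comm _ _ ⟩
      sum (λ j → ι (s j) * v (punchIn j₀ j)) + sum (λ j → ι (s j F.* factor j) * v j₀)
        ≈⟨ ∑-distrib-+ (λ j → ι (s j) * v (punchIn j₀ j)) (λ j → ι (s j F.* factor j) * v j₀) ⟨
      sum (λ j → ι (s j) * v (punchIn j₀ j) + ι (s j F.* factor j) * v j₀)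
        ≈⟨ sum-cong-≋ (λ j → trans (+-congˡ (trans (*-congʳ (ι-* _ _)) (*-assoc _ _ _))) (sym (distribˡ (ι (s j)) _ _))) ⟩
      combination-of s v′
        ≈⟨ sv′≈0 ⟩
      0# ∎) (punchIn j₀ j))
      where
      -- `v j₀` enters each `v′ j` with weight `factor j`; this is its total coefficient.
      t : F.Carrier
      t = F.sum λ j → s j F.* factor j
      s′ : Vector F.Carrier (suc m)
      s′ = Vector.insertAt s j₀ t

-- Operators of bounded order as matrices supported on a diagram

module Indicator (K : DiscreteField c ℓ) where
  open DiscreteField K

  when : {P : Set p} → Dec P → Carrier → Carrier
  when (yes _) s = s
  when (no _)  s = 0#

  when-true : {P : Set p} (P? : Dec P) → P → ∀ {s} → when P? s ≡ s
  when-true (yes _) _  = ≡.refl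
  when-true (no ¬P) P = contradiction P ¬P

  when-false : {P : Set p} (P? : Dec P) → ¬ P → ∀ {s} → when P? s ≡ 0#
  when-false (yes P) ¬P = contradiction P ¬P
  when-false (no _)  _  = ≡.refl

  -- The matrix of Δ^k in the chain basis, since Δ^k sends e (r + k) to e r and annihilates the
  -- first k elements.
  shift : (k : ℕ) → Fin n → Fin n → Carrier
  shift k r j = when (toℕ j ℕ.≟ toℕ r ℕ.+ k) 1#

-- Rank at least n - k, stated through factorizations B = W M because these can be transposed.
FactorizationBound : (K : DiscreteField c ℓ) (k : ℕ) {κ n : ℕ} →
                     (Fin κ → Fin n → Fin n → DiscreteField.Carrier K) → Set (c ⊔ ℓ)
FactorizationBound K k {κ} {n} B =
  ∀ (s : Vector Carrier κ) → ¬ (∀ t → s t ≈ 0#) →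
  ∀ ρ (W : Fin n → Fin ρ → Carrier) (M : Fin ρ → Fin n → Carrier) →
  (∀ r j → sum (λ t → s t * B t r j) ≈ sum λ u → W r u * M u j) → n ℕ.≤ k ℕ.+ ρ
  where open DiscreteField K

-- What both cases share: `height` gives the column heights of the diagram or of its reflection. The
-- shift is the codeword of rank exactly n - k, and `κ ≡ 0` is the case of the zero code.
record MatrixFamily (K : DiscreteField c ℓ) {n : ℕ} (k κ : ℕ) (height : Fin n → ℕ) : Set (c ⊔ ℓ) where
  open DiscreteField K
  open Indicator K
  field
    matrix             : Fin κ → Fin n → Fin n → Carrier
    supported          : ∀ t r j → height j ℕ.≤ toℕ r → matrix t r j ≈ 0#
    factorizationBound : FactorizationBound K k matrix
    shift-member       : κ ≡ 0 ⊎ ∃ λ t → ∀ r j → matrix t r j ≈ shift k r j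

ColumnStrict : (Fin n → ℕ) → Set
ColumnStrict c = ∀ {i i′} → toℕ i′ ≡ suc (toℕ i) → 0 ℕ.< c i → c i ℕ.< c i′

strict-growth : (c : Fin n → ℕ) → ColumnStrict c → ∀ o {i j} → toℕ j ≡ toℕ i ℕ.+ o →
                0 ℕ.< c i → c i ℕ.+ o ℕ.≤ c j
strict-growth c strict zero {i} {j} eq 0<cᵢ =
  ℕ.≤-reflexive (≡.trans (ℕ.+-identityʳ (c i)) (≡.cong c (≡.sym (Fin.toℕ-injective (≡.trans eq (ℕ.+-identityʳ (toℕ i)))))))
strict-growth {n} c strict (suc o) {i} {j} eq 0<cᵢ = ≡.subst (ℕ._≤ c j) (≡.sym (ℕ.+-suc (c i) o))
  (ℕ.≤-trans (ℕ.s≤s growth) (strict eq′ (ℕ.≤-trans 0<cᵢ (ℕ.≤-trans (ℕ.m≤m+n (c i) o) growth))))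
  where
  i+o<n : toℕ i ℕ.+ o ℕ.< n
  i+o<n = ℕ.<-trans (≡.subst (toℕ i ℕ.+ o ℕ.<_) (≡.trans (≡.sym (ℕ.+-suc (toℕ i) o)) (≡.sym eq)) (ℕ.n<1+n _)) (Fin.toℕ<n j)
  j′ : Fin n
  j′ = Fin.fromℕ< i+o<n
  growth : c i ℕ.+ o ℕ.≤ c j′
  growth = strict-growth c strict o (Fin.toℕ-fromℕ< i+o<n) 0<cᵢ
  eq′ : toℕ j ≡ suc (toℕ j′)
  eq′ = ≡.trans eq (≡.trans (ℕ.+-suc (toℕ i) o) (≡.cong suc (≡.sym (Fin.toℕ-fromℕ< i+o<n))))

module CodeMatrices {F : FiniteField c ℓ} {h : ℕ} (E : Extension F h) {k : ℕ} (k≤h : k ℕ.≤ h)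
  (height : Fin (suc h) → ℕ) (strict : ColumnStrict height) (height≤ : ∀ j → height j ℕ.≤ suc h)
  {κ : ℕ} (order : Fin κ → Fin (suc k)) (row : Fin κ → Fin (suc h))
  (injective : ∀ t t′ → order t ≡ order t′ → row t ≡ row t′ → t ≡ t′)
  (bounded : ∀ t → toℕ (row t) ℕ.< height (Fin.inject≤ (order t) (ℕ.s≤s k≤h))) where

  private
    module F = FiniteField F
  open Extension E
  open ExtensionProperties E
  open Chain E
  open RankBound E
  open Indicator F.discreteField
  open SetoidReasoning setoid

  ι-when-false : {P : Set} (P? : Dec P) → ¬ P → ∀ {s} → ι (when P? s) ≈ 0#
  ι-when-false P? ¬P = trans (reflexive (≡.cong ι (when-false P? ¬P))) ι-0

  Δ^-mono : ∀ {j m} x → j ℕ.≤ m → Δ^ j x ≈ 0# → Δ^ m x ≈ 0#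
  Δ^-mono {j} x j≤m x∈ with ℕ.m≤n⇒∃[o]m+o≡n j≤m
  ... | o , ≡.refl = trans (reflexive (≡.trans (≡.cong (λ m → Δ^ m x) (ℕ.+-comm j o)) (Δ^-Δ^ o j x)))
                           (trans (Δ^-cong o x∈) (Δ^-0 o))

  image : Fin κ → Fin (suc h) → Carrier
  image t j = basis (row t) * Δ^ (toℕ (order t)) (basis j)

  -- For j < i the image is 0. For j = i + o it is e l · e o, which Δ^(l + o + 1) annihilates; here
  -- l < `height` at column i, and the heights grow by at least o from column i to column j.
  image-kernel : ∀ t j → Δ^ (height j) (image t j) ≈ 0#
  image-kernel t j with ℕ.<-≤-connex (toℕ j) (toℕ (order t))
  ... | inj₁ j<i = trans (Δ^-cong (height j)
      (trans (*-congˡ (Δ^e≈0 (toℕ j) (toℕ (order t)) (toℕ≤h j) j<i)) (zeroʳ _))) (Δ^-0 (height j))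
  ... | inj₂ i≤j with ℕ.m≤n⇒∃[o]m+o≡n i≤j
  ... | o , i+o≡j = Δ^-mono (image t j) l+o<height (trans (Δ^-cong (suc (l ℕ.+ o)) (*-congˡ Δ^ie≈e))
      (product-kernel l o (e l) (e o) (Δ^e≈0 l (suc l) (toℕ≤h (row t)) ℕ.≤-refl) (Δ^e≈0 o (suc o) o≤h ℕ.≤-refl)))
    where
    i = toℕ (order t)
    l = toℕ (row t)
    o+i≡j : o ℕ.+ i ≡ toℕ j
    o+i≡j = ≡.trans (ℕ.+-comm o i) i+o≡j
    o≤h : o ℕ.≤ h
    o≤h = ℕ.≤-trans (ℕ.m≤m+n o i) (≡.subst (ℕ._≤ h) (≡.sym o+i≡j) (toℕ≤h j))
    Δ^ie≈e : Δ^ i (e (toℕ j)) ≈ e o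
    Δ^ie≈e = trans (reflexive (≡.cong (λ m → Δ^ i (e m)) (≡.sym o+i≡j)))
      (Δ^e o i (≡.subst (ℕ._≤ h) (≡.sym o+i≡j) (toℕ≤h j)))
    l+o<height : l ℕ.+ o ℕ.< height j
    l+o<height = ℕ.≤-trans (ℕ.+-monoˡ-≤ o (bounded t))
      (strict-growth height strict o
        (≡.trans (≡.sym i+o≡j) (≡.cong (ℕ._+ o) (≡.sym (Fin.toℕ-inject≤ (order t) (ℕ.s≤s k≤h)))))
        (ℕ.≤-trans (ℕ.s≤s ℕ.z≤n) (bounded t)))

  private
    coordinates = λ t j → kernel-coordinates (height j) (height≤ j) (image t j) (image-kernel t j)

  matrix : Fin κ → Fin (suc h) → Fin (suc h) → F.Carrier
  matrix t r j = proj₁ (coordinates t j) r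

  matrix-supported : ∀ t r j → height j ℕ.≤ toℕ r → matrix t r j F.≈ F.0#
  matrix-supported t r j = proj₁ (proj₂ (coordinates t j)) r

  matrix-columns : ∀ t j → combination-of (λ r → matrix t r j) basis ≈ image t j
  matrix-columns t j = proj₂ (proj₂ (coordinates t j))

  ι-combination : ∀ {m} (s : Vector F.Carrier m) (N : Fin m → Fin (suc h) → F.Carrier) →
    combination-of (λ r → F.sum λ t → s t F.* N t r) basis ≈ sum λ t → ι (s t) * combination-of (N t) basis
  ι-combination s N = begin
    sum (λ r → ι (F.sum λ t → s t F.* N t r) * basis r)
      ≈⟨ sum-cong-≋ (λ r → trans (*-congʳ {basis r} (ι-sum λ t → s t F.* N t r)) (*-distribʳ-sum (basis r) λ t → ι (s t F.* N t r))) ⟩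
    sum (λ r → sum λ t → ι (s t F.* N t r) * basis r)
      ≈⟨ ∑-comm (λ r t → ι (s t F.* N t r) * basis r) ⟩
    sum (λ t → sum λ r → ι (s t F.* N t r) * basis r)
      ≈⟨ sum-cong-≋ (λ t → trans
           (sum-cong-≋ λ r → trans (*-congʳ {basis r} (ι-* (s t) (N t r))) (*-assoc _ _ (basis r)))
           (sym (*-distribˡ-sum (ι (s t)) λ r → ι (N t r) * basis r))) ⟩
    sum (λ t → ι (s t) * combination-of (N t) basis) ∎

  module _ (s : Vector F.Carrier κ) where
    coefficient : Vector Carrier (suc k)
    coefficient i = sum λ t → ι (when (order t Fin.≟ i) (s t)) * basis (row t)

    -- Distinct indices of equal order have distinct rows, so the entries of s belonging to one
    -- order are coordinates in the chain basis.
    coefficient≈0⇒s≈0 : (∀ i → coefficient i ≈ 0#) → ∀ t → s t F.≈ F.0#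
    coefficient≈0⇒s≈0 coefficient≈0 t₀ = F.trans (F.sym S[l]≈s) (basis-independent S S≈0 (row t₀))
      where
      i = order t₀
      entry : Fin (suc h) → Fin κ → F.Carrier
      entry l t = when (row t Fin.≟ l) (when (order t Fin.≟ i) (s t))
      S : Vector F.Carrier (suc h)
      S l = F.sum (entry l)
      entry-off : ∀ t → t ≢ t₀ → entry (row t₀) t F.≈ F.0#
      entry-off t t≢t₀ with row t Fin.≟ row t₀ | order t Fin.≟ i
      ... | no _   | _        = F.refl
      ... | yes _  | no _     = F.refl
      ... | yes eq | yes eq′ = contradiction (injective t t₀ eq′ eq) t≢t₀
      S[l]≈s : S (row t₀) F.≈ s t₀
      S[l]≈s = F.trans (sum-single F.+-commutativeMonoid (entry (row t₀)) t₀ entry-off)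
        (F.reflexive (≡.trans (when-true (row t₀ Fin.≟ row t₀) ≡.refl) (when-true (order t₀ Fin.≟ i) ≡.refl)))
      S≈0 : combination-of S basis ≈ 0#
      S≈0 = begin
        sum (λ l → ι (S l) * basis l)
          ≈⟨ sum-cong-≋ (λ l → trans (*-congʳ {basis l} (ι-sum (entry l))) (*-distribʳ-sum (basis l) (ι ∘ entry l))) ⟩
        sum (λ l → sum λ t → ι (entry l t) * basis l)
          ≈⟨ ∑-comm (λ l t → ι (entry l t) * basis l) ⟩
        sum (λ t → sum λ l → ι (entry l t) * basis l)
          ≈⟨ sum-cong-≋ (λ t → trans
               (sum-single +-commutativeMonoid (λ l → ι (entry l t) * basis l) (row t) λ l l≢ →
                 trans (*-congʳ {basis l} (ι-when-false (row t Fin.≟ l) (l≢ ∘ ≡.sym))) (zeroˡ (basis l)))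
               (reflexive (≡.cong (λ u → ι u * basis (row t)) (when-true (row t Fin.≟ row t) ≡.refl)))) ⟩
        coefficient i
          ≈⟨ coefficient≈0 i ⟩
        0# ∎

    differential-coefficient : ∀ j → differential coefficient (basis j) ≈
      combination-of (λ r → F.sum λ t → s t F.* matrix t r j) basis
    differential-coefficient j = begin
      sum (λ i → coefficient i * Δ^ (toℕ i) (basis j))
        ≈⟨ sum-cong-≋ (λ i → *-distribʳ-sum (Δ^ (toℕ i) (basis j)) λ t → ι (when (order t Fin.≟ i) (s t)) * basis (row t)) ⟩
      sum (λ i → sum λ t → ι (when (order t Fin.≟ i) (s t)) * basis (row t) * Δ^ (toℕ i) (basis j))
        ≈⟨ ∑-comm (λ i t → ι (when (order t Fin.≟ i) (s t)) * basis (row t) * Δ^ (toℕ i) (basis j)) ⟩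
      sum (λ t → sum λ i → ι (when (order t Fin.≟ i) (s t)) * basis (row t) * Δ^ (toℕ i) (basis j))
        ≈⟨ sum-cong-≋ (λ t → trans
             (sum-single +-commutativeMonoid
               (λ i → ι (when (order t Fin.≟ i) (s t)) * basis (row t) * Δ^ (toℕ i) (basis j)) (order t) λ i i≢ →
               trans (*-congʳ {Δ^ (toℕ i) (basis j)} (trans
                       (*-congʳ {basis (row t)} (ι-when-false (order t Fin.≟ i) (i≢ ∘ ≡.sym)))
                       (zeroˡ (basis (row t)))))
                     (zeroˡ (Δ^ (toℕ i) (basis j))))
             (trans (*-assoc _ _ _)
               (*-cong (reflexive (≡.cong ι (when-true (order t Fin.≟ order t) ≡.refl))) (sym (matrix-columns t j))))) ⟩
      sum (λ t → ι (s t) * combination-of (λ r → matrix t r j) basis)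
        ≈⟨ ι-combination s (λ t r → matrix t r j) ⟨
      combination-of (λ r → F.sum λ t → s t F.* matrix t r j) basis ∎

    -- Read through the chain basis, the columns of W become ρ elements of K, and the factorization
    -- writes the value of the operator at each chain element as an F-combination of them.
    factorization-bound : ¬ (∀ t → s t F.≈ F.0#) →
      ∀ ρ (W : Fin (suc h) → Fin ρ → F.Carrier) (M : Fin ρ → Fin (suc h) → F.Carrier) →
      (∀ r j → (F.sum λ t → s t F.* matrix t r j) F.≈ F.sum λ u → W r u F.* M u j) →
      suc h ℕ.≤ k ℕ.+ ρ
    factorization-bound s≉0 ρ W M factorization =
      rank-bound coefficient (s≉0 ∘ coefficient≈0⇒s≈0) ρ (suc h) basis basis-independent
        (λ u → combination-of (λ r → W r u) basis) M λ j → begin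
          differential coefficient (basis j)
            ≈⟨ differential-coefficient j ⟩
          combination-of (λ r → F.sum λ t → s t F.* matrix t r j) basis
            ≈⟨ sum-cong-≋ (λ r → *-congʳ {basis r} (ι-cong (F.trans (factorization r j)
                 (F.sum-cong-≋ λ u → F.*-comm (W r u) (M u j))))) ⟩
          combination-of (λ r → F.sum λ u → M u j F.* W r u) basis
            ≈⟨ ι-combination (λ u → M u j) (λ u r → W r u) ⟩
          sum (λ u → ι (M u j) * combination-of (λ r → W r u) basis) ∎

  coordinates-unique : (s s′ : Vector F.Carrier (suc h)) → combination-of s basis ≈ combination-of s′ basis →
                       ∀ i → s i F.≈ s′ i
  coordinates-unique s s′ eq i = F.x-y≈0⇒x≈y (s i) (s′ i) (basis-independent (λ i → s i F.- s′ i) (begin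
    combination-of (λ i → s i F.- s′ i) basis
      ≈⟨ sum-cong-≋ (λ i → trans (*-congʳ {basis i} (ι-+ (s i) (F.- s′ i))) (trans (distribʳ (basis i) _ _)
           (+-congˡ (trans (*-congʳ {basis i} (trans (ι-neg (s′ i)) (sym (-1*x≈-x _)))) (*-assoc (- 1#) _ (basis i)))))) ⟩
    sum (λ i → ι (s i) * basis i + - 1# * (ι (s′ i) * basis i))
      ≈⟨ ∑-distrib-+ (λ i → ι (s i) * basis i) (λ i → - 1# * (ι (s′ i) * basis i)) ⟩
    combination-of s basis + sum (λ i → - 1# * (ι (s′ i) * basis i))
      ≈⟨ +-cong eq (trans (sym (*-distribˡ-sum (- 1#) λ i → ι (s′ i) * basis i)) (-1*x≈-x _)) ⟩
    combination-of s′ basis - combination-of s′ basis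
      ≈⟨ -‿inverseʳ _ ⟩
    0# ∎) i)
    where open RingProperties ring using (-1*x≈-x)

  -- Row 0 stands for multiplication by `e 0`, which is 1, so this operator is Δ^k itself.
  matrix-shift : ∀ t → order t ≡ fromℕ k → row t ≡ zero → ∀ r j → matrix t r j F.≈ shift k r j
  matrix-shift t order≡k row≡0 r j = coordinates-unique (λ r → matrix t r j) (λ r → shift k r j) (begin
    combination-of (λ r → matrix t r j) basis    ≈⟨ matrix-columns t j ⟩
    image t j                                    ≡⟨ ≡.cong₂ (λ l i → e l * Δ^ i (basis j)) (≡.cong toℕ row≡0) (≡.trans (≡.cong toℕ order≡k) (Fin.toℕ-fromℕ k)) ⟩
    e 0 * Δ^ k (basis j)                         ≈⟨ trans (*-congʳ (Δ^e≈1 0 ℕ.z≤n)) (*-identityˡ _) ⟩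
    Δ^ k (basis j)                               ≈⟨ shifted ⟩
    combination-of (λ r → shift k r j) basis     ∎) r
    where
    off : ∀ r → ¬ toℕ j ≡ toℕ r ℕ.+ k → ι (shift k r j) * basis r ≈ 0#
    off r neq = trans (*-congʳ {basis r} (ι-when-false (toℕ j ℕ.≟ toℕ r ℕ.+ k) neq)) (zeroˡ (basis r))
    shifted : Δ^ k (basis j) ≈ combination-of (λ r → shift k r j) basis
    shifted with ℕ.<-≤-connex (toℕ j) k
    ... | inj₁ j<k = trans (Δ^e≈0 (toℕ j) k (toℕ≤h j) j<k) (sym (sum-zero {suc h} _ λ r →
        off r λ j≡r+k → ℕ.<⇒≱ j<k (≡.subst (k ℕ.≤_) (≡.sym j≡r+k) (ℕ.m≤n+m k (toℕ r)))))
    ... | inj₂ k≤j = sym (begin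
      combination-of (λ r → shift k r j) basis
        ≈⟨ sum-single +-commutativeMonoid (λ r → ι (shift k r j) * basis r) r₀ (λ r r≢r₀ → off r λ j≡r+k →
             r≢r₀ (Fin.toℕ-injective (ℕ.+-cancelʳ-≡ k (toℕ r) (toℕ r₀) (≡.trans (≡.sym j≡r+k) j≡r₀+k)))) ⟩
      ι (shift k r₀ j) * basis r₀
        ≈⟨ trans (*-congʳ (trans (reflexive (≡.cong ι (when-true (toℕ j ℕ.≟ toℕ r₀ ℕ.+ k) j≡r₀+k))) ι-1)) (*-identityˡ _) ⟩
      e (toℕ r₀)
        ≈⟨ Δ^e (toℕ r₀) k (≡.subst (ℕ._≤ h) j≡r₀+k (toℕ≤h j)) ⟨
      Δ^ k (e (toℕ r₀ ℕ.+ k))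
        ≡⟨ ≡.cong (λ m → Δ^ k (e m)) j≡r₀+k ⟨
      Δ^ k (basis j) ∎)
      where
      j∸k<n : toℕ j ℕ.∸ k ℕ.< suc h
      j∸k<n = ℕ.≤-<-trans (ℕ.m∸n≤m (toℕ j) k) (Fin.toℕ<n j)
      r₀ : Fin (suc h)
      r₀ = Fin.fromℕ< j∸k<n
      j≡r₀+k : toℕ j ≡ toℕ r₀ ℕ.+ k
      j≡r₀+k = ≡.sym (≡.trans (≡.cong (ℕ._+ k) (Fin.toℕ-fromℕ< j∸k<n)) (ℕ.m∸n+n≡m k≤j))

-- Spans, the given field, and the code spanned by a family of matrices

module SpanProperties {r ℓr m ℓm} {R : Ring r ℓr} (M : LeftModule R m ℓm) where
  open Ring R using (Carrier; _≈_; 0#; 1#; _+_; _*_)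
  private module R = Ring R
  open LeftModule M
  open SetoidReasoning ≈ᴹ-setoid
  open CommutativeSemigroupProperties
    (CommutativeMonoid.commutativeSemigroup +ᴹ-commutativeMonoid) using (interchange)

  combination-0 : (s : Vector Carrier n) (v : Vector Carrierᴹ n) → (∀ i → s i ≈ 0#) → combination M s v ≈ᴹ 0ᴹ
  combination-0 {zero}  s v s≈0 = ≈ᴹ-refl
  combination-0 {suc n} s v s≈0 = ≈ᴹ-trans
    (+ᴹ-cong (≈ᴹ-trans (*ₗ-congʳ (s≈0 zero)) (*ₗ-zeroˡ _)) (combination-0 (tail s) (tail v) (s≈0 ∘ suc)))
    (+ᴹ-identityˡ 0ᴹ)

  combination-+ : (s t : Vector Carrier n) (v : Vector Carrierᴹ n) →
                  combination M (λ i → s i + t i) v ≈ᴹ combination M s v +ᴹ combination M t v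
  combination-+ {zero}  s t v = ≈ᴹ-sym (+ᴹ-identityˡ 0ᴹ)
  combination-+ {suc n} s t v = ≈ᴹ-trans
    (+ᴹ-cong (*ₗ-distribʳ (head v) _ _) (combination-+ (tail s) (tail t) (tail v)))
    (interchange _ _ _ _)

  combination-*ₗ : ∀ x (s : Vector Carrier n) (v : Vector Carrierᴹ n) →
                   combination M (λ i → x * s i) v ≈ᴹ x *ₗ combination M s v
  combination-*ₗ {zero}  x s v = ≈ᴹ-sym (*ₗ-zeroʳ x)
  combination-*ₗ {suc n} x s v = ≈ᴹ-trans
    (+ᴹ-cong (*ₗ-assoc x _ _) (combination-*ₗ x (tail s) (tail v))) (≈ᴹ-sym (*ₗ-distribˡ x _ _))

  span-isSubspace : (v : Vector Carrierᴹ n) → IsSubspace M (Span M v)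
  span-isSubspace v = record
    { resp-≈ᴹ   = λ { x≈y (s , eq) → s , ≈ᴹ-trans eq x≈y }
    ; 0ᴹ-closed = (λ _ → 0#) , combination-0 _ v (λ _ → R.refl)
    ; +ᴹ-closed = λ { (s , eq) (t , eq′) → (λ i → s i + t i) , ≈ᴹ-trans (combination-+ s t v) (+ᴹ-cong eq eq′) }
    ; *ₗ-closed = λ { x (s , eq) → (λ i → x * s i) , ≈ᴹ-trans (combination-*ₗ x s v) (*ₗ-congˡ eq) }
    }

  span-member : (v : Vector Carrierᴹ n) → ∀ i → Span M v (v i)
  span-member {n} v i = δ , ≈ᴹ-trans
    (sum-single +ᴹ-commutativeMonoid (λ j → δ j *ₗ v j) i off)
    (≈ᴹ-trans (*ₗ-congʳ on) (*ₗ-identityˡ (v i)))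
    where
    δ : Vector Carrier n
    δ j with j Fin.≟ i
    ... | yes _ = 1#
    ... | no  _ = 0#
    off : ∀ j → j ≢ i → δ j *ₗ v j ≈ᴹ 0ᴹ
    off j j≢i with j Fin.≟ i
    ... | yes j≡i = contradiction j≡i j≢i
    ... | no  _   = *ₗ-zeroˡ (v j)
    on : δ i ≈ 1#
    on with i Fin.≟ i
    ... | yes _   = R.refl
    ... | no  i≢i = contradiction ≡.refl i≢i

record Decision (𝔽 : HeytingField c ℓ₁ ℓ₂) : Set (c ⊔ ℓ₁) where
  open HeytingField 𝔽
  field
    _≟_     : Decidable _≈_
    1≉0     : ¬ 1# ≈ 0#
    inverse : ∀ x → ¬ x ≈ 0# → ∃ λ y → x * y ≈ 1#

  discreteField : DiscreteField c ℓ₁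
  discreteField = record
    { commutativeRing = HeytingCommutativeRing.commutativeRing heytingCommutativeRing
    ; _≟_             = _≟_
    ; 1≉0             = 1≉0
    ; inverse         = inverse
    }

module FromHeytingField (𝔽 : HeytingField c ℓ₁ ℓ₂) where
  private
    module 𝔽 = HeytingField 𝔽
    commutativeRing = HeytingCommutativeRing.commutativeRing 𝔽.heytingCommutativeRing
    module R = CommutativeRing commutativeRing
  open R using (_≈_; _*_; _-_; 0#; 1#)

  -- In the zero ring 0 - 0 would be invertible, and 0 would be apart from itself.
  1≉0ᴴ : ¬ 1# ≈ 0#
  1≉0ᴴ 1≈0 = 𝔽.#-irrefl R.refl (𝔽.invertible⇒# {0#} {0#} (0# , absurd , absurd))
    where
    absurd : ∀ {x} → x ≈ 1#
    absurd {x} = R.trans (R.trans (R.sym (R.*-identityˡ x)) (R.trans (R.*-congʳ 1≈0) (R.zeroˡ x))) (R.sym 1≈0)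

  module _ {N : ℕ} (bijection : Bijection R.setoid (≡.setoid (Fin N))) where
    private
      enumeration = Bijection⇒Inverse bijection
      open Enumerated enumeration using (_≟_; any?)

    -- Inverses are found by exhaustive search. When there is none, x is not apart from 0, and
    -- tightness gives x ≈ 0.
    decision : Decision 𝔽
    decision = record { _≟_ = _≟_ ; 1≉0 = 1≉0ᴴ ; inverse = inverse }
      where
      inverse : ∀ x → ¬ x ≈ 0# → ∃ λ y → x * y ≈ 1#
      inverse x x≉0 with any? (λ y≈z xy≈1 → R.trans (R.*-congˡ (R.sym y≈z)) xy≈1) (λ y → (x * y) ≟ 1#)
      ... | yes invertible = invertible
      ... | no ¬invertible = contradiction (proj₁ (𝔽.tight x 0#) λ x#0 → apart (𝔽.#⇒invertible x#0)) x≉0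
        where
        x-0≈x : x - 0# ≈ x
        x-0≈x = R.trans (R.+-congˡ ε⁻¹≈ε) (R.+-identityʳ x)
          where open GroupProperties R.+-group using (ε⁻¹≈ε)
        apart : (∃ λ y → y * (x - 0#) ≈ 1# × (x - 0#) * y ≈ 1#) → ⊥
        apart (y , _ , xy≈1) = ¬invertible (y , R.trans (R.*-congʳ (R.sym x-0≈x)) xy≈1)

  size≥2 : ∀ {N} → Bijection R.setoid (≡.setoid (Fin N)) → ∃ λ p → N ≡ 2 ℕ.+ p
  size≥2 {zero}        bijection with () ← Bijection.to bijection 0#
  size≥2 {suc zero}    bijection = contradiction (Bijection.injective bijection
    (≡.trans (unique (Bijection.to bijection 1#)) (≡.sym (unique (Bijection.to bijection 0#))))) 1≉0ᴴ
    where
    unique : (i : Fin 1) → i ≡ zero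
    unique zero = ≡.refl
  size≥2 {suc (suc p)} bijection = p , ≡.refl

module CodeAssembly (𝔽 : HeytingField c ℓ₁ ℓ₂) (decision : Decision 𝔽)
  {n d k κ : ℕ} (n≡k+d : n ≡ k ℕ.+ d) (0<d : 0 ℕ.< d) where

  private K = Decision.discreteField decision
  open DiscreteField K
  open Indicator K
  private
    module Matrices = LeftModule (matrices 𝔽 n)
    module Vectors = LeftModule (vectors 𝔽 n)
  open SpanProperties

  combination-entry : ∀ {m} (s : Vector Carrier m) (B : Vector (Matrix 𝔽 n) m) r j →
    combination (matrices 𝔽 n) s B r j ≡ sum λ t → s t * B t r j
  combination-entry {zero}  s B r j = ≡.refl
  combination-entry {suc m} s B r j = ≡.cong (s zero * B zero r j +_) (combination-entry (tail s) (tail B) r j)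

  combination-coordinate : ∀ {m} (s : Vector Carrier m) (v : Vector (Vector Carrier n) m) r →
    combination (vectors 𝔽 n) s v r ≡ sum λ t → s t * v t r
  combination-coordinate {zero}  s v r = ≡.refl
  combination-coordinate {suc m} s v r = ≡.cong (s zero * v zero r +_) (combination-coordinate (tail s) (tail v) r)

  -- Columns k, ..., n - 1 of the shift are the first d unit vectors and the others vanish, so
  -- coordinates in the column space are the first d entries.
  module ShiftRank (A : Matrix 𝔽 n) (A≈shift : ∀ r j → A r j ≈ shift k r j) where
    column-index : Fin d → Fin n
    column-index u = Fin.cast (≡.sym n≡k+d) (k Fin.↑ʳ u)

    toℕ-column-index : ∀ u → toℕ (column-index u) ≡ k ℕ.+ toℕ u
    toℕ-column-index u = ≡.trans (Fin.toℕ-cast (≡.sym n≡k+d) (k Fin.↑ʳ u)) (Fin.toℕ-↑ʳ k u)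

    d≤n : d ℕ.≤ n
    d≤n = ≡.subst (d ℕ.≤_) (≡.sym n≡k+d) (ℕ.m≤n+m d k)

    basis : Vector (Vector Carrier n) d
    basis u = transpose A (column-index u)

    A-diagonal : ∀ u r → toℕ r ≡ toℕ u → basis u r ≈ 1#
    A-diagonal u r r≡u = trans (A≈shift r (column-index u)) (reflexive (when-true (toℕ (column-index u) ℕ.≟ toℕ r ℕ.+ k)
      (≡.trans (toℕ-column-index u) (≡.trans (ℕ.+-comm k (toℕ u)) (≡.cong (ℕ._+ k) (≡.sym r≡u))))))

    A-off-diagonal : ∀ u r → toℕ r ≢ toℕ u → basis u r ≈ 0#
    A-off-diagonal u r r≢u = trans (A≈shift r (column-index u)) (reflexive (when-false (toℕ (column-index u) ℕ.≟ toℕ r ℕ.+ k)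
      λ eq → r≢u (ℕ.+-cancelʳ-≡ k (toℕ r) (toℕ u) (≡.trans (≡.sym eq) (≡.trans (toℕ-column-index u) (ℕ.+-comm k (toℕ u)))))))

    combination-basis : ∀ (s : Vector Carrier d) u r → toℕ r ≡ toℕ u → sum (λ u → s u * basis u r) ≈ s u
    combination-basis s u r r≡u = trans
      (sum-single +-commutativeMonoid (λ u → s u * basis u r) u λ u′ u′≢u →
        trans (*-congˡ {s u′} (A-off-diagonal u′ r λ r≡u′ → u′≢u (Fin.toℕ-injective (≡.trans (≡.sym r≡u′) r≡u)))) (zeroʳ (s u′)))
      (trans (*-congˡ (A-diagonal u r r≡u)) (*-identityʳ (s u)))

    zero-below : ∀ r j → d ℕ.≤ toℕ r → A r j ≈ 0#
    zero-below r j d≤r = trans (A≈shift r j) (reflexive (when-false (toℕ j ℕ.≟ toℕ r ℕ.+ k) λ eq →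
      ℕ.<⇒≱ (Fin.toℕ<n j) (≡.subst₂ ℕ._≤_ (≡.trans (ℕ.+-comm d k) (≡.sym n≡k+d)) (≡.sym eq) (ℕ.+-monoˡ-≤ k d≤r))))

    shift-rank : HasRank 𝔽 A d
    shift-rank = basis , record
      { members     = λ u → span-member (vectors 𝔽 n) (transpose A) (column-index u)
      ; independent = λ s s≈0 u → let r = Fin.inject≤ u d≤n in begin
          s u                                   ≈⟨ combination-basis s u r (Fin.toℕ-inject≤ u d≤n) ⟨
          sum (λ u → s u * basis u r)           ≡⟨ combination-coordinate s basis r ⟨
          combination (vectors 𝔽 n) s basis r   ≈⟨ s≈0 r ⟩
          0#                                    ∎
      ; spanning    = λ { {x} (a , a≈x) → (λ u → x (Fin.inject≤ u d≤n)) , λ r → trans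
          (reflexive (combination-coordinate _ basis r)) (coordinate x a a≈x r) }
      }
      where
      open SetoidReasoning setoid
      coordinate : ∀ x a → (∀ r → combination (vectors 𝔽 n) a (transpose A) r ≈ x r) →
                   ∀ r → sum (λ u → x (Fin.inject≤ u d≤n) * basis u r) ≈ x r
      coordinate x a a≈x r with ℕ.<-≤-connex (toℕ r) d
      ... | inj₁ r<d = trans
        (combination-basis (λ u → x (Fin.inject≤ u d≤n)) (Fin.fromℕ< r<d) r (≡.sym (Fin.toℕ-fromℕ< r<d)))
        (reflexive (≡.cong x (Fin.toℕ-injective (≡.trans (Fin.toℕ-inject≤ (Fin.fromℕ< r<d) d≤n) (Fin.toℕ-fromℕ< r<d)))))
      ... | inj₂ d≤r = trans
        (sum-zero {d} _ λ u → trans (*-congˡ {x (Fin.inject≤ u d≤n)} (zero-below r (column-index u) d≤r)) (zeroʳ _))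
        (trans (sym (sum-zero {n} _ λ j → trans (*-congˡ {a j} (zero-below r j d≤r)) (zeroʳ (a j))))
          (trans (sym (reflexive (combination-coordinate a (transpose A) r))) (a≈x r)))

    A≉0 : ¬ A Matrices.≈ᴹ Matrices.0ᴹ
    A≉0 A≈0 = 1≉0 (trans (sym (A-diagonal u₀ r₀ (Fin.toℕ-inject≤ u₀ d≤n))) (A≈0 r₀ (column-index u₀)))
      where
      u₀ = Fin.fromℕ< 0<d
      r₀ = Fin.inject≤ u₀ d≤n

  code : (𝒟 : FerrersDiagram n) (B : Fin κ → Matrix 𝔽 n) → (∀ t → Supported 𝔽 𝒟 (B t)) → FactorizationBound K k B →
         (κ ≡ 0 ⊎ ∃ λ t → ∀ r j → B t r j ≈ shift k r j) → IsCode 𝔽 𝒟 κ d (Span (matrices 𝔽 n) B)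
  code 𝒟 B B-supported bound κ≡0⊎shift = record
    { isSubspace      = span-isSubspace (matrices 𝔽 n) B
    ; supported       = λ { (s , s≈A) {i} {j} i∉ → trans (sym (s≈A i j)) (trans (reflexive (combination-entry s B i j))
        (sum-zero {κ} _ λ t → trans (*-congˡ {s t} (B-supported t i∉)) (zeroʳ (s t)))) }
    ; dimension       = B , record
      { members     = span-member (matrices 𝔽 n) B
      ; independent = independent
      ; spanning    = id
      }
    ; minimumDistance = Sum.map₂ distance κ≡0⊎shift
    }
    where
    open SetoidReasoning setoid
    independent : LinearlyIndependent (matrices 𝔽 n) B
    independent s s≈0 with Fin.all? (λ t → s t ≟ 0#)
    ... | yes all≈0 = all≈0
    -- The zero matrix factors through dimension 0; for a nonzero s the bound would give n ≤ k,
    -- against d > 0.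
    ... | no  s≉0   = contradiction
      (bound s s≉0 0 (λ _ ()) (λ ()) λ r j → trans (sym (reflexive (combination-entry s B r j))) (s≈0 r j))
      (ℕ.<⇒≱ (≡.subst₂ ℕ._<_ (≡.refl {x = k ℕ.+ 0}) (≡.sym n≡k+d) (ℕ.+-monoʳ-< k 0<d)))
    distance : (∃ λ t → ∀ r j → B t r j ≈ shift k r j) → HasMinimumRankDistance 𝔽 (Span (matrices 𝔽 n) B) d
    distance (t , B≈shift) = (B t , span-member (matrices 𝔽 n) B t , A≉0 , shift-rank) , lower
      where
      open ShiftRank (B t) B≈shift
      lower : ∀ {ρ} → NonzeroRank 𝔽 (Span (matrices 𝔽 n) B) ρ → d ℕ.≤ ρ
      -- A basis of the column space of A provides the factor W, and the coordinates of the columns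
      -- of A in it provide M.
      lower {ρ} (A , (s , s≈A) , A≉0 , w , isBasis) = ℕ.+-cancelˡ-≤ k d ρ (≡.subst (ℕ._≤ k ℕ.+ ρ) n≡k+d
        (bound s (λ s≈0 → A≉0 (Matrices.≈ᴹ-trans (Matrices.≈ᴹ-sym s≈A) (combination-0 (matrices 𝔽 n) s B s≈0)))
          ρ (λ r u → w u r) (λ u j → M j u) λ r j → begin
            sum (λ t → s t * B t r j)           ≡⟨ combination-entry s B r j ⟨
            combination (matrices 𝔽 n) s B r j  ≈⟨ s≈A r j ⟩
            A r j                               ≈⟨ proj₂ (spanned j) r ⟨
            combination (vectors 𝔽 n) (M j) w r ≡⟨ combination-coordinate (M j) w r ⟩
            sum (λ u → M j u * w u r)           ≈⟨ sum-cong-≋ (λ u → *-comm (M j u) (w u r)) ⟩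
            sum (λ u → w u r * M j u)           ∎))
        where
        spanned : ∀ j → Span (vectors 𝔽 n) w (transpose A j)
        spanned j = IsBasis.spanning isBasis (span-member (vectors 𝔽 n) (transpose A) j)
        M : Fin n → Fin ρ → Carrier
        M j = proj₁ (spanned j)

open CommutativeMonoidSum ℕ.+-0-commutativeMonoid using ()
  renaming (sum to ∑; ∑-comm to ∑-swap; sum-init-last to ∑-init-last; sum-cong-≗ to ∑-cong)

-- Heights of Ferrers diagrams

sum-tabulate : (f : Vector ℕ n) → ListAction.sum (List.tabulate f) ≡ ∑ f
sum-tabulate {zero}  f = ≡.refl
sum-tabulate {suc n} f = ≡.cong (head f ℕ.+_) (sum-tabulate (tail f))

∑-mono-≤ : (f g : Vector ℕ n) → (∀ i → f i ℕ.≤ g i) → ∑ f ℕ.≤ ∑ g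
∑-mono-≤ {zero}  f g f≤g = ℕ.z≤n
∑-mono-≤ {suc n} f g f≤g = ℕ.+-mono-≤ (f≤g zero) (∑-mono-≤ (tail f) (tail g) (f≤g ∘ suc))

∑-mono-< : (f g : Vector ℕ n) → (∀ i → f i ℕ.≤ g i) → ∀ i → f i ℕ.< g i → ∑ f ℕ.< ∑ g
∑-mono-< {suc n} f g f≤g zero    f<g = ℕ.+-mono-<-≤ f<g (∑-mono-≤ (tail f) (tail g) (f≤g ∘ suc))
∑-mono-< {suc n} f g f≤g (suc i) f<g = ℕ.+-mono-≤-< (f≤g zero) (∑-mono-< (tail f) (tail g) (f≤g ∘ suc) i f<g)

∑-positive : (f : Vector ℕ n) → 0 ℕ.< ∑ f → ∃ λ i → 0 ℕ.< f i
∑-positive {suc n} f 0<∑ with f zero in eq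
... | suc _ = zero , ≡.subst (0 ℕ.<_) (≡.sym eq) ℕ.z<s
... | zero  with ∑-positive (tail f) 0<∑
...   | i , 0<fᵢ = suc i , 0<fᵢ

∑-bound : (f : Vector ℕ n) → (∀ i → f i ℕ.≤ 1) → ∀ b → (∀ i → toℕ i ℕ.< b → f i ≡ 0) → ∑ f ℕ.≤ n ℕ.∸ b
∑-bound {zero}  f f≤1 b       f≡0 = ℕ.z≤n
∑-bound {suc n} f f≤1 zero    f≡0 = ℕ.+-mono-≤ (f≤1 zero) (∑-bound (tail f) (f≤1 ∘ suc) zero λ _ ())
∑-bound {suc n} f f≤1 (suc b) f≡0 = ≡.subst (λ x → x ℕ.+ ∑ (tail f) ℕ.≤ n ℕ.∸ b) (≡.sym (f≡0 zero ℕ.z<s))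
  (∑-bound (tail f) (f≤1 ∘ suc) b λ i i<b → f≡0 (suc i) (ℕ.s<s i<b))

decode : ∀ m (c : Vector ℕ m) → Fin (∑ c) → ∃ λ i → Fin (c i)
decode (suc m) c t with Fin.splitAt (head c) t
... | inj₁ l  = zero , l
... | inj₂ t′ with decode m (tail c) t′
...   | i , l = suc i , l

encode : ∀ m (c : Vector ℕ m) → (∃ λ i → Fin (c i)) → Fin (∑ c)
encode (suc m) c (zero  , l) = l Fin.↑ˡ ∑ (tail c)
encode (suc m) c (suc i , l) = head c Fin.↑ʳ encode m (tail c) (i , l)

encode-decode : ∀ m (c : Vector ℕ m) t → encode m c (decode m c t) ≡ t
encode-decode (suc m) c t with Fin.splitAt (head c) t in eq
... | inj₁ l  = Fin.splitAt⁻¹-↑ˡ eq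
... | inj₂ t′ = ≡.trans (≡.cong (head c Fin.↑ʳ_) (encode-decode m (tail c) t′)) (Fin.splitAt⁻¹-↑ʳ eq)

-- The corner is used for the pair of order k and row 0, that is for Δ^k, so that a code of positive
-- dimension contains a word of rank exactly d.
record Selection {N m : ℕ} (κ : ℕ) (c : Vector ℕ m) (top : Fin m) (bottom : Fin N) : Set where
  field
    order     : Fin κ → Fin m
    row       : Fin κ → Fin N
    injective : ∀ t t′ → order t ≡ order t′ → row t ≡ row t′ → t ≡ t′
    bounded   : ∀ t → toℕ (row t) ℕ.< c (order t)
    corner    : κ ≡ 0 ⊎ ∃ λ t → order t ≡ top × row t ≡ bottom

module Decoded {N m κ : ℕ} (c : Vector ℕ m) (c≤N : ∀ i → c i ℕ.≤ N) (κ≤∑ : κ ℕ.≤ ∑ c) where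
  cell : Fin κ → ∃ λ i → Fin (c i)
  cell t = decode m c (Fin.inject≤ t κ≤∑)

  order : Fin κ → Fin m
  order t = proj₁ (cell t)

  row : Fin κ → Fin N
  row t = Fin.inject≤ (proj₂ (cell t)) (c≤N (order t))

  toℕ-row : ∀ t → toℕ (row t) ≡ toℕ (proj₂ (cell t))
  toℕ-row t = Fin.toℕ-inject≤ _ (c≤N (order t))

  bounded : ∀ t → toℕ (row t) ℕ.< c (order t)
  bounded t = ≡.subst (ℕ._< c (order t)) (≡.sym (toℕ-row t)) (Fin.toℕ<n (proj₂ (cell t)))

  cell-≡ : (x y : ∃ λ i → Fin (c i)) → proj₁ x ≡ proj₁ y → toℕ (proj₂ x) ≡ toℕ (proj₂ y) → x ≡ y
  cell-≡ (i , l) (.i , l′) ≡.refl eq = ≡.cong (i ,_) (Fin.toℕ-injective eq)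

  injective : ∀ t t′ → order t ≡ order t′ → row t ≡ row t′ → t ≡ t′
  injective t t′ eq eq′ = Fin.inject≤-injective κ≤∑ κ≤∑ t t′
    (≡.trans (≡.sym (encode-decode m c _)) (≡.trans (≡.cong (encode m c) cell≡) (encode-decode m c _)))
    where
    cell≡ : cell t ≡ cell t′
    cell≡ = cell-≡ (cell t) (cell t′) eq (≡.trans (≡.sym (toℕ-row t)) (≡.trans (≡.cong toℕ eq′) (toℕ-row t′)))

-- If the first κ cells miss the corner, the corner replaces the first of them.
select : ∀ {N m} κ (c : Vector ℕ m) → (∀ i → c i ℕ.≤ suc N) → κ ℕ.≤ ∑ c →
         (top : Fin m) → (0 ℕ.< κ → 0 ℕ.< c top) → Selection κ c top (zero {N})
select zero c c≤N κ≤∑ top _ = record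
  { order = λ () ; row = λ () ; injective = λ () ; bounded = λ () ; corner = inj₁ ≡.refl }
select {N} (suc κ) c c≤N κ≤∑ top 0<c-top =
  choose (Fin.any? λ t → (order t Fin.≟ top) ×-dec (row t Fin.≟ zero))
  where
  open Decoded c c≤N κ≤∑
  choose : Dec (∃ λ t → order t ≡ top × row t ≡ zero) → Selection (suc κ) c top (zero {N})
  choose (yes found) = record
    { order = order ; row = row ; injective = injective ; bounded = bounded ; corner = inj₂ found }
  choose (no ¬found) = record
    { order     = λ { zero → top ; (suc t) → order (suc t) }
    ; row       = λ { zero → zero ; (suc t) → row (suc t) }
    ; injective = λ { zero    zero     _  _   → ≡.refl
                    ; zero    (suc t)  eq eq′ → contradiction (suc t , ≡.sym eq , ≡.sym eq′) ¬found
                    ; (suc t) zero     eq eq′ → contradiction (suc t , eq , eq′) ¬found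
                    ; (suc t) (suc t′)        → injective (suc t) (suc t′) }
    ; bounded   = λ { zero → 0<c-top ℕ.z<s ; (suc t) → bounded (suc t) }
    ; corner    = inj₂ (zero , ≡.refl , ≡.refl)
    }

subset-bound : (s : Subset n) → ∀ b → (∀ {x} → x ∈ s → toℕ x ℕ.< b) → ∣ s ∣ ℕ.≤ b
subset-bound Vec.[]              b       s<b = ℕ.z≤n
subset-bound (Bool.true  Vec.∷ s) zero    s<b with () ← s<b Vec.here
subset-bound (Bool.true  Vec.∷ s) (suc b) s<b = ℕ.s≤s (subset-bound s b λ x∈s → ℕ.s<s⁻¹ (s<b (Vec.there x∈s)))
subset-bound (Bool.false Vec.∷ s) b       s<b = subset-bound s b λ x∈s → ℕ.<-trans (ℕ.n<1+n _) (s<b (Vec.there x∈s))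

module Heights (𝒟 : FerrersDiagram n) where
  open FerrersDiagram 𝒟

  ∉⇒height≤ : ∀ {i j} → i ∉ column j → height j ℕ.≤ toℕ i
  ∉⇒height≤ {i} {j} i∉ = subset-bound (column j) (toℕ i)
    λ x∈ → ℕ.≰⇒> λ i≤x → i∉ (top-justified x∈ i≤x)

  height≤n : ∀ j → height j ℕ.≤ n
  height≤n j = ∣p∣≤n (column j)

  height-mono : ∀ {j j′} → j Fin.≤ j′ → height j ℕ.≤ height j′
  height-mono j≤j′ = p⊆q⇒∣p∣≤∣q∣ λ i∈ → right-justified i∈ j≤j′

  νmin≤ν : ∀ {d j} → j ℕ.< d → νmin 𝒟 d ℕ.≤ ν 𝒟 d j
  νmin≤ν {d} {j} j<d = lookup (min≤xs (ν 𝒟 d 0) (List.map (ν 𝒟 d) (List.upTo d))) (∈-map⁺ (ν 𝒟 d) (∈-upTo⁺ j<d))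

-- The indicator of m < x as a number: row lengths become sums over the columns, and the two
-- summations can be exchanged.
lt : ℕ → ℕ → ℕ
lt _       zero    = 0
lt zero    (suc x) = 1
lt (suc m) (suc x) = lt m x

lt≤1 : ∀ m x → lt m x ℕ.≤ 1
lt≤1 m       zero    = ℕ.z≤n
lt≤1 zero    (suc x) = ℕ.≤-refl
lt≤1 (suc m) (suc x) = lt≤1 m x

lt-antitone : ∀ m x → lt (suc m) x ℕ.≤ lt m x
lt-antitone m       zero    = ℕ.z≤n
lt-antitone zero    (suc x) = lt≤1 zero x
lt-antitone (suc m) (suc x) = lt-antitone m x

lt-boundary : ∀ m → lt (suc m) (suc m) ℕ.< lt m (suc m)
lt-boundary zero    = ℕ.z<s
lt-boundary (suc m) = lt-boundary m

lt-≥ : ∀ m x → x ℕ.≤ m → lt m x ≡ 0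
lt-≥ m       zero    _           = ≡.refl
lt-≥ (suc m) (suc x) (ℕ.s≤s x≤m) = lt-≥ m x x≤m

lt-positive : ∀ m x → 0 ℕ.< lt m x → m ℕ.< x
lt-positive zero    (suc x) _   = ℕ.z<s
lt-positive (suc m) (suc x) 0<lt = ℕ.s<s (lt-positive m x 0<lt)

∸-suc-lt : ∀ m x → x ℕ.∸ suc m ℕ.+ lt m x ≡ x ℕ.∸ m
∸-suc-lt m       zero    = ≡.trans (ℕ.+-identityʳ (0 ℕ.∸ suc m)) (≡.trans (ℕ.0∸n≡0 (suc m)) (≡.sym (ℕ.0∸n≡0 m)))
∸-suc-lt zero    (suc x) = ℕ.+-comm x 1
∸-suc-lt (suc m) (suc x) = ∸-suc-lt m x

-- Counts the cells of a column of height x in the N lowest rows h - N + 1, ..., h, which are the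
-- cells beyond the first n - N.
∑-lt : ∀ h x → x ℕ.≤ suc h → ∀ N → N ℕ.≤ suc h → ∑ {N} (λ i → lt (h ℕ.∸ toℕ i) x) ≡ x ℕ.∸ (suc h ℕ.∸ N)
∑-lt h x x≤n zero    _   = ≡.sym (ℕ.m≤n⇒m∸n≡0 x≤n)
∑-lt h x x≤n (suc N) N<n = ≡.trans (∑-init-last {N} (λ i → lt (h ℕ.∸ toℕ i) x))
  (≡.trans (≡.cong₂ ℕ._+_
    (≡.trans (∑-cong {N} λ i → ≡.cong (λ j → lt (h ℕ.∸ j) x) (Fin.toℕ-inject₁ i))
      (≡.trans (∑-lt h x x≤n N (ℕ.<⇒≤ N<n)) (≡.cong (x ℕ.∸_) (ℕ.+-∸-assoc 1 (ℕ.s≤s⁻¹ N<n)))))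
    (≡.cong (λ j → lt (h ℕ.∸ j) x) (Fin.toℕ-fromℕ N)))
  (∸-suc-lt (h ℕ.∸ N) x))

-- The column heights of the diagram reflected in its antidiagonal.
module Reflection {h : ℕ} (𝒟 : FerrersDiagram (suc h)) where
  open FerrersDiagram 𝒟
  open Heights 𝒟

  rowLength : ℕ → ℕ
  rowLength m = ∑ λ j → lt m (height j)

  reflected : Fin (suc h) → ℕ
  reflected i = rowLength (h ℕ.∸ toℕ i)

  reflected≤n : ∀ i → reflected i ℕ.≤ suc h
  reflected≤n i = ∑-bound (λ j → lt (h ℕ.∸ toℕ i) (height j)) (λ j → lt≤1 (h ℕ.∸ toℕ i) (height j)) 0 λ _ ()

  -- Discrete intermediate values: walking left, the height drops by at most one per column and is
  -- at most 1 in column 0, so no positive value is skipped.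
  intermediate : InitiallyConvex 𝒟 → ∀ m k j → toℕ j ≡ k → suc m ℕ.≤ height j → ∃ λ j′ → height j′ ≡ suc m
  intermediate (first , step) m zero    j j≡0 m<h =
    j , ℕ.≤-antisym (ℕ.≤-trans (first j≡0) (ℕ.s≤s ℕ.z≤n)) m<h
  intermediate convex@(_ , step) m (suc k) (suc j) j≡k m<h with ℕ.m≤n⇒m<n∨m≡n m<h
  ... | inj₂ eq  = suc j , ≡.sym eq
  ... | inj₁ m+1<h = intermediate convex m k (inject₁ j) (≡.trans (Fin.toℕ-inject₁ j) (ℕ.suc-injective j≡k))
    (ℕ.s≤s⁻¹ (ℕ.≤-trans m+1<h (step (≡.cong suc (≡.sym (Fin.toℕ-inject₁ j))))))

  -- If row m′ + 1 is nonempty, some column has height exactly m′ + 1. It meets row m′ but not row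
  -- m′ + 1, so row m′ is strictly longer.
  reflected-strict : InitiallyConvex 𝒟 → ColumnStrict reflected
  reflected-strict convex {i} {i′} i′≡1+i 0<r =
    ≡.subst (λ m → rowLength m ℕ.< reflected i′) (≡.sym m≡1+m′) strict
    where
    m′ = h ℕ.∸ toℕ i′
    m≡1+m′ : h ℕ.∸ toℕ i ≡ suc m′
    m≡1+m′ = ≡.trans (ℕ.+-∸-assoc 1 {h} {suc (toℕ i)} i<h) (≡.cong (λ k → suc (h ℕ.∸ k)) (≡.sym i′≡1+i))
      where
      i<h : suc (toℕ i) ℕ.≤ h
      i<h = ≡.subst (ℕ._≤ h) i′≡1+i (ℕ.s≤s⁻¹ (Fin.toℕ<n i′))
    strict : rowLength (suc m′) ℕ.< rowLength m′
    strict with ∑-positive (λ j → lt (suc m′) (height j)) (≡.subst (λ m → 0 ℕ.< rowLength m) m≡1+m′ 0<r)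
    ... | j , 0<lt with intermediate convex m′ (toℕ j) j ≡.refl (ℕ.<⇒≤ (lt-positive (suc m′) (height j) 0<lt))
    ... | j′ , height≡ = ∑-mono-< _ _ (λ j → lt-antitone m′ (height j)) j′
      (≡.subst (λ x → lt (suc m′) x ℕ.< lt m′ x) (≡.sym height≡) (lt-boundary m′))

  toℕ-opposite : (i : Fin (suc h)) → toℕ (Fin.opposite i) ≡ h ℕ.∸ toℕ i
  toℕ-opposite i = Fin.opposite-prop i

  -- A row that misses column j misses every column to its left as well, so its length is at most h
  -- - j.
  ∉⇒reflected≤ : ∀ {i j} → i ∉ column j → reflected (Fin.opposite i) ℕ.≤ toℕ (Fin.opposite j)
  ∉⇒reflected≤ {i} {j} i∉ = ≡.subst₂ (λ m b → rowLength m ℕ.≤ b) (≡.sym i≡) (≡.sym (toℕ-opposite j))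
    (∑-bound (λ j′ → lt (toℕ i) (height j′)) (λ j′ → lt≤1 (toℕ i) (height j′)) (suc (toℕ j)) λ j′ j′≤j →
      lt-≥ (toℕ i) (height j′) (ℕ.≤-trans (height-mono (ℕ.s≤s⁻¹ j′≤j)) (∉⇒height≤ i∉)))
    where
    i≡ : h ℕ.∸ toℕ (Fin.opposite i) ≡ toℕ i
    i≡ = ≡.trans (≡.cong (h ℕ.∸_) (toℕ-opposite i)) (ℕ.m∸[m∸n]≡n (ℕ.s≤s⁻¹ (Fin.toℕ<n i)))

  -- Double counting of the cells below the first j rows: by columns on the left, where the summand
  -- is the height minus j, and by the k + 1 lowest rows on the right.
  ν≡∑-reflected : ∀ {j k} (j+k≡h : j ℕ.+ k ≡ h) (k<n : suc k ℕ.≤ suc h) →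
                  ν 𝒟 (suc j) 0 ≡ ∑ {suc k} λ i → reflected (Fin.inject≤ i k<n)
  ν≡∑-reflected {j} {k} j+k≡h k<n = ≡.trans
    (sum-tabulate {suc h} λ i → height (Fin.inject≤ i (ℕ.m∸n≤m (suc h) 0)) ℕ.+ 1 ℕ.∸ suc j) (≡.trans
    (∑-cong {suc h} λ i → ≡.trans (≡.cong (ℕ._∸ suc j) (ℕ.+-comm (height (Fin.inject≤ i (ℕ.m∸n≤m (suc h) 0))) 1)) (≡.trans
      (≡.cong (λ i → height i ℕ.∸ j) (Fin.toℕ-injective (Fin.toℕ-inject≤ i (ℕ.m∸n≤m (suc h) 0))))
      (≡.trans (≡.cong (height i ℕ.∸_) (≡.sym (≡.trans (≡.cong (ℕ._∸ k) (≡.sym j+k≡h)) (ℕ.m+n∸n≡m j k))))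
               (≡.sym (∑-lt h (height i) (height≤n i) (suc k) k<n)))))
    (≡.trans (∑-swap {suc h} {suc k} λ i m → lt (h ℕ.∸ toℕ m) (height i))
      (∑-cong {suc k} λ m → ≡.cong (λ m → rowLength (h ℕ.∸ m)) (≡.sym (Fin.toℕ-inject≤ m k<n)))))

-- Assembly of the codes in the two cases

module Construction {F : FiniteField c ℓ} {h : ℕ} (E : Extension F h) {k κ : ℕ} (k≤h : k ℕ.≤ h)
  (height : Fin (suc h) → ℕ) (strict : ColumnStrict height) (height≤ : ∀ j → height j ℕ.≤ suc h)
  (κ≤∑ : κ ℕ.≤ ∑ {suc k} λ i → height (Fin.inject≤ i (ℕ.s≤s k≤h))) where

  open FiniteField F
  open Indicator discreteField

  -- This makes Δ^k available in a code of positive dimension: some column among the first k + 1 is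
  -- nonempty, and from there on strictness keeps the columns nonempty.
  positive-top : 0 ℕ.< κ → 0 ℕ.< height (Fin.inject≤ (fromℕ k) (ℕ.s≤s k≤h))
  positive-top 0<κ with ∑-positive {suc k} (λ i → height (Fin.inject≤ i (ℕ.s≤s k≤h))) (ℕ.≤-trans 0<κ κ≤∑)
  ... | i , 0<hᵢ = ℕ.≤-trans 0<hᵢ (ℕ.≤-trans (ℕ.m≤m+n _ (k ℕ.∸ toℕ i))
    (strict-growth height strict (k ℕ.∸ toℕ i)
      (≡.trans (Fin.toℕ-inject≤ (fromℕ k) _) (≡.trans (Fin.toℕ-fromℕ k)
        (≡.sym (≡.trans (≡.cong (ℕ._+ (k ℕ.∸ toℕ i)) (Fin.toℕ-inject≤ i (ℕ.s≤s k≤h)))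
                        (ℕ.m+[n∸m]≡n (ℕ.s≤s⁻¹ (Fin.toℕ<n i)))))))
      0<hᵢ))

  selection : Selection κ (λ i → height (Fin.inject≤ i (ℕ.s≤s k≤h))) (fromℕ k) zero
  selection = select κ _ (λ i → height≤ _) κ≤∑ (fromℕ k) positive-top

  open Selection selection
  open CodeMatrices E k≤h height strict height≤ order row injective bounded

  matrixFamily : MatrixFamily discreteField k κ height
  matrixFamily = record
    { matrix             = matrix
    ; supported          = matrix-supported
    ; factorizationBound = factorization-bound
    ; shift-member       = Sum.map₂ (λ { (t , order≡ , row≡) → t , matrix-shift t order≡ row≡ }) corner
    }

module _ (K : DiscreteField c ℓ) where
  open Indicator K

  -- Reflection in the antidiagonal preserves the difference j - r.
  shift-opposite : ∀ {h} k (r j : Fin (suc h)) →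
                   shift k (Fin.opposite j) (Fin.opposite r) ≡ shift k r j
  shift-opposite {h} k r j with toℕ j ℕ.≟ toℕ r ℕ.+ k
  ... | yes j≡r+k = when-true (_ ℕ.≟ _) (≡.trans (Fin.opposite-prop r) (≡.trans h∸r≡ (≡.cong (ℕ._+ k) (≡.sym (Fin.opposite-prop j)))))
    where
    h∸r≡ : h ℕ.∸ toℕ r ≡ h ℕ.∸ toℕ j ℕ.+ k
    h∸r≡ = ≡.sym (≡.trans (≡.cong (λ m → h ℕ.∸ m ℕ.+ k) j≡r+k)
      (≡.trans (≡.cong (ℕ._+ k) (≡.sym (ℕ.∸-+-assoc h (toℕ r) k)))
               (ℕ.m∸n+n≡m (ℕ.m+n≤o⇒m≤o∸n k (≡.subst (ℕ._≤ h) (≡.trans j≡r+k (ℕ.+-comm (toℕ r) k)) (ℕ.s≤s⁻¹ (Fin.toℕ<n j)))))))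
  ... | no j≢r+k = when-false (_ ℕ.≟ _) λ eq → j≢r+k (ℕ.+-cancelˡ-≡ (h ℕ.∸ toℕ j) (toℕ j) (toℕ r ℕ.+ k) (≡.trans
      (ℕ.m∸n+n≡m (ℕ.s≤s⁻¹ (Fin.toℕ<n j)))
      (≡.trans (≡.sym (ℕ.m∸n+n≡m (ℕ.s≤s⁻¹ (Fin.toℕ<n r))))
      (≡.trans (≡.cong (ℕ._+ toℕ r) (≡.trans (≡.sym (Fin.opposite-prop r)) (≡.trans eq (≡.cong (ℕ._+ k) (Fin.opposite-prop j)))))
      (≡.trans (ℕ.+-assoc (h ℕ.∸ toℕ j) k (toℕ r)) (≡.cong (h ℕ.∸ toℕ j ℕ.+_) (ℕ.+-comm k (toℕ r))))))))

ν≡∑-height : ∀ {h j k} (𝒟 : FerrersDiagram (suc h)) → suc h ℕ.∸ j ≡ suc k → (k<n : suc k ℕ.≤ suc h) →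
  ν 𝒟 (suc j) j ≡ ∑ {suc k} λ i → FerrersDiagram.height 𝒟 (Fin.inject≤ i k<n)
ν≡∑-height {h} {j} {k} 𝒟 eq k<n = go (suc h ℕ.∸ j) (ℕ.m∸n≤m (suc h) j) eq
  where
  open FerrersDiagram 𝒟
  -- `suc h ∸ j` is generalised to a variable so that matching on the equation identifies the two
  -- index types. With d = suc j the summand loses exactly what was added to the height.
  go : ∀ N (N≤n : N ℕ.≤ suc h) → N ≡ suc k →
       ListAction.sum (List.tabulate {n = N} λ i → (height (Fin.inject≤ i N≤n) ℕ.+ suc j) ℕ.∸ suc j) ≡
       ∑ {suc k} λ i → height (Fin.inject≤ i k<n)
  go N N≤n ≡.refl = ≡.trans (sum-tabulate {suc k} λ i → (height (Fin.inject≤ i N≤n) ℕ.+ suc j) ℕ.∸ suc j)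
    (∑-cong {suc k} λ i → ℕ.m+n∸n≡m (height (Fin.inject≤ i N≤n)) (suc j))

module Codes (𝔽 : HeytingField c ℓ₁ ℓ₂) (decision : Decision 𝔽) {p : ℕ}
  (enumeration : Enumeration (DiscreteField.setoid (Decision.discreteField decision)) (2 ℕ.+ p)) where

  F : FiniteField c ℓ₁
  F = record
    { discreteField = Decision.discreteField decision
    ; predpred      = p
    ; enumeration   = enumeration
    }

  module _ {h j : ℕ} (E : Extension F h) (j≤h : j ℕ.≤ h) (𝒟 : FerrersDiagram (suc h)) where
    open FerrersDiagram 𝒟
    open Heights 𝒟

    private
      module F = FiniteField F
      open Indicator F.discreteField using (shift)
      -- This is n - d, for n = suc h and d = suc j.
      k = h ℕ.∸ j
      κ = νmin 𝒟 (suc j)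
      k≤h : k ℕ.≤ h
      k≤h = ℕ.m∸n≤m h j
      n≡k+d : suc h ≡ k ℕ.+ suc j
      n≡k+d = ≡.sym (≡.trans (ℕ.+-suc k j) (≡.cong suc (ℕ.m∸n+n≡m j≤h)))


    open CodeAssembly 𝔽 decision {k = k} {κ = κ} n≡k+d (ℕ.z<s {j}) using (code)

    strictly-monotone-code : StrictlyMonotone 𝒟 → ExistsCode 𝔽 𝒟 κ (suc j)
    strictly-monotone-code strict = assemble matrixFamily
      where
      κ≤∑ : κ ℕ.≤ ∑ {suc k} λ i → height (Fin.inject≤ i (ℕ.s≤s k≤h))
      κ≤∑ = ℕ.≤-trans (νmin≤ν (ℕ.n<1+n j))
        (ℕ.≤-reflexive (ν≡∑-height {h} {j} 𝒟 (ℕ.+-∸-assoc 1 j≤h) (ℕ.s≤s k≤h)))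
      open Construction E k≤h height strict height≤n κ≤∑ using (matrixFamily)
      assemble : MatrixFamily F.discreteField k κ height → ExistsCode 𝔽 𝒟 κ (suc j)
      assemble family = Span (matrices 𝔽 (suc h)) matrix
        , code 𝒟 matrix (λ t {r} {i} r∉ → supported t r i (∉⇒height≤ r∉)) factorizationBound shift-member
        where open MatrixFamily family

    initially-convex-code : InitiallyConvex 𝒟 → ExistsCode 𝔽 𝒟 κ (suc j)
    initially-convex-code convex = assemble matrixFamily
      where
      open Reflection 𝒟
      κ≤∑ : κ ℕ.≤ ∑ {suc k} λ i → reflected (Fin.inject≤ i (ℕ.s≤s k≤h))
      κ≤∑ = ℕ.≤-trans (νmin≤ν {suc j} ℕ.z<s)
        (ℕ.≤-reflexive (ν≡∑-reflected {j} {k} (ℕ.m+[n∸m]≡n j≤h) (ℕ.s≤s k≤h)))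
      open Construction E k≤h reflected (reflected-strict convex) reflected≤n κ≤∑ using (matrixFamily)
      assemble : MatrixFamily F.discreteField k κ reflected → ExistsCode 𝔽 𝒟 κ (suc j)
      assemble family = Span (matrices 𝔽 (suc h)) reflectedMatrix
        , code 𝒟 reflectedMatrix
            (λ t {r} {i} r∉ → supported t (Fin.opposite i) (Fin.opposite r) (∉⇒reflected≤ r∉))
            bound corner
        where
        open MatrixFamily family
        reflectedMatrix : Fin κ → Matrix 𝔽 (suc h)
        reflectedMatrix t r i = matrix t (Fin.opposite i) (Fin.opposite r)
        bound : FactorizationBound F.discreteField k reflectedMatrix
        -- Reflection in the antidiagonal reverses products: a factorization W M of the reflected
        -- combination yields one of the original, with the reflected factors exchanged.
        bound s s≉0 ρ W M factorization = factorizationBound s s≉0 ρ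
          (λ r u → M u (Fin.opposite r)) (λ u i → W (Fin.opposite i) u) λ r i → begin
            F.sum (λ t → s t F.* matrix t r i)
              ≈⟨ F.sum-cong-≋ (λ t → F.reflexive (≡.cong₂ (λ r i → s t F.* matrix t r i)
                   (Fin.opposite-involutive r) (Fin.opposite-involutive i))) ⟨
            F.sum (λ t → s t F.* reflectedMatrix t (Fin.opposite i) (Fin.opposite r))
              ≈⟨ factorization (Fin.opposite i) (Fin.opposite r) ⟩
            F.sum (λ u → W (Fin.opposite i) u F.* M u (Fin.opposite r))
              ≈⟨ F.sum-cong-≋ (λ u → F.*-comm (W (Fin.opposite i) u) (M u (Fin.opposite r))) ⟩
            F.sum (λ u → M u (Fin.opposite r) F.* W (Fin.opposite i) u) ∎
          where open SetoidReasoning F.setoid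
        corner : κ ≡ 0 ⊎ ∃ λ t → ∀ r i → reflectedMatrix t r i F.≈ shift k r i
        corner = Sum.map₂ (λ { (t , matrix≈shift) → t , λ r i →
          F.trans (matrix≈shift (Fin.opposite i) (Fin.opposite r))
                  (F.reflexive (shift-opposite F.discreteField k r i)) }) shift-member

theorem4p10 : ∀ {c ℓ₁ ℓ₂ : Level} (d n : ℕ) → 1 ≤ d → d ≤ n →
    ((𝒟 : FerrersDiagram n) → StrictlyMonotone 𝒟 →
    (𝔽 : HeytingField c ℓ₁ ℓ₂) → IsFiniteField 𝔽 → ExistsCode 𝔽 𝒟 (νmin 𝒟 d) d)
    ×
    ((𝒟 : FerrersDiagram n) → InitiallyConvex 𝒟 →
    (𝔽 : HeytingField c ℓ₁ ℓ₂) → IsFiniteField 𝔽 → ExistsCode 𝔽 𝒟 (νmin 𝒟 d) d)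
theorem4p10 (suc j) (suc h) _ (ℕ.s≤s j≤h) = part₁ , part₂
  where
  part₁ : ∀ 𝒟 → StrictlyMonotone 𝒟 → ∀ 𝔽 → IsFiniteField 𝔽 → ExistsCode 𝔽 𝒟 (νmin 𝒟 (suc j)) (suc j)
  part₁ 𝒟 strict 𝔽 (_ , bijection) with FromHeytingField.size≥2 𝔽 bijection
  -- An extension of height h carries a chain of h + 1 = n elements.
  ... | p , ≡.refl = strictly-monotone-code (extension F h) j≤h 𝒟 strict
    where
    open FromHeytingField 𝔽
    open Codes 𝔽 (decision bijection) (Bijection⇒Inverse bijection)
  part₂ : ∀ 𝒟 → InitiallyConvex 𝒟 → ∀ 𝔽 → IsFiniteField 𝔽 → ExistsCode 𝔽 𝒟 (νmin 𝒟 (suc j)) (suc j)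
  part₂ 𝒟 convex 𝔽 (_ , bijection) with FromHeytingField.size≥2 𝔽 bijection
  ... | p , ≡.refl = initially-convex-code (extension F h) j≤h 𝒟 convex
    where
    open FromHeytingField 𝔽
    open Codes 𝔽 (decision bijection) (Bijection⇒Inverse bijection)
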